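{- Let $n\ge1$ and let $\widetilde{t_n}(q)$ be the unique polynomial of degree at most $n-1$ congruent to $t_n(q)=\sum_{s=1}^n\begin{bmatrix} 2n-s-1\\ n-1\end{bmatrix}_q$ modulo $q^n-1$. The number of infinite, positive integral frieze patterns with principal growth coefficient $2$ and minimal period $n$, counted up to global shift of the rows, equals the coefficient $[q^1]\widetilde{t_n}(q)$. Equivalently, the number of such frieze patterns (not up to shift) is $n\,[q^1]\widetilde{t_n}(q)$.
   Context: An infinite frieze pattern over $\mathbb{R}$ is a function $F$ on $\{(i,j)\in\mathbb{Z}^2: j\ge i\}$ with $F(i,i)=0$ and $F(i,i+1)=1$ for all $i$, and $F(i,j)F(i+1,j+1)-F(i+1,j)F(i,j+1)=1$ for all $j\ge i+1$. It is positive integral if $F(i,j)$ is a positive integer whenever $j>i$. All infinite frieze patterns here are assumed periodic: there is $p\ge1$ with $F(i+p,j+p)=F(i,j)$ for all $i\le j$. The quiddity row is the sequence $(F(i,i+2))_{i\in\mathbb{Z}}$; its minimal period equals the minimal period of $F$, called the minimal period of $F$. If $p$ is the minimal period, the difference $F(i,i+p+1)-F(i+1,i+p)$ is independent of $i$; it is called the principal growth coefficient. The global shift sends $F$ to $F'$ with $F'(i,j)=F(i+1,j+1)$. $q$-binomials $\begin{bmatrix} a\\ b\end{bmatrix}_q=\frac{[a]_q!}{[b]_q![a-b]_q!}$ with $[a]_q=1+\cdots+q^{a-1}$; $[q^1]f$ denotes the coefficient of $q$ in $f$.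
   Formalization: For n = 1 the literal coefficient of q in the constant polynomial is 0, but there is one such frieze pattern, F(i,j) = j − i; exponents are therefore read modulo n, so for n = 1 the constant term is used. For n ≥ 2 it is the literal coefficient of q. -}

module Defs where

open import Data.Nat.Base as ℕ using (ℕ; zero; suc; NonZero; _∸_; _%_)
open import Data.Integer.Base as ℤ using (ℤ; +_; 0ℤ; 1ℤ; -1ℤ)
import Data.Integer.Properties as ℤₚ
open import Data.Fin.Base using (Fin)
open import Data.List.Base using (List; []; _∷_; [_]; _++_; map; foldr; replicate; length; drop; upTo)
open import Data.Product.Base using (∃; _×_; _,_)
open import Function.Bundles using (Inverse)
open import Level using (0ℓ)
open import Relation.Binary.Bundles using (Setoid)
open import Relation.Binary.PropositionalEquality using (_≡_; refl; sym; trans; cong; cong₂)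
import Relation.Binary.PropositionalEquality.Properties as ≡

-- Coefficients with the constant term first; trailing zeros are allowed, so
-- the equality of polynomials is _≈ₚ_ rather than _≡_.
Poly : Set
Poly = List ℤ

coeff : Poly → ℕ → ℤ
coeff []      _       = 0ℤ
coeff (a ∷ _) zero    = a
coeff (_ ∷ f) (suc k) = coeff f k

infix 4 _≈ₚ_
_≈ₚ_ : Poly → Poly → Set
f ≈ₚ g = ∀ k → coeff f k ≡ coeff g k

infixl 6 _+ₚ_ _-ₚ_
infixl 7 _*ₚ_ _/ₚ_
infixr 8 _·ₚ_

_+ₚ_ : Poly → Poly → Poly
[]      +ₚ g       = g
(a ∷ f) +ₚ []      = a ∷ f
(a ∷ f) +ₚ (b ∷ g) = (a ℤ.+ b) ∷ (f +ₚ g)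

_·ₚ_ : ℤ → Poly → Poly
c ·ₚ f = map (c ℤ.*_) f

_-ₚ_ : Poly → Poly → Poly
f -ₚ g = f +ₚ (-1ℤ ·ₚ g)

_*ₚ_ : Poly → Poly → Poly
[]      *ₚ g = []
(a ∷ f) *ₚ g = (a ·ₚ g) +ₚ (0ℤ ∷ (f *ₚ g))

q^_ : ℕ → Poly
q^ n = replicate n 0ℤ ++ [ 1ℤ ]

DegreeAtMost : ℕ → Poly → Set
DegreeAtMost d f = ∀ k → d ℕ.< k → coeff f k ≡ 0ℤ

infix 4 _≡_[mod_]
_≡_[mod_] : Poly → Poly → Poly → Set
f ≡ g [mod m ] = ∃ λ h → f -ₚ g ≈ₚ h *ₚ m

-- The first k coefficients of f / g, by long division starting from the
-- constant term; this is meaningful when g has constant term 1.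
quotient : ℕ → Poly → Poly → Poly
quotient zero    f g = []
quotient (suc k) f g = c ∷ quotient k (drop 1 (f -ₚ c ·ₚ g)) g
  where c = coeff f 0

-- Whenever g has constant term 1 and divides f, this is the exact quotient,
-- because the quotient has no coefficients beyond the degree of f.
_/ₚ_ : Poly → Poly → Poly
f /ₚ g = quotient (length f) f g

[_]q : ℕ → Poly
[ a ]q = replicate a 1ℤ

[_]q! : ℕ → Poly
[ zero  ]q! = [ 1ℤ ]
[ suc a ]q! = [ suc a ]q *ₚ [ a ]q!

-- Used only for b ≤ a.  The divisor has constant term 1.
qBinomial : ℕ → ℕ → Poly
qBinomial a b = [ a ]q! /ₚ ([ b ]q! *ₚ [ a ∸ b ]q!)

-- The index i runs over 0, …, n - 1, so s = suc i runs over 1, …, n.  Then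
-- 2n - s - 1 ≥ n - 1 ≥ 0, hence no subtraction is truncated when n ≥ 1.
t : ℕ → Poly
t n = foldr _+ₚ_ [] (map (λ i → qBinomial (2 ℕ.* n ∸ suc i ∸ 1) (n ∸ 1)) (upTo n))

-- These two conditions determine f uniquely up to _≈ₚ_.
IsReducedT : (n : ℕ) → Poly → Set
IsReducedT n f = DegreeAtMost (n ∸ 1) f × f ≡ t n [mod q^ n -ₚ [ 1ℤ ] ]

-- The coefficient of q in the reduced representative f of a class modulo
-- q^n - 1.  Exponents count modulo n: for n ≥ 2 this is coeff f 1, and for
-- n = 1, where q ≡ 1, it is the constant term.  The case n = 1 matters: the
-- frieze F(i,j) = j - i has period 1 and growth coefficient 2, whereas a
-- constant polynomial has zero coefficient at exponent 1.
linearCoefficientMod : (n : ℕ) → .{{NonZero n}} → Poly → ℤ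
linearCoefficientMod n f = coeff f (1 % n)

-- A positive integral frieze over ℝ has all of its entries in ℤ, so entries
-- are taken there.  Only the entries with i ≤ j are part of the frieze: the
-- values of `entry` elsewhere are unconstrained, and are ignored by every
-- definition below, in particular by the equality _≈_.
record InfiniteFrieze : Set where
  field
    entry : ℤ → ℤ → ℤ
    entry-diagonal      : ∀ i → entry i i ≡ 0ℤ
    entry-superdiagonal : ∀ i → entry i (i ℤ.+ 1ℤ) ≡ 1ℤ
    diamond : ∀ i j → i ℤ.+ 1ℤ ℤ.≤ j →
      entry i j ℤ.* entry (i ℤ.+ 1ℤ) (j ℤ.+ 1ℤ)
        ℤ.- entry (i ℤ.+ 1ℤ) j ℤ.* entry i (j ℤ.+ 1ℤ) ≡ 1ℤ

open InfiniteFrieze public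

PositiveIntegral : InfiniteFrieze → Set
PositiveIntegral F = ∀ i j → i ℤ.< j → 0ℤ ℤ.< entry F i j

IsPeriod : InfiniteFrieze → ℕ → Set
IsPeriod F p =
  1 ℕ.≤ p × (∀ i j → i ℤ.≤ j → entry F (i ℤ.+ + p) (j ℤ.+ + p) ≡ entry F i j)

IsMinimalPeriod : InfiniteFrieze → ℕ → Set
IsMinimalPeriod F p = IsPeriod F p × (∀ p′ → IsPeriod F p′ → p ℕ.≤ p′)

HasPrincipalGrowthCoefficient : InfiniteFrieze → ℤ → Set
HasPrincipalGrowthCoefficient F c = ∃ λ p → IsMinimalPeriod F p ×
  (∀ i → entry F i (i ℤ.+ + p ℤ.+ 1ℤ) ℤ.- entry F (i ℤ.+ 1ℤ) (i ℤ.+ + p) ≡ c)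

infix 4 _≈_
_≈_ : InfiniteFrieze → InfiniteFrieze → Set
F ≈ G = ∀ i j → i ℤ.≤ j → entry F i j ≡ entry G i j

-- G is obtained from F by iterating the global shift, or its inverse.
infix 4 _≈-upToShift_
_≈-upToShift_ : InfiniteFrieze → InfiniteFrieze → Set
F ≈-upToShift G =
  ∃ λ (k : ℤ) → ∀ i j → i ℤ.≤ j → entry G i j ≡ entry F (i ℤ.+ k) (j ℤ.+ k)

record CountedFrieze (n : ℕ) : Set where
  field
    frieze           : InfiniteFrieze
    positiveIntegral : PositiveIntegral frieze
    minimalPeriod    : IsMinimalPeriod frieze n
    growth           : HasPrincipalGrowthCoefficient frieze (+ 2)

open CountedFrieze public

Friezes : ℕ → Setoid 0ℓ 0ℓ
Friezes n = record
  { Carrier = CountedFrieze n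
  ; _≈_     = λ F G → frieze F ≈ frieze G
  ; isEquivalence = record
    { refl  = λ i j _ → refl
    ; sym   = λ p i j i≤j → sym (p i j i≤j)
    ; trans = λ p q i j i≤j → trans (p i j i≤j) (q i j i≤j)
    }
  }

FriezesUpToShift : ℕ → Setoid 0ℓ 0ℓ
FriezesUpToShift n = record
  { Carrier = CountedFrieze n
  ; _≈_     = λ F G → frieze F ≈-upToShift frieze G
  ; isEquivalence = record
    { refl  = λ {F} → 0ℤ , λ i j _ →
        sym (cong₂ (entry (frieze F)) (ℤₚ.+-identityʳ i) (ℤₚ.+-identityʳ j))
    ; sym   = λ {F} {G} (k , p) → ℤ.- k , λ i j i≤j →
        trans (sym (cong₂ (entry (frieze F)) (cancel i k) (cancel j k)))
              (sym (p (i ℤ.- k) (j ℤ.- k) (ℤₚ.+-monoˡ-≤ (ℤ.- k) i≤j)))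
    ; trans = λ {F} {G} {H} (k , p) (l , q) → l ℤ.+ k , λ i j i≤j →
        trans (q i j i≤j)
        (trans (p (i ℤ.+ l) (j ℤ.+ l) (ℤₚ.+-monoˡ-≤ l i≤j))
               (cong₂ (entry (frieze F)) (ℤₚ.+-assoc i l k) (ℤₚ.+-assoc j l k)))
    }
  }
  where
  cancel : ∀ i k → i ℤ.- k ℤ.+ k ≡ i
  cancel i k = trans (ℤₚ.+-assoc i (ℤ.- k) k)
              (trans (cong (λ x → i ℤ.+ x) (ℤₚ.+-inverseˡ k)) (ℤₚ.+-identityʳ i))

-- S has exactly N elements up to its equality, where the integer N is thereby
-- asserted to be nonnegative.
NumberOfElements : Setoid 0ℓ 0ℓ → ℤ → Set
NumberOfElements S N = ∃ λ m → + m ≡ N × Inverse S (≡.setoid (Fin m))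

{-# OPTIONS --safe #-}
module Submission where

-- A positive frieze with growth coefficient 2 has unipotent monodromy, so the
-- recurrence given by its quiddity q has a positive periodic solution u, unique
-- up to scaling: q i u(i+1) = u(i) + u(i+2).  These u are the labellings of a
-- cycle in which every label divides the sum of its neighbours; they correspond
-- to the triangulations of a once-punctured disc.  Reading off the number
-- c(i) = ⌈u(i+1) / u(i)⌉ - 1 of peripheral arcs that leave i to the right is
-- local, hence commutes with rotation, and it identifies the quiddities with
-- the cyclic words c of length n and sum less than n.  So one has to count
-- primitive words, and their rotation classes, which all have n elements.
--
-- On the other side, t_n is the sum over m < n of h_m(1, q, …, q^(n-1)).  By
-- Newton's identities, n h_m is, modulo q^n - 1, the sum over the words w of
-- length n and sum m of ∑_k q^(k |Stab w|): both sides have the same components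
-- for the Möbius inverses of the power sums.  The coefficient of q then counts
-- the words with trivial stabiliser.

open import Algebra.Bundles using (CommutativeSemigroup)
open import Data.Fin.Base as Fin using (Fin)
import Data.Fin.Properties as Finₚ
open import Data.Integer.Base as ℤ using (+_; -1ℤ; -[1+_]; -_; 0ℤ; 1ℤ; _*_; _+_; _-_; ℤ; ∣_∣)
open import Data.Integer.DivMod using (_%ℕ_; _/ℕ_; a≡a%ℕn+[a/ℕn]*n)
import Data.Integer.Properties as ℤₚ
import Data.Integer.Tactic.RingSolver as ℤ-Solver
open import Data.List.Base using (List; []; [_]; _++_; _∷_; applyUpTo; deduplicate; downFrom; drop; filter; foldr; length; lookup; map; replicate; upTo)
open import Data.List.Membership.Propositional using (_∈_)
open import Data.List.Membership.Propositional.Properties using (∈-++⁺ʳ; ∈-++⁺ˡ; ∈-++⁻; ∈-applyUpTo⁺; ∈-applyUpTo⁻; ∈-deduplicate⁻; ∈-filter⁺; ∈-filter⁻; ∈-lookup; ∈-map⁺; ∈-map⁻; ∈-upTo⁻)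
open import Data.List.Membership.Propositional.Properties.WithK using (unique∧set⇒bag)
open import Data.List.Properties using (applyUpTo-∷ʳ; length-++; length-applyUpTo; length-map; length-replicate; map-applyUpTo; map-id-local; map-∘; ∷-injectiveʳ; ≡-dec)
open import Data.List.Relation.Binary.BagAndSetEquality using (∼bag⇒↭)
open import Data.List.Relation.Binary.Permutation.Propositional.Properties using (↭-length)
import Data.List.Relation.Unary.All as All
import Data.List.Relation.Unary.All.Properties as All
open import Data.List.Relation.Unary.AllPairs as AllPairs using (AllPairs)
import Data.List.Relation.Unary.AllPairs.Properties as AllPairs
open import Data.List.Relation.Unary.Any as Any using (here; there)
open import Data.List.Relation.Unary.Any.Properties using (lookup-index)
open import Data.List.Relation.Unary.Unique.Propositional using (Unique)
import Data.List.Relation.Unary.Unique.Propositional.Properties as Unique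
open import Data.Nat.Base as ℕ using (NonZero; _%_; _/_; _∸_; _⊔_; suc; s≤s; zero; z≤n; ℕ)
open import Data.Nat.DivMod using ([m+n]%n≡m%n; m%n<n; m*n/n≡m; m/n*n≡m; m<n⇒m%n≡m; m≡m%n+[m/n]*n)
open import Data.Nat.Divisibility using (%-presˡ-∣; *-monoˡ-∣; 1∣_; _∣?_; _∣_; divides; m%n≡0⇒n∣m; m∣m*n; n∣m*n; ∣-refl; ∣-trans; ∣m+n∣m⇒∣n; ∣m∣n⇒∣m+n; ∣⇒≤)
open import Data.Nat.GCD using (gcd; gcd-GCD; gcd-greatest; gcd[m,n]∣m; gcd[m,n]∣n; module Bézout)
open import Data.Nat.Induction using (<-rec)
open import Data.Nat.ListAction using (sum)
open import Data.Nat.Properties as ℕₚ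
import Data.Nat.Tactic.RingSolver as ℕ-Solver
open import Data.Product.Base using (_,_; _×_; proj₁; proj₂; ∃)
open import Data.Sum.Base using ([_,_]′; _⊎_; inj₁; inj₂)
open import Data.Unit.Base using (tt; ⊤)
open import Defs
open import Function.Base using (_∘_; id)
open import Function.Bundles using (Inverse; mk⇔)
open import Level using (0ℓ)
open import Relation.Binary.Bundles using (Setoid)
open import Relation.Binary.Definitions using (tri<; tri>; tri≈)
open import Relation.Binary.PropositionalEquality hiding ([_])
import Relation.Binary.PropositionalEquality.Properties as ≡
open import Relation.Binary.Structures using (IsEquivalence)
open import Relation.Nullary
open import Relation.Nullary.Decidable using (decidable-stable)
open import Relation.Unary using (Decidable)
open import Algebra.Properties.AbelianGroup ℤₚ.+-0-abelianGroup renaming (∙-cancelˡ to +-cancelˡ)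

-- The counting would normally evaluate h_m at roots of unity. Integer functionals replace this: a
-- function f of period n stands for q^k ↦ f k, and `τ e f` collects, up to the factor n, the part
-- of f carried by the characters of ℤ/n of exact order e. On that part the j-th power sum of 1, q,
-- ..., q^(n-1) acts as n or 0 according to whether e divides j. Hence h_m acts as the coefficient
-- of z^m in (1 - z^e)^(-n/e), which is the number of words with period n/e and sum m.
--
-- For friezes, u is the increment F(0, j + n) - F(0, j): the monodromy M satisfies (M - 1)^2 = 0,
-- so the increment is periodic, and positivity of F makes it positive. The sum of c stays below n
-- because each arc cuts off one vertex and a vertex of least label is never cut off. The same count
-- locates the minima of u from c alone, and a minimum is the starting point from which c determines
-- u up to scale.

private variable
  A B : Set

-- Finite sums

∑L : List A → (A → ℤ) → ℤ
∑L []       f = 0ℤ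
∑L (x ∷ xs) f = f x + ∑L xs f

∑ : ℕ → (ℕ → ℤ) → ℤ
∑ n = ∑L (upTo n)

∑L-cong : (xs : List A) {f g : A → ℤ} → (∀ {x} → x ∈ xs → f x ≡ g x) → ∑L xs f ≡ ∑L xs g
∑L-cong []       e = refl
∑L-cong (x ∷ xs) e = cong₂ _+_ (e (here refl)) (∑L-cong xs (e ∘ there))

∑L-+ : (xs : List A) (f g : A → ℤ) → ∑L xs (λ x → f x + g x) ≡ ∑L xs f + ∑L xs g
∑L-+ []       f g = refl
∑L-+ (x ∷ xs) f g rewrite ∑L-+ xs f g = interchange (f x) (g x) (∑L xs f) (∑L xs g)
  where
  interchange : ∀ a b c d → a + b + (c + d) ≡ a + c + (b + d)
  interchange = ℤ-Solver.solve-∀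

∑L-*ˡ : (xs : List A) (c : ℤ) (f : A → ℤ) → ∑L xs (λ x → c * f x) ≡ c * ∑L xs f
∑L-*ˡ []       c f = sym (ℤₚ.*-zeroʳ c)
∑L-*ˡ (x ∷ xs) c f rewrite ∑L-*ˡ xs c f = sym (ℤₚ.*-distribˡ-+ c (f x) _)

∑L-*ʳ : (xs : List A) (c : ℤ) (f : A → ℤ) → ∑L xs (λ x → f x * c) ≡ ∑L xs f * c
∑L-*ʳ xs c f = trans (∑L-cong xs (λ {x} _ → ℤₚ.*-comm (f x) c)) (trans (∑L-*ˡ xs c f) (ℤₚ.*-comm c _))

∑L-zero : (xs : List A) → ∑L xs (λ _ → 0ℤ) ≡ 0ℤ
∑L-zero []       = refl
∑L-zero (x ∷ xs) = trans (ℤₚ.+-identityˡ _) (∑L-zero xs)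

∑L-const : (xs : List A) (c : ℤ) → ∑L xs (λ _ → c) ≡ + length xs * c
∑L-const []       c = sym (ℤₚ.*-zeroˡ c)
∑L-const (x ∷ xs) c = trans (cong (_+_ (c)) (∑L-const xs c)) (sym (ℤₚ.suc-* (+ length xs) c))

∑L-++ : (xs ys : List A) (f : A → ℤ) → ∑L (xs ++ ys) f ≡ ∑L xs f + ∑L ys f
∑L-++ []       ys f = sym (ℤₚ.+-identityˡ _)
∑L-++ (x ∷ xs) ys f = trans (cong (_+_ (f x)) (∑L-++ xs ys f)) (sym (ℤₚ.+-assoc (f x) _ _))

∑L-map : (g : A → B) (xs : List A) (f : B → ℤ) → ∑L (map g xs) f ≡ ∑L xs (f ∘ g)
∑L-map g []       f = refl
∑L-map g (x ∷ xs) f = cong (_+_ (f (g x))) (∑L-map g xs f)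

∑L-swap : (xs : List A) (ys : List B) (f : A → B → ℤ) →
  ∑L xs (λ x → ∑L ys (f x)) ≡ ∑L ys (λ y → ∑L xs (λ x → f x y))
∑L-swap []       ys f = sym (∑L-zero ys)
∑L-swap (x ∷ xs) ys f = trans (cong (_+_ (∑L ys (f x))) (∑L-swap xs ys f))
  (sym (∑L-+ ys (f x) (λ y → ∑L xs (λ x → f x y))))

∑-cong : ∀ n {f g : ℕ → ℤ} → (∀ i → f i ≡ g i) → ∑ n f ≡ ∑ n g
∑-cong n e = ∑L-cong (upTo n) (λ {i} _ → e i)

∑-suc : ∀ n (f : ℕ → ℤ) → ∑ (suc n) f ≡ f 0 + ∑ n (f ∘ suc)
∑-suc n f = cong (_+_ (f 0)) (trans (cong (λ xs → ∑L xs f) (sym (map-applyUpTo id suc n))) (∑L-map suc (upTo n) f))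

∑-snoc : ∀ n (f : ℕ → ℤ) → ∑ (suc n) f ≡ ∑ n f + f n
∑-snoc n f = trans (cong (λ xs → ∑L xs f) (sym (applyUpTo-∷ʳ id n)))
  (trans (∑L-++ (upTo n) (n ∷ []) f) (cong (_+_ (∑ n f)) (ℤₚ.+-identityʳ (f n))))

∑-const : ∀ n c → ∑ n (λ _ → c) ≡ + n * c
∑-const n c = trans (∑L-const (upTo n) c) (cong (λ k → + k * c) (length-upTo n))
  where open import Data.List.Properties using (length-upTo)

Periodic : ℕ → (ℕ → A) → Set
Periodic n f = ∀ i → f (i ℕ.+ n) ≡ f i

Periodic-* : ∀ {n} {f : ℕ → A} → Periodic n f → ∀ k i → f (i ℕ.+ k ℕ.* n) ≡ f i
Periodic-* {n = n} {f} p zero    i = cong f (ℕₚ.+-identityʳ i)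
Periodic-* {n = n} {f} p (suc k) i = trans (cong f (sym (ℕₚ.+-assoc i n (k ℕ.* n)))) (trans (Periodic-* p k (i ℕ.+ n)) (p i))

shift-periodic : ∀ {n} {f : ℕ → A} s → Periodic n f → Periodic n (λ i → f (i ℕ.+ s))
shift-periodic {n = n} {f} s p i = trans (cong f (trans (ℕₚ.+-assoc i n s) (trans (cong (i ℕ.+_) (ℕₚ.+-comm n s)) (sym (ℕₚ.+-assoc i s n))))) (p (i ℕ.+ s))

∑-shift₁ : ∀ n {f : ℕ → ℤ} → Periodic n f → ∑ n (f ∘ suc) ≡ ∑ n f
∑-shift₁ n {f} p = +-cancelˡ (f 0) _ _ (trans (sym (∑-suc n f)) (trans (∑-snoc n f)
  (trans (cong (_+_ (∑ n f)) (p 0)) (ℤₚ.+-comm (∑ n f) (f 0)))))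

∑-shift : ∀ n s {f : ℕ → ℤ} → Periodic n f → ∑ n (λ i → f (i ℕ.+ s)) ≡ ∑ n f
∑-shift n zero    {f} p = ∑-cong n (λ i → cong f (ℕₚ.+-identityʳ i))
∑-shift n (suc s) {f} p = trans (∑-cong n (λ i → cong f (ℕₚ.+-suc i s)))
  (trans (∑-shift₁ n {λ i → f (i ℕ.+ s)} (shift-periodic s p)) (∑-shift n s p))

-- Newton’s identities and Möbius inversion

∑-cong< : ∀ n {f g : ℕ → ℤ} → (∀ i → i ℕ.< n → f i ≡ g i) → ∑ n f ≡ ∑ n g
∑-cong< n e = ∑L-cong (upTo n) (λ {i} i∈ → e i (∈-upTo⁻ i∈))

∑-zero< : ∀ n {f : ℕ → ℤ} → (∀ i → i ℕ.< n → f i ≡ 0ℤ) → ∑ n f ≡ 0ℤ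
∑-zero< n e = trans (∑-cong< n e) (∑L-zero (upTo n))

∑-single : ∀ {n k} {f : ℕ → ℤ} → k ℕ.< n → (∀ i → i ℕ.< n → i ≢ k → f i ≡ 0ℤ) → ∑ n f ≡ f k
∑-single {suc n} {k} {f} k<n e with ℕₚ.m≤n⇒m<n∨m≡n (ℕₚ.≤-pred k<n)
... | inj₁ k<n′ = trans (∑-snoc n f) (trans (cong₂ _+_
        (∑-single k<n′ (λ i i<n → e i (ℕₚ.m<n⇒m<1+n i<n)))
        (e n ℕₚ.≤-refl (λ n≡k → ℕₚ.<-irrefl (sym n≡k) k<n′)))
      (ℤₚ.+-identityʳ (f k)))
... | inj₂ refl = trans (∑-snoc n f) (trans (cong (_+ f n)
        (∑-zero< n (λ i i<n → e i (ℕₚ.m<n⇒m<1+n i<n) (ℕₚ.<⇒≢ i<n))))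
      (ℤₚ.+-identityˡ (f n)))

χ : ∀ {P : Set} → Dec P → ℤ
χ (yes _) = 1ℤ
χ (no  _) = 0ℤ

χ-cong : ∀ {P Q : Set} (P? : Dec P) (Q? : Dec Q) → (P → Q) → (Q → P) → χ P? ≡ χ Q?
χ-cong (yes p) (yes q) f g = refl
χ-cong (yes p) (no ¬q) f g = contradiction (f p) ¬q
χ-cong (no ¬p) (yes q) f g = contradiction (g q) ¬p
χ-cong (no ¬p) (no ¬q) f g = refl

χ-* : ∀ {P Q R : Set} (P? : Dec P) (Q? : Dec Q) (R? : Dec R) →
  (P → Q → R) → (R → P) → (R → Q) → χ P? * χ Q? ≡ χ R?
χ-* (yes p) (yes q) (yes r) f g h = refl
χ-* (yes p) (yes q) (no ¬r) f g h = contradiction (f p q) ¬r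
χ-* (yes p) (no ¬q) (yes r) f g h = contradiction (h r) ¬q
χ-* (yes p) (no ¬q) (no ¬r) f g h = refl
χ-* (no ¬p) Q?      (yes r) f g h = contradiction (g r) ¬p
χ-* (no ¬p) (yes q) (no ¬r) f g h = refl
χ-* (no ¬p) (no ¬q) (no ¬r) f g h = refl

χ-yes : ∀ {P : Set} (P? : Dec P) → P → χ P? ≡ 1ℤ
χ-yes (yes _) p = refl
χ-yes (no ¬p) p = contradiction p ¬p

χ-no : ∀ {P : Set} (P? : Dec P) → ¬ P → χ P? ≡ 0ℤ
χ-no (yes p) ¬p = contradiction p ¬p
χ-no (no _)  ¬p = refl

χ-*-cong : ∀ {P : Set} (P? : Dec P) {x y : ℤ} → (P → x ≡ y) → χ P? * x ≡ χ P? * y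
χ-*-cong (yes p) e = cong (_*_ 1ℤ) (e p)
χ-*-cong (no _)  e = refl

-- The pairing of f with the complete homogeneous symmetric polynomial
-- h_m(q^x : x ∈ xs).
H : List ℕ → ℕ → (ℕ → ℤ) → ℤ
H []       zero    f = f 0
H []       (suc m) f = 0ℤ
H (x ∷ xs) zero    f = f 0
H (x ∷ xs) (suc m) f = H xs (suc m) f + H (x ∷ xs) m (λ w → f (x ℕ.+ w))

H-cong : ∀ xs m {f g : ℕ → ℤ} → (∀ w → f w ≡ g w) → H xs m f ≡ H xs m g
H-cong []       zero    e = e 0
H-cong []       (suc m) e = refl
H-cong (x ∷ xs) zero    e = e 0
H-cong (x ∷ xs) (suc m) e = cong₂ _+_ (H-cong xs (suc m) e) (H-cong (x ∷ xs) m (λ w → e (x ℕ.+ w)))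

H-zero : ∀ xs (f : ℕ → ℤ) → H xs 0 f ≡ f 0
H-zero []       f = refl
H-zero (x ∷ xs) f = refl

H-∑L : ∀ xs m (ks : List A) (g : A → ℕ → ℤ) → H xs m (λ w → ∑L ks (λ k → g k w)) ≡ ∑L ks (λ k → H xs m (g k))
H-∑L []       zero    ks g = refl
H-∑L []       (suc m) ks g = sym (∑L-zero ks)
H-∑L (x ∷ xs) zero    ks g = refl
H-∑L (x ∷ xs) (suc m) ks g = trans
  (cong₂ _+_ (H-∑L xs (suc m) ks g) (H-∑L (x ∷ xs) m ks (λ k w → g k (x ℕ.+ w))))
  (sym (∑L-+ ks (λ k → H xs (suc m) (g k)) (λ k → H (x ∷ xs) m (λ w → g k (x ℕ.+ w)))))

-- The sum of p_j(ys) h_(m-j)(xs) over 1 ≤ j ≤ m, paired with f. The two lists of variables are kept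
-- apart so that a variable can be removed from one at a time.
powerSums : List ℕ → List ℕ → ℕ → (ℕ → ℤ) → ℤ
powerSums ys xs m f = ∑ m (λ j → ∑L ys (λ y → H xs (m ∸ suc j) (λ w → f (suc j ℕ.* y ℕ.+ w))))

powerSums-∷ʳ : ∀ ys x xs m (f : ℕ → ℤ) →
  powerSums ys (x ∷ xs) (suc m) f ≡ powerSums ys xs (suc m) f + powerSums ys (x ∷ xs) m (λ w → f (x ℕ.+ w))
powerSums-∷ʳ ys x xs m f = begin
  powerSums ys (x ∷ xs) (suc m) f ≡⟨ ∑-snoc m (λ j → ∑L ys (term j)) ⟩
  ∑ m (λ j → ∑L ys (term j)) + ∑L ys (term m) ≡⟨ cong₂ _+_ (∑-cong< m split) (∑L-cong ys (λ {y} _ → last y)) ⟩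
  ∑ m (λ j → ∑L ys (term₁ j) + ∑L ys (term₂ j)) + ∑L ys (term₁ m)
    ≡⟨ cong (_+ ∑L ys (term₁ m)) (∑L-+ (upTo m) (λ j → ∑L ys (term₁ j)) (λ j → ∑L ys (term₂ j))) ⟩
  ∑ m (λ j → ∑L ys (term₁ j)) + ∑ m (λ j → ∑L ys (term₂ j)) + ∑L ys (term₁ m)
    ≡⟨ rearrange (∑ m (λ j → ∑L ys (term₁ j))) _ _ ⟩
  ∑ m (λ j → ∑L ys (term₁ j)) + ∑L ys (term₁ m) + ∑ m (λ j → ∑L ys (term₂ j))
    ≡⟨ cong (_+ ∑ m (λ j → ∑L ys (term₂ j))) (sym (∑-snoc m (λ j → ∑L ys (term₁ j)))) ⟩
  powerSums ys xs (suc m) f + powerSums ys (x ∷ xs) m (λ w → f (x ℕ.+ w)) ∎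
  where
  open ≡-Reasoning
  term term₁ term₂ : ℕ → ℕ → ℤ
  term  j y = H (x ∷ xs) (m ∸ j) (λ w → f (suc j ℕ.* y ℕ.+ w))
  term₁ j y = H xs (m ∸ j) (λ w → f (suc j ℕ.* y ℕ.+ w))
  term₂ j y = H (x ∷ xs) (m ∸ suc j) (λ w → f (x ℕ.+ (suc j ℕ.* y ℕ.+ w)))
  rearrange : ∀ a b c → a + b + c ≡ a + c + b
  rearrange = ℤ-Solver.solve-∀
  last : ∀ y → term m y ≡ term₁ m y
  last y rewrite ℕₚ.n∸n≡0 m = sym (H-zero xs _)
  exchange : ∀ a b c → a ℕ.+ (b ℕ.+ c) ≡ b ℕ.+ (a ℕ.+ c)
  exchange = ℕ-Solver.solve-∀
  split′ : ∀ j → j ℕ.< m → ∀ y → term j y ≡ term₁ j y + term₂ j y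
  split′ j j<m y rewrite sym (ℕₚ.suc-pred (m ∸ j) {{ℕ.>-nonZero (ℕₚ.m<n⇒0<n∸m j<m)}}) | ℕₚ.pred[m∸n]≡m∸[1+n] m j =
    cong (_+_ (H xs (suc (m ∸ suc j)) (λ w → f (suc j ℕ.* y ℕ.+ w))))
      (H-cong (x ∷ xs) (m ∸ suc j) (λ w → cong f (exchange (suc j ℕ.* y) x w)))
  split : ∀ j → j ℕ.< m → ∑L ys (term j) ≡ ∑L ys (term₁ j) + ∑L ys (term₂ j)
  split j j<m = trans (∑L-cong ys (λ {y} _ → split′ j j<m y)) (∑L-+ ys (term₁ j) (term₂ j))

-- Induction along h_m(x, xs) = h_m(xs) + q^x h_(m-1)(x, xs). The single h_(m-1) left over is the
-- term j = 1 of ∑ q^(jx) h_(m-j)(x, xs); the other terms come from degree m - 1, multiplied by q^x.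
newton : ∀ xs m (f : ℕ → ℤ) → + m * H xs m f ≡ powerSums xs xs m f
newton xs       zero    f = ℤₚ.*-zeroˡ (H xs 0 f)
newton []       (suc m) f = trans (ℤₚ.*-zeroʳ (+ suc m)) (sym (∑L-zero (upTo (suc m))))
newton (x ∷ xs) (suc m) f = begin
  + suc m * (H xs (suc m) f + h) ≡⟨ ℤₚ.*-distribˡ-+ (+ suc m) (H xs (suc m) f) h ⟩
  + suc m * H xs (suc m) f + + suc m * h ≡⟨ cong₂ _+_ (newton xs (suc m) f) (ℤₚ.suc-* (+ m) h) ⟩
  powerSums xs xs (suc m) f + (h + + m * h) ≡⟨ cong (λ z → powerSums xs xs (suc m) f + (h + z))
                                                            (trans (newton (x ∷ xs) m f′) (powerSums-∷ˡ m f′)) ⟩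
  powerSums xs xs (suc m) f + (h + (α m f′ + powerSums xs (x ∷ xs) m f′))
    ≡⟨ rearrange (powerSums xs xs (suc m) f) h (α m f′) _ ⟩
  (h + α m f′) + (powerSums xs xs (suc m) f + powerSums xs (x ∷ xs) m f′)
    ≡⟨ cong₂ _+_ (sym α-suc) (sym (powerSums-∷ʳ xs x xs m f)) ⟩
  α (suc m) f + powerSums xs (x ∷ xs) (suc m) f ≡⟨ sym (powerSums-∷ˡ (suc m) f) ⟩
  powerSums (x ∷ xs) (x ∷ xs) (suc m) f ∎
  where
  open ≡-Reasoning
  f′ : ℕ → ℤ
  f′ w = f (x ℕ.+ w)
  h : ℤ
  h = H (x ∷ xs) m f′
  α : ℕ → (ℕ → ℤ) → ℤ
  α k g = ∑ k (λ j → H (x ∷ xs) (k ∸ suc j) (λ w → g (suc j ℕ.* x ℕ.+ w)))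
  powerSums-∷ˡ : ∀ k g → powerSums (x ∷ xs) (x ∷ xs) k g ≡ α k g + powerSums xs (x ∷ xs) k g
  powerSums-∷ˡ k g = ∑L-+ (upTo k) (λ j → H (x ∷ xs) (k ∸ suc j) (λ w → g (suc j ℕ.* x ℕ.+ w))) _
  α-suc : α (suc m) f ≡ h + α m f′
  α-suc = trans (∑-suc m (λ j → H (x ∷ xs) (m ∸ j) (λ w → f (suc j ℕ.* x ℕ.+ w))))
    (cong₂ _+_ (H-cong (x ∷ xs) m (λ w → cong (λ z → f (z ℕ.+ w)) (ℕₚ.+-identityʳ x)))
      (∑-cong m (λ j → H-cong (x ∷ xs) (m ∸ suc j) (λ w → cong f (ℕₚ.+-assoc x (suc j ℕ.* x) w)))))
  rearrange : ∀ a b c d → a + (b + (c + d)) ≡ (b + c) + (a + d)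
  rearrange = ℤ-Solver.solve-∀

∑L-downFrom : ∀ n (f : ℕ → ℤ) → ∑L (downFrom n) f ≡ ∑ n f
∑L-downFrom zero    f = refl
∑L-downFrom (suc n) f = trans (cong (_+_ (f n)) (∑L-downFrom n f)) (trans (ℤₚ.+-comm (f n) (∑ n f)) (sym (∑-snoc n f)))

σ : ℕ → ℕ → (ℕ → ℤ) → ℤ
σ n g f = ∑ n (λ k → f (g ℕ.* k))

average : ℕ → ℕ → (ℕ → ℤ) → ℕ → ℤ
average n j f w = ∑ n (λ k → f (j ℕ.* k ℕ.+ w))

-- Exponents are natural numbers, so a negative Bézout coefficient -y is replaced by y (n - 1), at
-- the cost of a multiple of n.
bézout-mod : ∀ n .{{_ : NonZero n}} g j → ∃ λ α → ∃ λ β → ∃ λ t → gcd g j ℕ.+ t ℕ.* n ≡ α ℕ.* j ℕ.+ β ℕ.* g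
bézout-mod (suc n) g j with Bézout.identity (gcd-GCD g j)
... | Bézout.+- x y e = y ℕ.* n , x , y ℕ.* j , (begin
  gcd g j ℕ.+ y ℕ.* j ℕ.* suc n ≡⟨ rearrange (gcd g j) y j n ⟩
  gcd g j ℕ.+ y ℕ.* j ℕ.+ y ℕ.* n ℕ.* j ≡⟨ cong (ℕ._+ y ℕ.* n ℕ.* j) e ⟩
  x ℕ.* g ℕ.+ y ℕ.* n ℕ.* j ≡⟨ ℕₚ.+-comm (x ℕ.* g) _ ⟩
  y ℕ.* n ℕ.* j ℕ.+ x ℕ.* g             ∎)
  where
  open ≡-Reasoning
  rearrange : ∀ d y j n → d ℕ.+ y ℕ.* j ℕ.* suc n ≡ d ℕ.+ y ℕ.* j ℕ.+ y ℕ.* n ℕ.* j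
  rearrange = ℕ-Solver.solve-∀
... | Bézout.-+ x y e = y , x ℕ.* n , x ℕ.* g , (begin
  gcd g j ℕ.+ x ℕ.* g ℕ.* suc n ≡⟨ rearrange (gcd g j) x g n ⟩
  gcd g j ℕ.+ x ℕ.* g ℕ.+ x ℕ.* n ℕ.* g ≡⟨ cong (ℕ._+ x ℕ.* n ℕ.* g) e ⟩
  y ℕ.* j ℕ.+ x ℕ.* n ℕ.* g             ∎)
  where
  open ≡-Reasoning
  rearrange : ∀ d y j n → d ℕ.+ y ℕ.* j ℕ.* suc n ≡ d ℕ.+ y ℕ.* j ℕ.+ y ℕ.* n ℕ.* j
  rearrange = ℕ-Solver.solve-∀

average-periodic : ∀ {n} j {f : ℕ → ℤ} → Periodic n f → Periodic n (average n j f)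
average-periodic {n} j {f} p w = ∑-cong n (λ k → trans (cong f (sym (ℕₚ.+-assoc (j ℕ.* k) w n))) (p (j ℕ.* k ℕ.+ w)))

-- Summing over the subgroups of ℤ/n generated by j and by g is, up to the
-- factor n, summing over the subgroup generated by both.
σ-average : ∀ n .{{_ : NonZero n}} g j {f : ℕ → ℤ} → Periodic n f →
  σ n g (average n j f) ≡ + n * σ n (gcd g j) f
σ-average n@(suc _) g j {f} p with gcd[m,n]∣m g j | gcd[m,n]∣n g j | bézout-mod n g j
... | divides g′ g≡ | divides j′ j≡ | α , β , t , e = ℤₚ.*-cancelˡ-≡ (+ n) _ _ (trans (sym W≡nT) W≡n²σ)
  where
  open ≡-Reasoning
  d : ℕ
  d = gcd g j
  T W : ℤ
  T = σ n g (average n j f)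
  -- The third sum, over multiples of d, is redundant in two ways. As d is α j + β g modulo n, it is
  -- absorbed by the sums over k and l, which gives n T. As d divides j and g, it absorbs them
  -- instead, which gives n² σ.
  W = ∑ n (λ i → ∑ n (λ l → ∑ n (λ k → f (j ℕ.* k ℕ.+ g ℕ.* l ℕ.+ d ℕ.* i))))

  move : ∀ k l i → f (j ℕ.* k ℕ.+ g ℕ.* l ℕ.+ d ℕ.* i) ≡ f (j ℕ.* (k ℕ.+ α ℕ.* i) ℕ.+ g ℕ.* (l ℕ.+ β ℕ.* i))
  move k l i = begin
    f (j ℕ.* k ℕ.+ g ℕ.* l ℕ.+ d ℕ.* i) ≡⟨ sym (Periodic-* p (t ℕ.* i) _) ⟩
    f (j ℕ.* k ℕ.+ g ℕ.* l ℕ.+ d ℕ.* i ℕ.+ t ℕ.* i ℕ.* n) ≡⟨ cong f (lemma₁ (j ℕ.* k) (g ℕ.* l) d i t n) ⟩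
    f (j ℕ.* k ℕ.+ g ℕ.* l ℕ.+ (d ℕ.+ t ℕ.* n) ℕ.* i) ≡⟨ cong (λ z → f (j ℕ.* k ℕ.+ g ℕ.* l ℕ.+ z ℕ.* i)) e ⟩
    f (j ℕ.* k ℕ.+ g ℕ.* l ℕ.+ (α ℕ.* j ℕ.+ β ℕ.* g) ℕ.* i) ≡⟨ cong f (lemma₂ j k g l α β i) ⟩
    f (j ℕ.* (k ℕ.+ α ℕ.* i) ℕ.+ g ℕ.* (l ℕ.+ β ℕ.* i)) ∎
    where
    lemma₁ : ∀ a b d i t n → a ℕ.+ b ℕ.+ d ℕ.* i ℕ.+ t ℕ.* i ℕ.* n ≡ a ℕ.+ b ℕ.+ (d ℕ.+ t ℕ.* n) ℕ.* i
    lemma₁ = ℕ-Solver.solve-∀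
    lemma₂ : ∀ j k g l α β i → j ℕ.* k ℕ.+ g ℕ.* l ℕ.+ (α ℕ.* j ℕ.+ β ℕ.* g) ℕ.* i ≡ j ℕ.* (k ℕ.+ α ℕ.* i) ℕ.+ g ℕ.* (l ℕ.+ β ℕ.* i)
    lemma₂ = ℕ-Solver.solve-∀

  multiple-periodic : ∀ (h : ℕ → ℕ) → (∀ i → ∃ λ b → h (i ℕ.+ n) ≡ h i ℕ.+ b ℕ.* n) → Periodic n (f ∘ h)
  multiple-periodic h e i with b , e′ ← e i = trans (cong f e′) (Periodic-* p b (h i))

  slide : ∀ i → ∑ n (λ l → ∑ n (λ k → f (j ℕ.* (k ℕ.+ α ℕ.* i) ℕ.+ g ℕ.* (l ℕ.+ β ℕ.* i)))) ≡ T
  slide i = trans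
    (∑-cong n (λ l → ∑-shift n (α ℕ.* i) {λ k → f (j ℕ.* k ℕ.+ g ℕ.* (l ℕ.+ β ℕ.* i))}
       (multiple-periodic _ (λ k → j , lemma j k n (g ℕ.* (l ℕ.+ β ℕ.* i))))))
    (∑-shift n (β ℕ.* i) {λ l → average n j f (g ℕ.* l)}
      (λ l → ∑-cong n (λ k → multiple-periodic (λ l → j ℕ.* k ℕ.+ g ℕ.* l) (λ l → g , lemma′ g l n (j ℕ.* k)) l)))
    where
    lemma : ∀ j k n a → j ℕ.* (k ℕ.+ n) ℕ.+ a ≡ j ℕ.* k ℕ.+ a ℕ.+ j ℕ.* n
    lemma = ℕ-Solver.solve-∀
    lemma′ : ∀ g l n a → a ℕ.+ g ℕ.* (l ℕ.+ n) ≡ a ℕ.+ g ℕ.* l ℕ.+ g ℕ.* n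
    lemma′ = ℕ-Solver.solve-∀

  W≡nT : W ≡ + n * T
  W≡nT = trans (∑-cong n (λ i → trans (∑-cong n (λ l → ∑-cong n (λ k → move k l i))) (slide i))) (∑-const n T)

  absorb : ∀ l k → ∑ n (λ i → f (j ℕ.* k ℕ.+ g ℕ.* l ℕ.+ d ℕ.* i)) ≡ σ n d f
  absorb l k = trans
    (∑-cong n (λ i → cong f (trans (cong₂ (λ y z → y ℕ.* k ℕ.+ z ℕ.* l ℕ.+ d ℕ.* i) j≡ g≡) (lemma j′ d k g′ l i))))
    (∑-shift n (j′ ℕ.* k ℕ.+ g′ ℕ.* l) {λ i → f (d ℕ.* i)} (multiple-periodic _ (λ i → d , ℕₚ.*-distribˡ-+ d i n)))
    where
    lemma : ∀ j d k g l i → j ℕ.* d ℕ.* k ℕ.+ g ℕ.* d ℕ.* l ℕ.+ d ℕ.* i ≡ d ℕ.* (i ℕ.+ (j ℕ.* k ℕ.+ g ℕ.* l))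
    lemma = ℕ-Solver.solve-∀

  W≡n²σ : W ≡ + n * (+ n * σ n d f)
  W≡n²σ = begin
    W ≡⟨ ∑L-swap (upTo n) (upTo n) (λ i l → ∑ n (λ k → f (j ℕ.* k ℕ.+ g ℕ.* l ℕ.+ d ℕ.* i))) ⟩
    ∑ n (λ l → ∑ n (λ i → ∑ n (λ k → f (j ℕ.* k ℕ.+ g ℕ.* l ℕ.+ d ℕ.* i))))
      ≡⟨ ∑-cong n (λ l → trans (∑L-swap (upTo n) (upTo n) (λ i k → f (j ℕ.* k ℕ.+ g ℕ.* l ℕ.+ d ℕ.* i)))
           (trans (∑-cong n (absorb l)) (∑-const n (σ n d f)))) ⟩
    ∑ n (λ l → + n * σ n d f) ≡⟨ ∑-const n _ ⟩
    + n * (+ n * σ n d f) ∎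

-- Möbius inversion over divisors

divisorSum : ℕ → ℕ → (ℕ → ℤ) → ℤ
divisorSum n g s = ∑ n (λ i → χ (suc i ∣? g) * s (suc i))

-- The Möbius inverse without the Möbius function: the value at e is fixed at stage e, as s e minus
-- the values at the smaller divisors of e, and later stages copy it.
möbiusTable : (ℕ → ℤ) → ℕ → ℕ → ℤ
möbiusTable s zero    e = 0ℤ
möbiusTable s (suc N) e with e ℕₚ.≟ suc N
... | yes _ = s e - divisorSum N e (möbiusTable s N)
... | no  _ = möbiusTable s N e

möbius-inversion : ∀ s N g → 1 ℕ.≤ g → g ℕ.≤ N → divisorSum N g (möbiusTable s N) ≡ s g
möbius-inversion s zero    g 1≤g g≤N = contradiction (ℕₚ.≤-trans 1≤g g≤N) (λ ())
möbius-inversion s (suc N) g 1≤g g≤N =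
  trans (∑-snoc N (λ i → χ (suc i ∣? g) * möbiusTable s (suc N) (suc i)))
  (trans (cong (_+ χ (suc N ∣? g) * möbiusTable s (suc N) (suc N)) (∑-cong< N (λ i i<N → cong (_*_ (χ (suc i ∣? g))) (old i i<N)))) (new (ℕₚ.m≤n⇒m<n∨m≡n g≤N)))
  where
  old : ∀ i → i ℕ.< N → möbiusTable s (suc N) (suc i) ≡ möbiusTable s N (suc i)
  old i i<N with suc i ℕₚ.≟ suc N
  ... | yes e = contradiction (ℕₚ.suc-injective e) (ℕₚ.<⇒≢ i<N)
  ... | no  _ = refl
  top : möbiusTable s (suc N) (suc N) ≡ s (suc N) - divisorSum N (suc N) (möbiusTable s N)
  top with suc N ℕₚ.≟ suc N
  ... | yes _ = refl
  ... | no ¬e = contradiction refl ¬e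
  cancel : ∀ a b → a + 1ℤ * (b - a) ≡ b
  cancel = ℤ-Solver.solve-∀
  new : g ℕ.< suc N ⊎ g ≡ suc N →
    divisorSum N g (möbiusTable s N) + χ (suc N ∣? g) * möbiusTable s (suc N) (suc N) ≡ s g
  new (inj₁ (s≤s g≤N′))
    rewrite χ-no (suc N ∣? g) (λ N+1∣g → ℕₚ.<⇒≱ (s≤s g≤N′) (∣⇒≤ {{ℕ.>-nonZero 1≤g}} N+1∣g)) =
    trans (ℤₚ.+-identityʳ _) (möbius-inversion s N g 1≤g g≤N′)
  new (inj₂ refl) rewrite χ-yes (suc N ∣? suc N) ∣-refl | top = cancel (divisorSum N (suc N) (möbiusTable s N)) (s (suc N))

-- Strong induction on g: in the difference of the two divisor sums at g the proper divisors cancel,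
-- and a g - b g is left.
divisorSum-injective : ∀ n .{{_ : NonZero n}} {a b : ℕ → ℤ} →
  (∀ g → 1 ℕ.≤ g → g ∣ n → divisorSum n g a ≡ divisorSum n g b) → ∀ g → 1 ℕ.≤ g → g ∣ n → a g ≡ b g
divisorSum-injective n {a} {b} e = <-rec (λ g → 1 ℕ.≤ g → g ∣ n → a g ≡ b g) step
  where
  open ≡-Reasoning
  step : ∀ g → (∀ {h} → h ℕ.< g → 1 ℕ.≤ h → h ∣ n → a h ≡ b h) → 1 ℕ.≤ g → g ∣ n → a g ≡ b g
  step g@(suc g-1) rec 1≤g g∣n = ℤₚ.i-j≡0⇒i≡j (a g) (b g) (begin
    a g - b g ≡⟨ sym (ℤₚ.*-identityˡ _) ⟩
    1ℤ * (a g - b g) ≡⟨ cong (_* (a g - b g)) (sym (χ-yes (g ∣? g) ∣-refl)) ⟩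
    χ (g ∣? g) * (a g - b g) ≡⟨ sym (∑-single (∣⇒≤ g∣n) other) ⟩
    ∑ n (λ i → χ (suc i ∣? g) * (a (suc i) - b (suc i)))
      ≡⟨ ∑-cong n (λ i → lemma (χ (suc i ∣? g)) (a (suc i)) (b (suc i))) ⟩
    ∑ n (λ i → χ (suc i ∣? g) * a (suc i) + ℤ.-1ℤ * (χ (suc i ∣? g) * b (suc i)))
      ≡⟨ trans (∑L-+ (upTo n) _ _) (cong (_+_ (divisorSum n g a)) (∑L-*ˡ (upTo n) ℤ.-1ℤ _)) ⟩
    divisorSum n g a + ℤ.-1ℤ * divisorSum n g b ≡⟨ cong (_+ ℤ.-1ℤ * divisorSum n g b) (e g 1≤g g∣n) ⟩
    divisorSum n g b + ℤ.-1ℤ * divisorSum n g b ≡⟨ cancel (divisorSum n g b) ⟩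
    0ℤ ∎)
    where
    lemma : ∀ x a b → x * (a - b) ≡ x * a + ℤ.-1ℤ * (x * b)
    lemma = ℤ-Solver.solve-∀
    cancel : ∀ x → x + ℤ.-1ℤ * x ≡ 0ℤ
    cancel = ℤ-Solver.solve-∀
    other : ∀ i → i ℕ.< n → i ≢ g-1 → χ (suc i ∣? g) * (a (suc i) - b (suc i)) ≡ 0ℤ
    other i i<n i≢ with suc i ∣? g
    ... | no  _ = refl
    ... | yes i∣g = trans (ℤₚ.*-identityˡ _) (ℤₚ.i≡j⇒i-j≡0 (rec (ℕₚ.≤∧≢⇒< (∣⇒≤ i∣g) (i≢ ∘ ℕₚ.suc-injective)) (s≤s z≤n) (∣-trans i∣g g∣n)))

module _ (n : ℕ) .{{_ : NonZero n}} where

  -- If f is a character of ℤ/n, then `σ n g f` is n or 0 according to whether the order of f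
  -- divides g. Its Möbius inverse is therefore n at that order and 0 at the other divisors of n.
  τ : ℕ → (ℕ → ℤ) → ℤ
  τ e f = möbiusTable (λ g → σ n g f) n e

  divisorSum-τ : ∀ f g → 1 ℕ.≤ g → g ∣ n → divisorSum n g (λ e → τ e f) ≡ σ n g f
  divisorSum-τ f g 1≤g g∣n = möbius-inversion (λ g → σ n g f) n g 1≤g (∣⇒≤ g∣n)

  -- Both sides have the same divisor sums: by `σ-average` the left one yields the divisor sum at
  -- gcd g j, and this is the divisor sum at g restricted to the divisors of j.
  τ-average : ∀ j {f} → Periodic n f → ∀ g → 1 ℕ.≤ g → g ∣ n → τ g (average n j f) ≡ + n * (χ (g ∣? j) * τ g f)
  τ-average j {f} p = divisorSum-injective n (λ g 1≤g g∣n → begin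
    divisorSum n g (λ e → τ e (average n j f)) ≡⟨ divisorSum-τ (average n j f) g 1≤g g∣n ⟩
    σ n g (average n j f) ≡⟨ σ-average n g j p ⟩
    + n * σ n (gcd g j) f ≡⟨ cong (_*_ (+ n)) (sym (divisorSum-τ f (gcd g j) (1≤gcd g 1≤g) (∣-trans (gcd[m,n]∣m g j) g∣n))) ⟩
    + n * divisorSum n (gcd g j) (λ e → τ e f) ≡⟨ sym (∑L-*ˡ (upTo n) (+ n) _) ⟩
    ∑ n (λ i → + n * (χ (suc i ∣? gcd g j) * τ (suc i) f)) ≡⟨ ∑-cong n (λ i → term g (suc i)) ⟩
    divisorSum n g (λ e → + n * (χ (e ∣? j) * τ e f))     ∎)
    where
    open ≡-Reasoning
    1≤gcd : ∀ g → 1 ℕ.≤ g → 1 ℕ.≤ gcd g j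
    1≤gcd g@(suc _) _ with gcd g j | gcd[m,n]∣m g j
    ... | suc _ | _ = s≤s z≤n
    ... | zero  | divides q e = contradiction (trans e (ℕₚ.*-zeroʳ q)) (λ ())
    assoc : ∀ n a b t → n * (a * b * t) ≡ a * (n * (b * t))
    assoc = ℤ-Solver.solve-∀
    term : ∀ g e → + n * (χ (e ∣? gcd g j) * τ e f) ≡ χ (e ∣? g) * (+ n * (χ (e ∣? j) * τ e f))
    term g e = trans
      (cong (λ z → + n * (z * τ e f))
        (sym (χ-* (e ∣? g) (e ∣? j) (e ∣? gcd g j) gcd-greatest (λ d → ∣-trans d (gcd[m,n]∣m g j)) (λ d → ∣-trans d (gcd[m,n]∣n g j)))))
      (assoc (+ n) (χ (e ∣? g)) (χ (e ∣? j)) (τ e f))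

  -- By Newton's identities, a family X with the recurrence of the coefficients
  -- of (1 - z^e)^(-n/e) gives the components of h_m(1, q, …, q^(n-1)).
  H-decomposition : (X : ℕ → ℕ → ℤ) →
    (∀ e → 1 ℕ.≤ e → e ∣ n → X e 0 ≡ 1ℤ) →
    (∀ e → 1 ℕ.≤ e → e ∣ n → ∀ m → + suc m * X e (suc m) ≡ + n * ∑ (suc m) (λ j → χ (e ∣? suc j) * X e (m ∸ j))) →
    ∀ m f → Periodic n f →
    + n * H (downFrom n) m f ≡ divisorSum n n (λ e → X e m * τ e f)
  H-decomposition X X-zero X-suc = <-rec _ step
    where
    open ≡-Reasoning
    step : ∀ m → (∀ {k} → k ℕ.< m → ∀ f → Periodic n f → + n * H (downFrom n) k f ≡ divisorSum n n (λ e → X e k * τ e f)) →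
      ∀ f → Periodic n f → + n * H (downFrom n) m f ≡ divisorSum n n (λ e → X e m * τ e f)
    step zero rec f p = begin
      + n * H (downFrom n) 0 f ≡⟨ cong (_*_ (+ n)) (H-zero (downFrom n) f) ⟩
      + n * f 0 ≡⟨ sym (∑-const n (f 0)) ⟩
      ∑ n (λ _ → f 0) ≡⟨ ∑-cong n (λ k → sym (trans (cong f (ℕₚ.*-comm n k)) (Periodic-* p k 0))) ⟩
      σ n n f ≡⟨ sym (divisorSum-τ f n (ℕ.>-nonZero⁻¹ n) ∣-refl) ⟩
      divisorSum n n (λ e → τ e f) ≡⟨ ∑-cong n (λ i → χ-*-cong (suc i ∣? n) (λ d →
                                       sym (trans (cong (_* τ (suc i) f) (X-zero (suc i) (s≤s z≤n) d)) (ℤₚ.*-identityˡ _)))) ⟩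
      divisorSum n n (λ e → X e 0 * τ e f) ∎
    -- Newton's identity needs the factor m + 1. The inner sum over y turns f into
    -- `average n (suc j) f`, to which the induction hypothesis in degree m - j applies.
    step (suc m) rec f p = ℤₚ.*-cancelˡ-≡ (+ suc m) _ _ (begin
      + suc m * (+ n * H E (suc m) f) ≡⟨ swap* (+ suc m) (+ n) _ ⟩
      + n * (+ suc m * H E (suc m) f) ≡⟨ cong (_*_ (+ n)) (newton E (suc m) f) ⟩
      + n * powerSums E E (suc m) f ≡⟨ sym (∑L-*ˡ (upTo (suc m)) (+ n) _) ⟩
      ∑ (suc m) (λ j → + n * ∑L E (λ y → H E (m ∸ j) (λ w → f (suc j ℕ.* y ℕ.+ w))))
        ≡⟨ ∑-cong (suc m) (λ j → cong (_*_ (+ n)) (trans (∑L-downFrom n _) (sym (H-∑L E (m ∸ j) (upTo n) (λ y w → f (suc j ℕ.* y ℕ.+ w)))))) ⟩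
      ∑ (suc m) (λ j → + n * H E (m ∸ j) (average n (suc j) f))
        ≡⟨ ∑-cong (suc m) (λ j → rec (s≤s (ℕₚ.m∸n≤m m j)) (average n (suc j) f) (average-periodic (suc j) p)) ⟩
      ∑ (suc m) (λ j → ∑ n (λ i → χ (suc i ∣? n) * (X (suc i) (m ∸ j) * τ (suc i) (average n (suc j) f))))
        ≡⟨ ∑L-swap (upTo (suc m)) (upTo n) _ ⟩
      ∑ n (λ i → ∑ (suc m) (λ j → χ (suc i ∣? n) * (X (suc i) (m ∸ j) * τ (suc i) (average n (suc j) f))))
        ≡⟨ ∑-cong n (λ i → trans (∑L-*ˡ (upTo (suc m)) (χ (suc i ∣? n)) _) (χ-*-cong (suc i ∣? n) (component (suc i) (s≤s z≤n)))) ⟩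
      ∑ n (λ i → χ (suc i ∣? n) * (+ suc m * (X (suc i) (suc m) * τ (suc i) f)))
        ≡⟨ ∑-cong n (λ i → swap* (χ (suc i ∣? n)) (+ suc m) _) ⟩
      ∑ n (λ i → + suc m * (χ (suc i ∣? n) * (X (suc i) (suc m) * τ (suc i) f)))
        ≡⟨ ∑L-*ˡ (upTo n) (+ suc m) _ ⟩
      + suc m * divisorSum n n (λ e → X e (suc m) * τ e f) ∎)
      where
      E : List ℕ
      E = downFrom n
      swap* : ∀ a b c → a * (b * c) ≡ b * (a * c)
      swap* = ℤ-Solver.solve-∀
      rearrange : ∀ x n c t → x * (n * (c * t)) ≡ c * x * (n * t)
      rearrange = ℤ-Solver.solve-∀
      rearrange′ : ∀ n x t → x * (n * t) ≡ n * x * t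
      rearrange′ = ℤ-Solver.solve-∀
      component : ∀ e → 1 ℕ.≤ e → e ∣ n →
        ∑ (suc m) (λ j → X e (m ∸ j) * τ e (average n (suc j) f)) ≡ + suc m * (X e (suc m) * τ e f)
      component e 1≤e e∣n = begin
        ∑ (suc m) (λ j → X e (m ∸ j) * τ e (average n (suc j) f))
          ≡⟨ ∑-cong (suc m) (λ j → trans (cong (_*_ (X e (m ∸ j))) (τ-average (suc j) p e 1≤e e∣n))
               (rearrange (X e (m ∸ j)) (+ n) (χ (e ∣? suc j)) (τ e f))) ⟩
        ∑ (suc m) (λ j → χ (e ∣? suc j) * X e (m ∸ j) * (+ n * τ e f))
          ≡⟨ ∑L-*ʳ (upTo (suc m)) (+ n * τ e f) (λ j → χ (e ∣? suc j) * X e (m ∸ j)) ⟩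
        ∑ (suc m) (λ j → χ (e ∣? suc j) * X e (m ∸ j)) * (+ n * τ e f)
          ≡⟨ rearrange′ (+ n) _ (τ e f) ⟩
        + n * ∑ (suc m) (λ j → χ (e ∣? suc j) * X e (m ∸ j)) * τ e f
          ≡⟨ cong (_* τ e f) (sym (X-suc e 1≤e e∣n m)) ⟩
        + suc m * X e (suc m) * τ e f
          ≡⟨ ℤₚ.*-assoc (+ suc m) (X e (suc m)) (τ e f) ⟩
        + suc m * (X e (suc m) * τ e f) ∎

-- Polynomials modulo q^n - 1

-- The linear functional q^k ↦ w k.
pair : (ℕ → ℤ) → Poly → ℤ
pair w []      = 0ℤ
pair w (a ∷ f) = a * w 0 + pair (w ∘ suc) f

pair-cong : ∀ {w v} f → (∀ k → w k ≡ v k) → pair w f ≡ pair v f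
pair-cong []      e = refl
pair-cong (a ∷ f) e = cong₂ _+_ (cong (_*_ a) (e 0)) (pair-cong f (e ∘ suc))

pair-zero : ∀ w f → (∀ k → coeff f k ≡ 0ℤ) → pair w f ≡ 0ℤ
pair-zero w []      e = refl
pair-zero w (a ∷ f) e rewrite e 0 = trans (ℤₚ.+-identityˡ _) (pair-zero (w ∘ suc) f (e ∘ suc))

pair-resp-≈ : ∀ w f g → f ≈ₚ g → pair w f ≡ pair w g
pair-resp-≈ w []      g       e = sym (pair-zero w g (sym ∘ e))
pair-resp-≈ w (a ∷ f) []      e = pair-zero w (a ∷ f) e
pair-resp-≈ w (a ∷ f) (b ∷ g) e = cong₂ _+_ (cong (_* w 0) (e 0)) (pair-resp-≈ (w ∘ suc) f g (e ∘ suc))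

pair-+ₚ : ∀ w f g → pair w (f +ₚ g) ≡ pair w f + pair w g
pair-+ₚ w []      g       = sym (ℤₚ.+-identityˡ _)
pair-+ₚ w (a ∷ f) []      = sym (ℤₚ.+-identityʳ _)
pair-+ₚ w (a ∷ f) (b ∷ g) = trans (cong (_+_ ((a + b) * w 0)) (pair-+ₚ (w ∘ suc) f g)) (lemma a b (w 0) _ _)
  where
  lemma : ∀ a b c x y → (a + b) * c + (x + y) ≡ (a * c + x) + (b * c + y)
  lemma = ℤ-Solver.solve-∀

pair-·ₚ : ∀ w c f → pair w (c ·ₚ f) ≡ c * pair w f
pair-·ₚ w c []      = sym (ℤₚ.*-zeroʳ c)
pair-·ₚ w c (a ∷ f) = trans (cong (_+_ (c * a * w 0)) (pair-·ₚ (w ∘ suc) c f)) (lemma c a (w 0) _)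
  where
  lemma : ∀ c a x y → c * a * x + c * y ≡ c * (a * x + y)
  lemma = ℤ-Solver.solve-∀

pair-+ : ∀ w v f → pair (λ k → w k + v k) f ≡ pair w f + pair v f
pair-+ w v []      = refl
pair-+ w v (a ∷ f) = trans (cong (_+_ (a * (w 0 + v 0))) (pair-+ (w ∘ suc) (v ∘ suc) f)) (lemma a (w 0) (v 0) _ _)
  where
  lemma : ∀ a b c x y → a * (b + c) + (x + y) ≡ (a * b + x) + (a * c + y)
  lemma = ℤ-Solver.solve-∀

pair-* : ∀ c w f → pair (λ k → c * w k) f ≡ c * pair w f
pair-* c w []      = sym (ℤₚ.*-zeroʳ c)
pair-* c w (a ∷ f) = trans (cong (_+_ (a * (c * w 0))) (pair-* c (w ∘ suc) f)) (lemma c a (w 0) _)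
  where
  lemma : ∀ c a x y → a * (c * x) + c * y ≡ c * (a * x + y)
  lemma = ℤ-Solver.solve-∀

pair-null : ∀ f → pair (λ _ → 0ℤ) f ≡ 0ℤ
pair-null []      = refl
pair-null (a ∷ f) rewrite ℤₚ.*-zeroʳ a = trans (ℤₚ.+-identityˡ _) (pair-null f)

pair-swap : ∀ (w : ℕ → ℕ → ℤ) f g → pair (λ i → pair (w i) g) f ≡ pair (λ j → pair (λ i → w i j) f) g
pair-swap w []      g = sym (pair-null g)
pair-swap w (a ∷ f) g = trans (cong₂ _+_ (sym (pair-* a (w 0) g)) (pair-swap (w ∘ suc) f g))
  (sym (pair-+ (λ j → a * w 0 j) (λ j → pair (λ i → w (suc i) j) f) g))

pair-*ₚ : ∀ w f g → pair w (f *ₚ g) ≡ pair (λ i → pair (λ j → w (i ℕ.+ j)) g) f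
pair-*ₚ w []      g = refl
pair-*ₚ w (a ∷ f) g = trans (pair-+ₚ w (a ·ₚ g) (0ℤ ∷ (f *ₚ g)))
  (cong₂ _+_ (pair-·ₚ w a g) (trans (ℤₚ.+-identityˡ _) (pair-*ₚ (w ∘ suc) f g)))

pair-q^ : ∀ w n → pair w (q^ n) ≡ w n
pair-q^ w zero    = trans (ℤₚ.+-identityʳ _) (ℤₚ.*-identityˡ _)
pair-q^ w (suc n) = trans (ℤₚ.+-identityˡ _) (pair-q^ (w ∘ suc) n)

pair-∑ : ∀ w n f → (∀ k → n ℕ.≤ k → coeff f k ≡ 0ℤ) → pair w f ≡ ∑ n (λ k → coeff f k * w k)
pair-∑ w zero    f       e = pair-zero w f (λ k → e k z≤n)
pair-∑ w (suc n) []      e = sym (trans (∑-cong (suc n) (λ k → ℤₚ.*-zeroˡ (w k))) (∑L-zero (upTo (suc n))))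
pair-∑ w (suc n) (a ∷ f) e = trans (cong (_+_ (a * w 0)) (pair-∑ (w ∘ suc) n f (λ k n≤k → e (suc k) (s≤s n≤k))))
  (sym (∑-suc n (λ k → coeff (a ∷ f) k * w k)))

infix 4 _≅_
-- Under a functional a product becomes a double sum over exponents, so the ring laws reduce to
-- those of addition on ℕ. As a record, the relation lets unification recover f and g.
record _≅_ (f g : Poly) : Set where
  constructor mk≅
  field pairing : ∀ w → pair w f ≡ pair w g
open _≅_

≅-isEquivalence : IsEquivalence _≅_
≅-isEquivalence = record
  { refl  = mk≅ λ _ → refl
  ; sym   = λ e → mk≅ λ w → sym (pairing e w)
  ; trans = λ e e′ → mk≅ λ w → trans (pairing e w) (pairing e′ w)
  }

≅-setoid : Setoid 0ℓ 0ℓ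
≅-setoid = record { isEquivalence = ≅-isEquivalence }

coeff-pair : ∀ f k → coeff f k ≡ pair (λ i → χ (i ℕₚ.≟ k)) f
coeff-pair []      k       = refl
coeff-pair (a ∷ f) zero    = sym (trans (cong₂ _+_ (ℤₚ.*-identityʳ a) (pair-null f)) (ℤₚ.+-identityʳ a))
coeff-pair (a ∷ f) (suc k) = trans (coeff-pair f k) (trans (sym (ℤₚ.+-identityˡ _))
  (cong₂ _+_ (sym (ℤₚ.*-zeroʳ a)) (pair-cong f (λ i → χ-cong (i ℕₚ.≟ k) (suc i ℕₚ.≟ suc k) (cong suc) ℕₚ.suc-injective))))

≅⇒≈ₚ : ∀ {f g} → f ≅ g → f ≈ₚ g
≅⇒≈ₚ {f} {g} e k = trans (coeff-pair f k) (trans (pairing e _) (sym (coeff-pair g k)))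

*ₚ-comm : ∀ f g → f *ₚ g ≅ g *ₚ f
*ₚ-comm f g = mk≅ λ w → trans (pair-*ₚ w f g) (trans (pair-swap (λ i j → w (i ℕ.+ j)) f g)
  (trans (pair-cong g (λ j → pair-cong f (λ i → cong w (ℕₚ.+-comm i j)))) (sym (pair-*ₚ w g f))))

*ₚ-assoc : ∀ f g h → (f *ₚ g) *ₚ h ≅ f *ₚ (g *ₚ h)
*ₚ-assoc f g h = mk≅ λ w → trans (pair-*ₚ w (f *ₚ g) h) (trans (pair-*ₚ _ f g)
  (trans (pair-cong f (λ i → trans (pair-cong g (λ j → pair-cong h (λ k → cong w (ℕₚ.+-assoc i j k)))) (sym (pair-*ₚ _ g h))))
    (sym (pair-*ₚ w f (g *ₚ h)))))

*ₚ-cong : ∀ {f f′ g g′} → f ≅ f′ → g ≅ g′ → f *ₚ g ≅ f′ *ₚ g′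
*ₚ-cong {f} {f′} {g} {g′} e e′ = mk≅ λ w → trans (pair-*ₚ w f g)
  (trans (pair-cong f (λ i → pairing e′ _)) (trans (pairing e _) (sym (pair-*ₚ w f′ g′))))

*ₚ-congˡ : ∀ f {g g′} → g ≅ g′ → f *ₚ g ≅ f *ₚ g′
*ₚ-congˡ f {g} {g′} e = *ₚ-cong {f} {f} {g} {g′} (mk≅ λ _ → refl) e

+ₚ-cong : ∀ {f f′ g g′} → f ≅ f′ → g ≅ g′ → f +ₚ g ≅ f′ +ₚ g′
+ₚ-cong {f} {f′} {g} {g′} e e′ = mk≅ λ w → trans (pair-+ₚ w f g)
  (trans (cong₂ _+_ (pairing e w) (pairing e′ w)) (sym (pair-+ₚ w f′ g′)))

*ₚ-distribʳ : ∀ f g h → (f +ₚ g) *ₚ h ≅ f *ₚ h +ₚ g *ₚ h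
*ₚ-distribʳ f g h = mk≅ λ w → trans (pair-*ₚ w (f +ₚ g) h) (trans (pair-+ₚ _ f g)
  (trans (cong₂ _+_ (sym (pair-*ₚ w f h)) (sym (pair-*ₚ w g h))) (sym (pair-+ₚ w (f *ₚ h) (g *ₚ h)))))

*ₚ-identityˡ : ∀ f → [ 1ℤ ] *ₚ f ≅ f
*ₚ-identityˡ f = mk≅ λ w → trans (pair-*ₚ w [ 1ℤ ] f) (trans (ℤₚ.+-identityʳ _) (ℤₚ.*-identityˡ _))

*ₚ-commutativeSemigroup : CommutativeSemigroup 0ℓ 0ℓ
*ₚ-commutativeSemigroup = record
  { Carrier = Poly ; _≈_ = _≅_ ; _∙_ = _*ₚ_
  ; isCommutativeSemigroup = record
    { isSemigroup = record
      { isMagma = record { isEquivalence = ≅-isEquivalence ; ∙-cong = *ₚ-cong }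
      ; assoc = *ₚ-assoc }
    ; comm = *ₚ-comm } }

-- Gaussian polynomials as complete homogeneous polynomials

gaussian : ℕ → ℕ → Poly
gaussian zero    zero    = [ 1ℤ ]
gaussian zero    (suc m) = []
gaussian (suc N) zero    = [ 1ℤ ]
gaussian (suc N) (suc m) = gaussian N (suc m) +ₚ (q^ N) *ₚ gaussian (suc N) m

-- `gaussian N m` is h_m(1, q, ..., q^(N-1)); `downFrom N` lists the exponents in the order in which
-- its recursion removes the variables.
pair-gaussian : ∀ w N m → pair w (gaussian N m) ≡ H (downFrom N) m w
pair-gaussian w zero    zero    = trans (ℤₚ.+-identityʳ _) (ℤₚ.*-identityˡ _)
pair-gaussian w zero    (suc m) = refl
pair-gaussian w (suc N) zero    = trans (ℤₚ.+-identityʳ _) (ℤₚ.*-identityˡ _)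
pair-gaussian w (suc N) (suc m) = trans (pair-+ₚ w (gaussian N (suc m)) _)
  (cong₂ _+_ (pair-gaussian w N (suc m))
    (trans (pair-*ₚ w (q^ N) (gaussian (suc N) m)) (trans (pair-q^ _ N) (pair-gaussian _ (suc N) m))))

[]q-+ : ∀ a b → [ a ℕ.+ b ]q ≅ [ a ]q +ₚ (q^ a) *ₚ [ b ]q
[]q-+ a b = mk≅ λ w → trans (lemma w a) (sym (trans (pair-+ₚ w [ a ]q _)
    (cong (_+_ (pair w [ a ]q)) (trans (pair-*ₚ w (q^ a) [ b ]q) (pair-q^ _ a)))))
  where
  lemma : ∀ w a → pair w [ a ℕ.+ b ]q ≡ pair w [ a ]q + pair (λ j → w (a ℕ.+ j)) [ b ]q
  lemma w zero    = sym (ℤₚ.+-identityˡ _)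
  lemma w (suc a) = trans (cong (_+_ (1ℤ * w 0)) (lemma (w ∘ suc) a)) (sym (ℤₚ.+-assoc (1ℤ * w 0) _ _))

-- At (b + 1, m + 1) both summands of the recursion produce the factor [b + m + 1]!, the first with
-- [b + 1] and the second with q^(b+1) [m + 1]. These add up to [b + m + 2].
gaussian-product : ∀ b m → gaussian (suc b) m *ₚ ([ b ]q! *ₚ [ m ]q!) ≅ [ b ℕ.+ m ]q!
gaussian-product b zero rewrite ℕₚ.+-identityʳ b =
  trans≅ (*ₚ-identityˡ _) (trans≅ (*ₚ-comm [ b ]q! [ 1ℤ ]) (*ₚ-identityˡ _))
  where open IsEquivalence ≅-isEquivalence renaming (trans to trans≅)
gaussian-product zero (suc m) =
  trans≅ (*ₚ-cong (*ₚ-identityˡ (gaussian 1 m)) (*ₚ-identityˡ ([ suc m ]q *ₚ [ m ]q!)))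
  (trans≅ (x∙yz≈y∙xz (gaussian 1 m) [ suc m ]q [ m ]q!)
    (*ₚ-congˡ [ suc m ]q (trans≅ (*ₚ-congˡ (gaussian 1 m) (sym≅ (*ₚ-identityˡ [ m ]q!))) (gaussian-product zero m))))
  where
  open IsEquivalence ≅-isEquivalence renaming (trans to trans≅; refl to refl≅; sym to sym≅)
  open import Algebra.Properties.CommutativeSemigroup *ₚ-commutativeSemigroup
gaussian-product (suc b) (suc m) = begin
  (G₁ +ₚ Q *ₚ G₂) *ₚ ((C *ₚ F) *ₚ (M *ₚ E)) ≈⟨ *ₚ-distribʳ G₁ (Q *ₚ G₂) _ ⟩
  G₁ *ₚ ((C *ₚ F) *ₚ (M *ₚ E)) +ₚ (Q *ₚ G₂) *ₚ ((C *ₚ F) *ₚ (M *ₚ E))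
    ≈⟨ +ₚ-cong (trans≅ (*ₚ-congˡ G₁ (*ₚ-assoc C F (M *ₚ E))) (x∙yz≈y∙xz G₁ C (F *ₚ (M *ₚ E))))
               (trans≅ (*ₚ-congˡ (Q *ₚ G₂) (x∙yz≈y∙xz (C *ₚ F) M E)) (interchange Q G₂ M ((C *ₚ F) *ₚ E))) ⟩
  C *ₚ (G₁ *ₚ (F *ₚ (M *ₚ E))) +ₚ (Q *ₚ M) *ₚ (G₂ *ₚ ((C *ₚ F) *ₚ E))
    ≈⟨ +ₚ-cong (*ₚ-congˡ C (gaussian-product b (suc m))) (*ₚ-congˡ (Q *ₚ M) (gaussian-product (suc b) m)) ⟩
  C *ₚ [ b ℕ.+ suc m ]q! +ₚ (Q *ₚ M) *ₚ [ suc b ℕ.+ m ]q!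
    ≡⟨ cong (λ a → C *ₚ [ a ]q! +ₚ (Q *ₚ M) *ₚ [ suc b ℕ.+ m ]q!) (ℕₚ.+-suc b m) ⟩
  C *ₚ [ suc b ℕ.+ m ]q! +ₚ (Q *ₚ M) *ₚ [ suc b ℕ.+ m ]q! ≈⟨ sym≅ (*ₚ-distribʳ C (Q *ₚ M) _) ⟩
  (C +ₚ Q *ₚ M) *ₚ [ suc b ℕ.+ m ]q! ≈⟨ *ₚ-cong (sym≅ ([]q-+ (suc b) (suc m))) refl≅ ⟩
  [ suc b ℕ.+ suc m ]q *ₚ [ suc b ℕ.+ m ]q! ≡⟨ cong (λ a → [ suc b ℕ.+ suc m ]q *ₚ [ a ]q!) (sym (ℕₚ.+-suc b m)) ⟩
  [ suc b ℕ.+ suc m ]q! ∎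
  where
  open IsEquivalence ≅-isEquivalence renaming (trans to trans≅; refl to refl≅; sym to sym≅)
  open import Algebra.Properties.CommutativeSemigroup *ₚ-commutativeSemigroup
  open import Relation.Binary.Reasoning.Setoid ≅-setoid
  C F M E Q G₁ G₂ : Poly
  C = [ suc b ]q
  F = [ b ]q!
  M = [ suc m ]q
  E = [ m ]q!
  Q = q^ suc b
  G₁ = gaussian (suc b) (suc m)
  G₂ = gaussian (suc (suc b)) m

length-+ₚ : ∀ f g → length (f +ₚ g) ≡ length f ⊔ length g
length-+ₚ []      g       = refl
length-+ₚ (a ∷ f) []      = refl
length-+ₚ (a ∷ f) (b ∷ g) = cong suc (length-+ₚ f g)

length-*ₚ : ∀ a f g → 1 ℕ.≤ length g → length ((a ∷ f) *ₚ g) ≡ length f ℕ.+ length g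
length-*ₚ a []      g 1≤g = trans (length-+ₚ (a ·ₚ g) _) (trans (cong (_⊔ 1) (length-map (_*_ a) g)) (ℕₚ.m≥n⇒m⊔n≡m 1≤g))
length-*ₚ a (b ∷ f) g 1≤g = trans (length-+ₚ (a ·ₚ g) _)
  (trans (cong₂ _⊔_ (length-map (_*_ a) g) (cong suc (length-*ₚ b f g 1≤g)))
    (ℕₚ.m≤n⇒m⊔n≡n (ℕₚ.m≤n+m (length g) (suc (length f)))))

length-q^-*ₚ : ∀ n g → 1 ℕ.≤ length g → length ((q^ n) *ₚ g) ≡ n ℕ.+ length g
length-q^-*ₚ zero    g 1≤g = length-*ₚ 1ℤ [] g 1≤g
length-q^-*ₚ (suc n) g 1≤g = trans (length-*ₚ 0ℤ (q^ n) g 1≤g)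
  (cong (ℕ._+ length g) (trans (length-++ (replicate n 0ℤ)) (trans (cong (ℕ._+ 1) (length-replicate n)) (ℕₚ.+-comm n 1))))

length-gaussian : ∀ N m → length (gaussian (suc N) m) ≡ suc (N ℕ.* m)
length-gaussian N       zero    = cong suc (sym (ℕₚ.*-zeroʳ N))
length-gaussian zero    (suc m) = trans (length-q^-*ₚ zero (gaussian 1 m) (ℕₚ.≤-reflexive (sym (length-gaussian zero m)))) (length-gaussian zero m)
length-gaussian (suc N) (suc m) = begin
  length (gaussian (suc N) (suc m) +ₚ (q^ suc N) *ₚ gaussian (suc (suc N)) m)
    ≡⟨ length-+ₚ (gaussian (suc N) (suc m)) _ ⟩
  length (gaussian (suc N) (suc m)) ⊔ length ((q^ suc N) *ₚ gaussian (suc (suc N)) m)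
    ≡⟨ cong₂ _⊔_ (length-gaussian N (suc m)) (trans (length-q^-*ₚ (suc N) (gaussian (suc (suc N)) m)
         (ℕₚ.≤-trans (s≤s z≤n) (ℕₚ.≤-reflexive (sym (length-gaussian (suc N) m))))) (cong (suc N ℕ.+_) (length-gaussian (suc N) m))) ⟩
  suc (N ℕ.* suc m) ⊔ (suc N ℕ.+ suc (suc N ℕ.* m))
    ≡⟨ cong (suc (N ℕ.* suc m) ⊔_) (lemma N m) ⟩
  suc (N ℕ.* suc m) ⊔ suc (suc N ℕ.* suc m)
    ≡⟨ ℕₚ.m≤n⇒m⊔n≡n (s≤s (ℕₚ.m≤n+m (N ℕ.* suc m) (suc m))) ⟩
  suc (suc N ℕ.* suc m) ∎
  where
  open ≡-Reasoning
  lemma : ∀ N m → suc N ℕ.+ suc (suc N ℕ.* m) ≡ suc (suc N ℕ.* suc m)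
  lemma = ℕ-Solver.solve-∀

-- The operation `_/ₚ_` returns as many coefficients as the dividend has entries, so the quotient, a
-- list of length b m + 1, has to fit.
length-[]q! : ∀ b m → suc (b ℕ.* m) ℕ.≤ length [ b ℕ.+ m ]q!
length-[]q! zero    zero    = ℕₚ.≤-refl
length-[]q! zero    (suc m) = ℕₚ.≤-trans (length-[]q! zero m) (ℕₚ.≤-trans (ℕₚ.m≤n+m _ _) (ℕₚ.≤-reflexive (sym (length-*ₚ 1ℤ [ m ]q [ m ]q! (length-[]q! zero m)))))
length-[]q! (suc b) m = begin
  suc (m ℕ.+ b ℕ.* m) ≡⟨ sym (ℕₚ.+-suc m (b ℕ.* m)) ⟩
  m ℕ.+ suc (b ℕ.* m) ≤⟨ ℕₚ.+-mono-≤ (ℕₚ.m≤n+m m b) (length-[]q! b m) ⟩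
  b ℕ.+ m ℕ.+ length [ b ℕ.+ m ]q! ≡⟨ cong (ℕ._+ length [ b ℕ.+ m ]q!) (sym (length-replicate (b ℕ.+ m))) ⟩
  length [ b ℕ.+ m ]q ℕ.+ length [ b ℕ.+ m ]q! ≡⟨ sym (length-*ₚ 1ℤ [ b ℕ.+ m ]q [ b ℕ.+ m ]q! (ℕₚ.≤-trans (s≤s z≤n) (length-[]q! b m))) ⟩
  length [ suc b ℕ.+ m ]q! ∎
  where open ℕₚ.≤-Reasoning

-- Exact division of polynomials

coeff-beyond : ∀ f k → length f ℕ.≤ k → coeff f k ≡ 0ℤ
coeff-beyond []      k       l≤k       = refl
coeff-beyond (a ∷ f) (suc k) (s≤s l≤k) = coeff-beyond f k l≤k

coeff-+ₚ : ∀ f g k → coeff (f +ₚ g) k ≡ coeff f k + coeff g k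
coeff-+ₚ []      g       k       = sym (ℤₚ.+-identityˡ _)
coeff-+ₚ (a ∷ f) []      k       = sym (ℤₚ.+-identityʳ _)
coeff-+ₚ (a ∷ f) (b ∷ g) zero    = refl
coeff-+ₚ (a ∷ f) (b ∷ g) (suc k) = coeff-+ₚ f g k

coeff-·ₚ : ∀ c f k → coeff (c ·ₚ f) k ≡ c * coeff f k
coeff-·ₚ c []      k       = sym (ℤₚ.*-zeroʳ c)
coeff-·ₚ c (a ∷ f) zero    = refl
coeff-·ₚ c (a ∷ f) (suc k) = coeff-·ₚ c f k

coeff-drop₁ : ∀ f k → coeff (drop 1 f) k ≡ coeff f (suc k)
coeff-drop₁ []      k = refl
coeff-drop₁ (a ∷ f) k = refl

coeff-*ₚ-zero : ∀ f g → coeff (f *ₚ g) 0 ≡ coeff f 0 * coeff g 0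
coeff-*ₚ-zero []      g = sym (ℤₚ.*-zeroˡ (coeff g 0))
coeff-*ₚ-zero (a ∷ f) g = trans (coeff-+ₚ (a ·ₚ g) _ 0) (trans (ℤₚ.+-identityʳ _) (coeff-·ₚ a g 0))

-- As g starts with 1, the constant terms of f and h agree. Subtracting that multiple of g and
-- dividing by q replaces h by its tail; the case `[]` serves the coefficients beyond the list h.
coeff-quotient : ∀ k {f g} h → coeff g 0 ≡ 1ℤ → f ≈ₚ h *ₚ g → ∀ i → i ℕ.< k → coeff (quotient k f g) i ≡ coeff h i
coeff-quotient (suc k) {f} {g} h g₀ e zero i<k = trans (e 0) (trans (coeff-*ₚ-zero h g) (trans (cong (_*_ (coeff h 0)) g₀) (ℤₚ.*-identityʳ _)))
coeff-quotient (suc k) {f} {g} [] g₀ e (suc i) (s≤s i<k) = coeff-quotient k [] g₀ e′ i i<k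
  where
  e′ : drop 1 (f -ₚ coeff f 0 ·ₚ g) ≈ₚ []
  e′ j rewrite coeff-drop₁ (f -ₚ coeff f 0 ·ₚ g) j | coeff-+ₚ f (-1ℤ ·ₚ (coeff f 0 ·ₚ g)) (suc j) | coeff-·ₚ -1ℤ (coeff f 0 ·ₚ g) (suc j)
    | coeff-·ₚ (coeff f 0) g (suc j) | e 0 | e (suc j) | ℤₚ.*-zeroˡ (coeff g (suc j)) = refl
coeff-quotient (suc k) {f} {g} (a ∷ h) g₀ e (suc i) (s≤s i<k) = coeff-quotient k h g₀ e′ i i<k
  where
  cancel : ∀ a x y → a * x + y + -1ℤ * (a * x) ≡ y
  cancel = ℤ-Solver.solve-∀
  f₀ : coeff f 0 ≡ a
  f₀ = trans (e 0) (trans (coeff-*ₚ-zero (a ∷ h) g) (trans (cong (_*_ a) g₀) (ℤₚ.*-identityʳ a)))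
  e′ : drop 1 (f -ₚ coeff f 0 ·ₚ g) ≈ₚ h *ₚ g
  e′ j rewrite coeff-drop₁ (f -ₚ coeff f 0 ·ₚ g) j | coeff-+ₚ f (-1ℤ ·ₚ (coeff f 0 ·ₚ g)) (suc j) | coeff-·ₚ -1ℤ (coeff f 0 ·ₚ g) (suc j)
    | coeff-·ₚ (coeff f 0) g (suc j) | f₀ | e (suc j) | coeff-+ₚ (a ·ₚ g) (0ℤ ∷ (h *ₚ g)) (suc j) | coeff-·ₚ a g (suc j) = cancel a (coeff g (suc j)) _

length-quotient : ∀ k f g → length (quotient k f g) ≡ k
length-quotient zero    f g = refl
length-quotient (suc k) f g = cong suc (length-quotient k _ g)

/ₚ-exact : ∀ {f g} h → coeff g 0 ≡ 1ℤ → f ≈ₚ h *ₚ g → length h ℕ.≤ length f → f /ₚ g ≈ₚ h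
/ₚ-exact {f} {g} h g₀ e l i with i ℕₚ.<? length f
... | yes i<l = coeff-quotient (length f) h g₀ e i i<l
... | no  i≮l = trans (coeff-beyond (f /ₚ g) i (ℕₚ.≤-trans (ℕₚ.≤-reflexive (length-quotient (length f) f g)) (ℕₚ.≮⇒≥ i≮l)))
  (sym (coeff-beyond h i (ℕₚ.≤-trans l (ℕₚ.≮⇒≥ i≮l))))

coeff-[]q!-zero : ∀ a → coeff [ a ]q! 0 ≡ 1ℤ
coeff-[]q!-zero zero    = refl
coeff-[]q!-zero (suc a) = trans (coeff-*ₚ-zero [ suc a ]q [ a ]q!) (trans (ℤₚ.*-identityˡ _) (coeff-[]q!-zero a))

qBinomial≈gaussian : ∀ b m → qBinomial (b ℕ.+ m) b ≈ₚ gaussian (suc b) m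
qBinomial≈gaussian b m rewrite ℕₚ.m+n∸m≡n b m = /ₚ-exact {[ b ℕ.+ m ]q!} {[ b ]q! *ₚ [ m ]q!} (gaussian (suc b) m)
  (trans (coeff-*ₚ-zero [ b ]q! [ m ]q!) (cong₂ _*_ (coeff-[]q!-zero b) (coeff-[]q!-zero m)))
  (λ k → sym (≅⇒≈ₚ (gaussian-product b m) k))
  (ℕₚ.≤-trans (ℕₚ.≤-reflexive (length-gaussian b m)) (length-[]q! b m))

pair-sum : ∀ {A : Set} w (xs : List A) (g : A → Poly) → pair w (foldr _+ₚ_ [] (map g xs)) ≡ ∑L xs (pair w ∘ g)
pair-sum w []       g = refl
pair-sum w (x ∷ xs) g = trans (pair-+ₚ w (g x) _) (cong (_+_ (pair w (g x))) (pair-sum w xs g))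

-- With n = b + 1 and s = i + 1 the upper index 2n - s - 1 is b + (b - i), so the summand is h_(b-i)
-- in n variables and every degree below n occurs once.
pair-t : ∀ w b → pair w (t (suc b)) ≡ ∑ (suc b) (λ i → H (downFrom (suc b)) (b ∸ i) w)
pair-t w b = trans (pair-sum w (upTo (suc b)) (λ i → qBinomial (2 ℕ.* suc b ∸ suc i ∸ 1) b)) (∑-cong< (suc b) (λ i i<n → begin
  pair w (qBinomial (2 ℕ.* suc b ∸ suc i ∸ 1) b) ≡⟨ cong (λ a → pair w (qBinomial a b)) (top i (ℕₚ.≤-pred i<n)) ⟩
  pair w (qBinomial (b ℕ.+ (b ∸ i)) b) ≡⟨ pair-resp-≈ w (qBinomial (b ℕ.+ (b ∸ i)) b) (gaussian (suc b) (b ∸ i)) (qBinomial≈gaussian b (b ∸ i)) ⟩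
  pair w (gaussian (suc b) (b ∸ i)) ≡⟨ pair-gaussian w (suc b) (b ∸ i) ⟩
  H (downFrom (suc b)) (b ∸ i) w                   ∎))
  where
  open ≡-Reasoning
  lemma : ∀ b → b ℕ.+ suc (b ℕ.+ 0) ≡ suc (b ℕ.+ b)
  lemma = ℕ-Solver.solve-∀
  top : ∀ i → i ℕ.≤ b → 2 ℕ.* suc b ∸ suc i ∸ 1 ≡ b ℕ.+ (b ∸ i)
  top i i≤b rewrite lemma b | ℕₚ.+-∸-assoc 1 (ℕₚ.≤-trans i≤b (ℕₚ.m≤m+n b b)) = ℕₚ.+-∸-assoc b i≤b

-- The functional that reads off the coefficient of q after reduction modulo q^n - 1.
δ₁ : (n : ℕ) → .{{_ : NonZero n}} → ℕ → ℤ
δ₁ n k = χ (k % n ℕₚ.≟ 1 % n)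

δ₁-periodic : ∀ n .{{_ : NonZero n}} → Periodic n (δ₁ n)
δ₁-periodic n k = cong (λ r → χ (r ℕₚ.≟ 1 % n)) ([m+n]%n≡m%n k n)
  where open import Data.Nat.DivMod using ([m+n]%n≡m%n)

-- A functional of period n takes the same value on q^(i+n) and q^i, so it kills the multiples of
-- q^n - 1.
pair-mod : ∀ {n w} f g → Periodic n w → f ≡ g [mod q^ n -ₚ [ 1ℤ ] ] → pair w f ≡ pair w g
pair-mod {n} {w} f g p (h , e) = ℤₚ.i-j≡0⇒i≡j _ _ (begin
  pair w f - pair w g ≡⟨ lemma (pair w f) (pair w g) ⟩
  pair w f + -1ℤ * pair w g ≡⟨ cong (_+_ (pair w f)) (sym (pair-·ₚ w -1ℤ g)) ⟩
  pair w f + pair w (-1ℤ ·ₚ g) ≡⟨ sym (pair-+ₚ w f (-1ℤ ·ₚ g)) ⟩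
  pair w (f -ₚ g) ≡⟨ pair-resp-≈ w (f -ₚ g) (h *ₚ (q^ n -ₚ [ 1ℤ ])) e ⟩
  pair w (h *ₚ (q^ n -ₚ [ 1ℤ ])) ≡⟨ pair-*ₚ w h _ ⟩
  pair (λ i → pair (λ j → w (i ℕ.+ j)) (q^ n -ₚ [ 1ℤ ])) h ≡⟨ pair-cong h vanish ⟩
  pair (λ i → 0ℤ) h ≡⟨ pair-null h ⟩
  0ℤ                                     ∎)
  where
  open ≡-Reasoning
  lemma : ∀ a b → a - b ≡ a + -1ℤ * b
  lemma = ℤ-Solver.solve-∀
  lemma′ : ∀ a → a + (-1ℤ * a + 0ℤ) ≡ 0ℤ
  lemma′ = ℤ-Solver.solve-∀
  vanish : ∀ i → pair (λ j → w (i ℕ.+ j)) (q^ n -ₚ [ 1ℤ ]) ≡ 0ℤ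
  vanish i = trans (pair-+ₚ (λ j → w (i ℕ.+ j)) (q^ n) _)
    (trans (cong₂ _+_ (trans (pair-q^ _ n) (p i)) (cong (λ k → -1ℤ * w k + 0ℤ) (ℕₚ.+-identityʳ i))) (lemma′ (w i)))

-- Among the exponents below n, the only ones that occur in t̃, `δ₁ n` is nonzero exactly at 1 % n.
-- By periodicity t̃ can then be exchanged for `t n`.
linearCoefficient≡H : ∀ n .{{_ : NonZero n}} t̃ → IsReducedT n t̃ →
  linearCoefficientMod n t̃ ≡ ∑ n (λ i → H (downFrom n) (n ∸ suc i) (δ₁ n))
linearCoefficient≡H n@(suc b) t̃ (deg , e) = begin
  coeff t̃ (1 % n) ≡⟨ sym (ℤₚ.*-identityʳ _) ⟩
  coeff t̃ (1 % n) * 1ℤ ≡⟨ cong (_*_ (coeff t̃ (1 % n))) (sym (χ-yes (1 % n % n ℕₚ.≟ 1 % n) (m<n⇒m%n≡m (m%n<n 1 n)))) ⟩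
  coeff t̃ (1 % n) * δ₁ n (1 % n) ≡⟨ sym (∑-single (m%n<n 1 n) other) ⟩
  ∑ n (λ k → coeff t̃ k * δ₁ n k) ≡⟨ sym (pair-∑ (δ₁ n) n t̃ deg) ⟩
  pair (δ₁ n) t̃ ≡⟨ pair-mod t̃ (t n) (δ₁-periodic n) e ⟩
  pair (δ₁ n) (t n) ≡⟨ pair-t (δ₁ n) b ⟩
  ∑ n (λ i → H (downFrom n) (b ∸ i) (δ₁ n)) ∎
  where
  open ≡-Reasoning
  other : ∀ k → k ℕ.< n → k ≢ 1 % n → coeff t̃ k * δ₁ n k ≡ 0ℤ
  other k k<n k≢ = trans (cong (_*_ (coeff t̃ k)) (χ-no (k % n ℕₚ.≟ 1 % n) (λ e → k≢ (trans (sym (m<n⇒m%n≡m k<n)) e)))) (ℤₚ.*-zeroʳ (coeff t̃ k))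

-- Counting primitive cyclic words

psum : (ℕ → ℕ) → ℕ → ℕ
psum f n = sum (applyUpTo f n)

psum-cong< : ∀ {f g : ℕ → ℕ} n → (∀ i → i ℕ.< n → f i ≡ g i) → psum f n ≡ psum g n
psum-cong< zero    e = refl
psum-cong< (suc n) e = cong₂ ℕ._+_ (e 0 (s≤s z≤n)) (psum-cong< n (λ i i<n → e (suc i) (s≤s i<n)))

psum-+ : ∀ f a b → psum f (a ℕ.+ b) ≡ psum f a ℕ.+ psum (λ i → f (a ℕ.+ i)) b
psum-+ f zero    b = refl
psum-+ f (suc a) b = trans (cong (ℕ._+_ (f 0)) (psum-+ (f ∘ suc) a b)) (sym (ℕₚ.+-assoc (f 0) _ _))

psum-periodic : ∀ {N f} → Periodic N f → ∀ k → psum f (k ℕ.* N) ≡ k ℕ.* psum f N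
psum-periodic         p zero    = refl
psum-periodic {N} {f} p (suc k) = trans (psum-+ f N (k ℕ.* N))
  (cong (ℕ._+_ (psum f N)) (trans (psum-cong< (k ℕ.* N) (λ i _ → trans (cong f (ℕₚ.+-comm N i)) (p i))) (psum-periodic p k)))

∑-split : ∀ a b f → ∑ (a ℕ.+ b) f ≡ ∑ a f + ∑ b (λ i → f (a ℕ.+ i))
∑-split zero    b f = sym (ℤₚ.+-identityˡ _)
∑-split (suc a) b f = trans (∑-suc (a ℕ.+ b) f) (trans (cong (_+_ (f 0)) (∑-split a b (f ∘ suc)))
  (trans (sym (ℤₚ.+-assoc (f 0) _ _)) (cong (_+ ∑ b (λ i → f (suc a ℕ.+ i))) (sym (∑-suc a f)))))

∑-multiples : ∀ e .{{_ : NonZero e}} k (g : ℕ → ℤ) →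
  ∑ (k ℕ.* e) (λ j → χ (e ∣? suc j) * g (suc j)) ≡ ∑ k (λ i → g (suc i ℕ.* e))
∑-multiples e       zero    g = refl
∑-multiples (suc e) (suc k) g = begin
  ∑ (suc e ℕ.+ k ℕ.* suc e) term
    ≡⟨ ∑-split (suc e) (k ℕ.* suc e) term ⟩
  ∑ (suc e) term + ∑ (k ℕ.* suc e) (λ j → χ (suc e ∣? suc (suc e ℕ.+ j)) * g (suc (suc e ℕ.+ j)))
    ≡⟨ cong₂ _+_ first (∑-cong (k ℕ.* suc e) (λ j → cong₂ _*_
         (χ-cong (suc e ∣? suc (suc e ℕ.+ j)) (suc e ∣? suc j) (down j) (up j)) (cong g (sym (ℕₚ.+-suc (suc e) j))))) ⟩
  g (1 ℕ.* suc e) + ∑ (k ℕ.* suc e) (λ j → χ (suc e ∣? suc j) * g (suc e ℕ.+ suc j))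
    ≡⟨ cong (_+_ (g (1 ℕ.* suc e))) (∑-multiples (suc e) k (λ j → g (suc e ℕ.+ j))) ⟩
  g (1 ℕ.* suc e) + ∑ k (λ i → g (suc (suc i) ℕ.* suc e))
    ≡⟨ sym (∑-suc k (λ i → g (suc i ℕ.* suc e))) ⟩
  ∑ (suc k) (λ i → g (suc i ℕ.* suc e)) ∎
  where
  open ≡-Reasoning
  term : ℕ → ℤ
  term j = χ (suc e ∣? suc j) * g (suc j)
  down : ∀ j → suc e ∣ suc (suc e ℕ.+ j) → suc e ∣ suc j
  down j d = ∣m+n∣m⇒∣n (subst (suc e ∣_) (sym (ℕₚ.+-suc (suc e) j)) d) ∣-refl
  up : ∀ j → suc e ∣ suc j → suc e ∣ suc (suc e ℕ.+ j)
  up j d = subst (suc e ∣_) (ℕₚ.+-suc (suc e) j) (∣m∣n⇒∣m+n ∣-refl d)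
  first : ∑ (suc e) term ≡ g (1 ℕ.* suc e)
  first = trans (∑-single {suc e} {e} {term} ℕₚ.≤-refl (λ i i<e i≢e →
      cong (_* g (suc i)) (χ-no (suc e ∣? suc i) (λ d → i≢e (ℕₚ.≤-antisym (ℕₚ.≤-pred i<e) (ℕₚ.≤-pred (∣⇒≤ d)))))))
    (trans (cong (_* g (suc e)) (χ-yes (suc e ∣? suc e) ∣-refl)) (trans (ℤₚ.*-identityˡ _) (cong g (sym (ℕₚ.*-identityˡ (suc e))))))

-- Words and their periodic extensions

nth : List ℕ → ℕ → ℕ
nth []      i       = 0
nth (a ∷ w) zero    = a
nth (a ∷ w) (suc i) = nth w i

nth-applyUpTo : ∀ f {n i} → i ℕ.< n → nth (applyUpTo f n) i ≡ f i
nth-applyUpTo f {suc n} {zero}  i<n       = refl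
nth-applyUpTo f {suc n} {suc i} (s≤s i<n) = nth-applyUpTo (f ∘ suc) i<n

applyUpTo-nth : ∀ w → applyUpTo (nth w) (length w) ≡ w
applyUpTo-nth []      = refl
applyUpTo-nth (a ∷ w) = cong (a ∷_) (applyUpTo-nth w)

applyUpTo-cong< : ∀ {f g : ℕ → A} n → (∀ i → i ℕ.< n → f i ≡ g i) → applyUpTo f n ≡ applyUpTo g n
applyUpTo-cong< zero    e = refl
applyUpTo-cong< (suc n) e = cong₂ _∷_ (e 0 (s≤s z≤n)) (applyUpTo-cong< n (λ i i<n → e (suc i) (s≤s i<n)))

ext : (n : ℕ) → .{{_ : NonZero n}} → List ℕ → ℕ → ℕ
ext n w i = nth w (i % n)

module _ (n : ℕ) .{{_ : NonZero n}} where

  ext-periodic : ∀ w → Periodic n (ext n w)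
  ext-periodic w i = cong (nth w) ([m+n]%n≡m%n i n)

  periodic-% : ∀ {f : ℕ → A} → Periodic n f → ∀ i → f (i % n) ≡ f i
  periodic-% {f = f} p i = trans (sym (Periodic-* p (i / n) (i % n))) (cong f (sym (m≡m%n+[m/n]*n i n)))

  ext-applyUpTo : ∀ {f} → Periodic n f → ∀ i → ext n (applyUpTo f n) i ≡ f i
  ext-applyUpTo {f} p i = trans (nth-applyUpTo f (m%n<n i n)) (periodic-% p i)

  applyUpTo-ext : ∀ {w} → length w ≡ n → applyUpTo (ext n w) n ≡ w
  applyUpTo-ext {w} refl = trans (applyUpTo-cong< n (λ i i<n → cong (nth w) (m<n⇒m%n≡m i<n))) (applyUpTo-nth w)

  rotate : ℕ → List ℕ → List ℕ
  rotate k w = applyUpTo (λ i → ext n w (i ℕ.+ k)) n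

  shift-% : ∀ {f : ℕ → A} → Periodic n f → ∀ s i → f (i ℕ.+ s % n) ≡ f (i ℕ.+ s)
  shift-% {f = f} p s i = trans (sym (Periodic-* p (s / n) (i ℕ.+ s % n)))
    (cong f (trans (ℕₚ.+-assoc i (s % n) _) (cong (ℕ._+_ i) (sym (m≡m%n+[m/n]*n s n)))))

  ext-rotate : ∀ k w i → ext n (rotate k w) i ≡ ext n w (i ℕ.+ k)
  ext-rotate k w = ext-applyUpTo (shift-periodic k (ext-periodic w))

  length-rotate : ∀ k w → length (rotate k w) ≡ n
  length-rotate k w = length-applyUpTo _ n

  periodic? : ∀ {f : ℕ → ℕ} → Periodic n f → ∀ p → Dec (Periodic p f)
  periodic? {f} n-per p with ≡-dec ℕₚ._≟_ (applyUpTo (λ i → f (i ℕ.+ p)) n) (applyUpTo f n)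
  ... | yes e = yes (λ i → begin
    f (i ℕ.+ p) ≡⟨ sym (ext-applyUpTo (shift-periodic p n-per) i) ⟩
    ext n (applyUpTo (λ i → f (i ℕ.+ p)) n) i ≡⟨ cong (λ w → ext n w i) e ⟩
    ext n (applyUpTo f n) i ≡⟨ ext-applyUpTo n-per i ⟩
    f i                                               ∎)
    where open ≡-Reasoning
  ... | no ¬e = no (λ p-per → ¬e (applyUpTo-cong< n (λ i _ → p-per i)))

  -- Descent through smaller positive periods. When none is left below p, the remainder of any
  -- period modulo p is again a period and must be 0.
  leastPeriod : ∀ {f : ℕ → ℕ} → Periodic n f →
    ∃ λ p → 1 ℕ.≤ p × Periodic p f × (∀ q → Periodic q f → p ∣ q)
  leastPeriod {f} n-per = <-rec (λ p → 1 ℕ.≤ p → Periodic p f → Goal) step n (ℕ.>-nonZero⁻¹ n) n-per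
    where
    Goal : Set
    Goal = ∃ λ p → 1 ℕ.≤ p × Periodic p f × (∀ q → Periodic q f → p ∣ q)
    step : ∀ p → (∀ {q} → q ℕ.< p → 1 ℕ.≤ q → Periodic q f → Goal) → 1 ℕ.≤ p → Periodic p f → Goal
    step p@(suc _) rec 1≤p p-per with ℕₚ.anyUpTo? (λ q → (1 ℕₚ.≤? q) ×-dec periodic? n-per q) p
    ... | yes (q , q<p , 1≤q , q-per) = rec q<p 1≤q q-per
    ... | no ¬smaller = p , 1≤p , p-per , minimal
      where
      minimal : ∀ q → Periodic q f → p ∣ q
      minimal q q-per = m%n≡0⇒n∣m q p (remainder (q % p) refl)
        where
        q%p-per : Periodic (q % p) f
        q%p-per i = trans (sym (Periodic-* p-per (q / p) (i ℕ.+ q % p)))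
          (trans (cong f (trans (ℕₚ.+-assoc i (q % p) _) (cong (ℕ._+_ i) (sym (m≡m%n+[m/n]*n q p))))) (q-per i))
        remainder : ∀ r → q % p ≡ r → q % p ≡ 0
        remainder zero    e = e
        remainder (suc r) e = contradiction (q % p , m%n<n q p , ℕₚ.≤-trans (s≤s z≤n) (ℕₚ.≤-reflexive (sym e)) , q%p-per) ¬smaller

  IsPrimitive : (ℕ → ℕ) → Set
  IsPrimitive f = ∀ p → 1 ℕ.≤ p → Periodic p f → n ℕ.≤ p

  isPrimitive? : ∀ w → Dec (IsPrimitive (ext n w))
  isPrimitive? w with p , 1≤p , p-per , minimal ← leastPeriod (ext-periodic w) with n ℕₚ.≤? p
  ... | yes n≤p = yes (λ q 1≤q q-per → ℕₚ.≤-trans n≤p (∣⇒≤ {{ℕ.>-nonZero 1≤q}} (minimal q q-per)))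
  ... | no  n≰p = no (λ prim → n≰p (prim p 1≤p p-per))

increaseHead : List ℕ → List ℕ
increaseHead []      = []
increaseHead (a ∷ w) = suc a ∷ w

-- A head 0 or an increased head: the two cases mirror the recursion of `H`, so that the number of
-- words is h_m at N variables equal to 1.
words : ℕ → ℕ → List (List ℕ)
words zero    zero    = [ [] ]
words zero    (suc m) = []
words (suc N) zero    = map (0 ∷_) (words N zero)
words (suc N) (suc m) = map (0 ∷_) (words N (suc m)) ++ map increaseHead (words (suc N) m)

HasLengthAndSum : ℕ → ℕ → List ℕ → Set
HasLengthAndSum N m w = length w ≡ N × sum w ≡ m

∈-zero-head : ∀ {N m ws w} → (∀ {v} → v ∈ ws → HasLengthAndSum N m v) → w ∈ map (0 ∷_) ws → HasLengthAndSum (suc N) m w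
∈-zero-head ws-sound w∈ with v , v∈ , refl ← ∈-map⁻ (0 ∷_) w∈ with l , s ← ws-sound v∈ = cong suc l , s

∈-increaseHead : ∀ {N m ws w} → (∀ {v} → v ∈ ws → HasLengthAndSum (suc N) m v) → w ∈ map increaseHead ws → HasLengthAndSum (suc N) (suc m) w
∈-increaseHead ws-sound w∈ with ∈-map⁻ increaseHead w∈
... | []    , v∈ , refl = contradiction (proj₁ (ws-sound v∈)) (λ ())
... | _ ∷ _ , v∈ , refl with l , s ← ws-sound v∈ = l , cong suc s

words-sound : ∀ N m {w} → w ∈ words N m → HasLengthAndSum N m w
words-sound zero    zero    (here refl) = refl , refl
words-sound (suc N) zero    w∈ = ∈-zero-head (words-sound N zero) w∈
words-sound (suc N) (suc m) w∈ = [ ∈-zero-head (words-sound N (suc m)) , ∈-increaseHead (words-sound (suc N) m) ]′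
  (∈-++⁻ (map (0 ∷_) (words N (suc m))) w∈)

words-complete : ∀ w → w ∈ words (length w) (sum w)
words-complete []          = here refl
words-complete (zero ∷ w)  = zero-head (sum w) (words-complete w)
  where
  zero-head : ∀ {N} m {w} → w ∈ words N m → (0 ∷ w) ∈ words (suc N) m
  zero-head zero    w∈ = ∈-map⁺ (0 ∷_) w∈
  zero-head (suc m) w∈ = ∈-++⁺ˡ (∈-map⁺ (0 ∷_) w∈)
words-complete (suc a ∷ w) = ∈-++⁺ʳ (map (0 ∷_) (words (length w) (suc (a ℕ.+ sum w)))) (∈-map⁺ increaseHead (words-complete (a ∷ w)))

words-unique : ∀ N m → Unique (words N m)
words-unique zero    zero    = All.[] AllPairs.∷ AllPairs.[]
words-unique zero    (suc m) = AllPairs.[]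
words-unique (suc N) zero    = Unique.map⁺ ∷-injectiveʳ (words-unique N zero)
words-unique (suc N) (suc m) = Unique.++⁺ (Unique.map⁺ ∷-injectiveʳ (words-unique N (suc m)))
  (Unique.map⁺ increaseHead-injective (words-unique (suc N) m)) disjoint
  where
  increaseHead-injective : ∀ {v w} → increaseHead v ≡ increaseHead w → v ≡ w
  increaseHead-injective {[]}    {[]}    e    = refl
  increaseHead-injective {a ∷ v} {b ∷ w} refl = refl
  disjoint : ∀ {w} → ¬ (w ∈ map (0 ∷_) (words N (suc m)) × w ∈ map increaseHead (words (suc N) m))
  disjoint (w∈ , w∈′) with ∈-map⁻ (0 ∷_) w∈ | ∈-map⁻ increaseHead w∈′
  ... | v , _ , refl | []    , _ , ()
  ... | v , _ , refl | _ ∷ _ , _ , ()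

length-unique : ∀ {xs ys : List A} → Unique xs → Unique ys → (∀ {x} → x ∈ xs → x ∈ ys) → (∀ {x} → x ∈ ys → x ∈ xs) → length xs ≡ length ys
length-unique u v f g = ↭-length (∼bag⇒↭ (unique∧set⇒bag u v (mk⇔ f g)))

length-filter-χ : ∀ {P : A → Set} (P? : Decidable P) xs → + length (filter P? xs) ≡ ∑L xs (χ ∘ P?)
length-filter-χ P? []       = refl
length-filter-χ P? (x ∷ xs) with P? x
... | yes _ = cong (_+_ 1ℤ) (length-filter-χ P? xs)
... | no  _ = trans (length-filter-χ P? xs) (sym (ℤₚ.+-identityˡ _))

length-words : ∀ N m → + length (words N m) ≡ H (replicate N 0) m (λ _ → 1ℤ)
length-words zero    zero    = refl
length-words zero    (suc m) = refl
length-words (suc N) zero    = trans (cong +_ (length-map (0 ∷_) (words N zero))) (trans (length-words N zero) (H-zero (replicate N 0) _))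
length-words (suc N) (suc m) = trans (cong +_ (length-++ (map (0 ∷_) (words N (suc m)))))
  (cong₂ _+_ (trans (cong +_ (length-map (0 ∷_) (words N (suc m)))) (length-words N (suc m)))
               (trans (cong +_ (length-map increaseHead (words (suc N) m))) (length-words (suc N) m)))

-- Newton's identity at q = 1, where every power sum of N variables equals N.
length-words-newton : ∀ N m → + m * + length (words N m) ≡ + N * ∑ m (λ j → + length (words N (m ∸ suc j)))
length-words-newton N m = begin
  + m * + length (words N m) ≡⟨ cong (_*_ (+ m)) (length-words N m) ⟩
  + m * H (replicate N 0) m (λ _ → 1ℤ) ≡⟨ newton (replicate N 0) m (λ _ → 1ℤ) ⟩
  ∑ m (λ j → ∑L (replicate N 0) (λ _ → H (replicate N 0) (m ∸ suc j) (λ _ → 1ℤ)))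
    ≡⟨ ∑-cong m (λ j → trans (∑L-const (replicate N 0) _) (cong₂ (λ k h → + k * h) (length-replicate N) (sym (length-words N (m ∸ suc j))))) ⟩
  ∑ m (λ j → + N * + length (words N (m ∸ suc j))) ≡⟨ ∑L-*ˡ (upTo m) (+ N) _ ⟩
  + N * ∑ m (λ j → + length (words N (m ∸ suc j))) ∎
  where open ≡-Reasoning

module _ (n : ℕ) .{{_ : NonZero n}} where

  extPeriodic? : ∀ p w → Dec (Periodic p (ext n w))
  extPeriodic? p w = periodic? n (ext-periodic n w) p

  -- For a divisor e of n, these are the words fixed by the rotations of order dividing e, and their
  -- number is the coefficient of z^m in (1 - z^e)^(-n/e). At e = 0 a default stands in, since n / e
  -- asks for a nonzero e.
  symmetricWords : ℕ → ℕ → ℤ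
  symmetricWords zero      m = 0ℤ
  symmetricWords e@(suc _) m = ∑L (words n m) (λ w → χ (extPeriodic? (n / e) w))

  symmetricWords-nondivisible : ∀ N e .{{_ : NonZero e}} → n ≡ N ℕ.* e → ∀ m → ¬ (e ∣ m) → symmetricWords e m ≡ 0ℤ
  symmetricWords-nondivisible N e@(suc _) n≡Ne m e∤m = trans (∑L-cong (words n m) (λ {w} w∈ → χ-no (extPeriodic? (n / e) w) (λ per →
      e∤m (divides (psum (ext n w) N) (begin
        m ≡⟨ sym (proj₂ (words-sound n m {w} w∈)) ⟩
        sum w ≡⟨ cong sum (sym (applyUpTo-ext n {w} (proj₁ (words-sound n m {w} w∈)))) ⟩
        psum (ext n w) n ≡⟨ cong (psum (ext n w)) (trans n≡Ne (ℕₚ.*-comm N e)) ⟩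
        psum (ext n w) (e ℕ.* N) ≡⟨ psum-periodic (subst (λ p → Periodic p (ext n w)) n/e≡N per) e ⟩
        e ℕ.* psum (ext n w) N ≡⟨ ℕₚ.*-comm e _ ⟩
        psum (ext n w) N ℕ.* e         ∎)))))
    (∑L-zero (words n m))
    where
    open ≡-Reasoning
    n/e≡N : n / e ≡ N
    n/e≡N = trans (cong (_/ e) n≡Ne) (m*n/n≡m N e)

  -- A word of length N e with period N is the e-fold repetition of a word of length N, and
  -- repetition multiplies the sum by e.
  symmetricWords-multiple : ∀ N e .{{_ : NonZero e}} → n ≡ N ℕ.* e → ∀ k → symmetricWords e (k ℕ.* e) ≡ + length (words N k)
  symmetricWords-multiple zero      e@(suc _) refl k = contradiction refl (ℕ.≢-nonZero⁻¹ n)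
  symmetricWords-multiple N@(suc _) e@(suc _) n≡Ne k = trans (sym (length-filter-χ P? (words n (k ℕ.* e)))) (cong +_ (trans
      (length-unique (Unique.filter⁺ P? (words-unique n (k ℕ.* e))) (Unique.map⁻ {f = restrict} (subst Unique (sym restrict-repeat) (words-unique N k))) forward backward)
      (length-map repeat (words N k))))
    where
    open ≡-Reasoning
    n≡eN : n ≡ e ℕ.* N
    n≡eN = trans n≡Ne (ℕₚ.*-comm N e)
    n/e≡N : n / e ≡ N
    n/e≡N = trans (cong (_/ e) n≡Ne) (m*n/n≡m N e)
    P? : ∀ w → Dec (Periodic (n / e) (ext n w))
    P? = extPeriodic? (n / e)
    repeat : List ℕ → List ℕ
    repeat v = applyUpTo (ext N v) n
    ext-repeat : ∀ v i → ext n (repeat v) i ≡ ext N v i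
    ext-repeat v = ext-applyUpTo n (λ i → trans (cong (λ a → ext N v (i ℕ.+ a)) n≡eN) (Periodic-* (ext-periodic N v) e i))
    restrict : List ℕ → List ℕ
    restrict w = applyUpTo (ext n w) N
    restrict-repeat : map restrict (map repeat (words N k)) ≡ words N k
    restrict-repeat = trans (sym (map-∘ (words N k))) (map-id-local (All.tabulate (λ {v} v∈ →
      trans (applyUpTo-cong< N (λ i _ → ext-repeat v i)) (applyUpTo-ext N {v} (proj₁ (words-sound N k {v} v∈))))))
    forward : ∀ {w} → w ∈ filter P? (words n (k ℕ.* e)) → w ∈ map repeat (words N k)
    forward {w} w∈ with w∈ , per ← ∈-filter⁻ P? w∈ with l , s ← words-sound n (k ℕ.* e) {w} w∈ =
      subst (_∈ map repeat (words N k)) repeat-restrict (∈-map⁺ repeat (subst₂ (λ a b → restrict w ∈ words a b) (length-applyUpTo (ext n w) N) sum-restrict (words-complete (restrict w))))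
      where
      N-per : Periodic N (ext n w)
      N-per = subst (λ p → Periodic p (ext n w)) n/e≡N per
      repeat-restrict : repeat (restrict w) ≡ w
      repeat-restrict = trans (applyUpTo-cong< n (λ i _ → ext-applyUpTo N {ext n w} N-per i)) (applyUpTo-ext n {w} l)
      sum-restrict : sum (restrict w) ≡ k
      sum-restrict = ℕₚ.*-cancelʳ-≡ _ _ e (begin
        psum (ext n w) N ℕ.* e ≡⟨ ℕₚ.*-comm (psum (ext n w) N) e ⟩
        e ℕ.* psum (ext n w) N ≡⟨ sym (psum-periodic N-per e) ⟩
        psum (ext n w) (e ℕ.* N) ≡⟨ cong (psum (ext n w)) (sym n≡eN) ⟩
        psum (ext n w) n ≡⟨ cong sum (applyUpTo-ext n {w} l) ⟩
        sum w ≡⟨ s ⟩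
        k ℕ.* e                    ∎)
    backward : ∀ {w} → w ∈ map repeat (words N k) → w ∈ filter P? (words n (k ℕ.* e))
    backward w∈ with v , v∈ , refl ← ∈-map⁻ repeat w∈ with l , s ← words-sound N k {v} v∈ =
      ∈-filter⁺ P? (subst₂ (λ a b → repeat v ∈ words a b) (length-applyUpTo (ext N v) n) sum-repeat (words-complete (repeat v)))
        (subst (λ p → Periodic p (ext n (repeat v))) (sym n/e≡N) (λ i → trans (ext-repeat v (i ℕ.+ N)) (trans (ext-periodic N v i) (sym (ext-repeat v i)))))
      where
      sum-repeat : sum (repeat v) ≡ k ℕ.* e
      sum-repeat = begin
        psum (ext N v) n ≡⟨ cong (psum (ext N v)) n≡eN ⟩
        psum (ext N v) (e ℕ.* N) ≡⟨ psum-periodic (ext-periodic N v) e ⟩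
        e ℕ.* psum (ext N v) N ≡⟨ cong (ℕ._*_ e) (cong sum (applyUpTo-ext N {v} l)) ⟩
        e ℕ.* sum v ≡⟨ cong (ℕ._*_ e) s ⟩
        e ℕ.* k ≡⟨ ℕₚ.*-comm e k ⟩
        k ℕ.* e ∎

  symmetricWords-zero : ∀ e → 1 ℕ.≤ e → e ∣ n → symmetricWords e 0 ≡ 1ℤ
  symmetricWords-zero e@(suc _) _ (divides N n≡Ne) = trans (symmetricWords-multiple N e n≡Ne 0)
    (trans (length-words N 0) (H-zero (replicate N 0) _))

  -- If e does not divide m + 1, both sides vanish, since e cannot divide both j + 1 and m - j.
  -- Otherwise only the multiples of e contribute, and what remains is e times Newton's identity for
  -- words of length n / e.
  symmetricWords-suc : ∀ e → 1 ℕ.≤ e → e ∣ n → ∀ m →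
    + suc m * symmetricWords e (suc m) ≡ + n * ∑ (suc m) (λ j → χ (e ∣? suc j) * symmetricWords e (m ∸ j))
  symmetricWords-suc e@(suc _) _ (divides N n≡Ne) m with e ∣? suc m
  ... | no e∤m = begin
    + suc m * symmetricWords e (suc m) ≡⟨ cong (_*_ (+ suc m)) (symmetricWords-nondivisible N e n≡Ne (suc m) e∤m) ⟩
    + suc m * 0ℤ ≡⟨ ℤₚ.*-zeroʳ (+ suc m) ⟩
    0ℤ ≡⟨ sym (ℤₚ.*-zeroʳ (+ n)) ⟩
    + n * 0ℤ ≡⟨ cong (_*_ (+ n)) (sym (∑-zero< (suc m) vanish)) ⟩
    + n * ∑ (suc m) (λ j → χ (e ∣? suc j) * symmetricWords e (m ∸ j)) ∎
    where
    open ≡-Reasoning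
    vanish : ∀ j → j ℕ.< suc m → χ (e ∣? suc j) * symmetricWords e (m ∸ j) ≡ 0ℤ
    vanish j (s≤s j≤m) with e ∣? suc j
    ... | no  _   = refl
    ... | yes e∣j = trans (ℤₚ.*-identityˡ _) (symmetricWords-nondivisible N e n≡Ne (m ∸ j)
      (λ d → e∤m (subst (e ∣_) (cong suc (ℕₚ.m+[n∸m]≡n j≤m)) (∣m∣n⇒∣m+n e∣j d))))
  ... | yes (divides k sm≡ke) = begin
    + suc m * symmetricWords e (suc m) ≡⟨ cong (λ a → + a * symmetricWords e a) sm≡ke ⟩
    + (k ℕ.* e) * symmetricWords e (k ℕ.* e) ≡⟨ cong₂ _*_ (trans (ℤₚ.pos-* k e) (ℤₚ.*-comm (+ k) (+ e))) (symmetricWords-multiple N e n≡Ne k) ⟩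
    + e * + k * + length (words N k) ≡⟨ ℤₚ.*-assoc (+ e) (+ k) _ ⟩
    + e * (+ k * + length (words N k)) ≡⟨ cong (_*_ (+ e)) (length-words-newton N k) ⟩
    + e * (+ N * ∑ k (λ j → + length (words N (k ∸ suc j)))) ≡⟨ sym (ℤₚ.*-assoc (+ e) (+ N) _) ⟩
    + e * + N * ∑ k (λ j → + length (words N (k ∸ suc j))) ≡⟨ cong₂ _*_ e*N (∑-cong k term) ⟩
    + n * ∑ k (λ j → symmetricWords e (k ℕ.* e ∸ suc j ℕ.* e)) ≡⟨ cong (_*_ (+ n)) (sym (∑-multiples e k (λ j → symmetricWords e (k ℕ.* e ∸ j)))) ⟩
    + n * ∑ (k ℕ.* e) (λ j → χ (e ∣? suc j) * symmetricWords e (k ℕ.* e ∸ suc j))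
      ≡⟨ cong (λ a → + n * ∑ a (λ j → χ (e ∣? suc j) * symmetricWords e (a ∸ suc j))) (sym sm≡ke) ⟩
    + n * ∑ (suc m) (λ j → χ (e ∣? suc j) * symmetricWords e (m ∸ j)) ∎
    where
    open ≡-Reasoning
    e*N : + e * + N ≡ + n
    e*N = trans (sym (ℤₚ.pos-* e N)) (cong +_ (trans (ℕₚ.*-comm e N) (sym n≡Ne)))
    term : ∀ j → + length (words N (k ∸ suc j)) ≡ symmetricWords e (k ℕ.* e ∸ suc j ℕ.* e)
    term j = trans (sym (symmetricWords-multiple N e n≡Ne (k ∸ suc j))) (cong (symmetricWords e) (ℕₚ.*-distribʳ-∸ e k (suc j)))

  -- After the sums are exchanged, a word of least period p contributes the sum of `τ n e (δ₁ n)`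
  -- over the divisors e of g = n / p. This is `σ n g (δ₁ n)`, the number of k < n with g k ≡ 1
  -- modulo n; since g divides n, it is 1 for g = 1 and 0 otherwise.
  H-primitive : ∀ m → + n * H (downFrom n) m (δ₁ n) ≡ ∑L (words n m) (λ w → χ (isPrimitive? n w))
  H-primitive m = begin
    + n * H (downFrom n) m (δ₁ n)
      ≡⟨ H-decomposition n symmetricWords symmetricWords-zero symmetricWords-suc m (δ₁ n) (δ₁-periodic n) ⟩
    ∑ n (λ i → χ (suc i ∣? n) * (∑L (words n m) (λ w → χ (extPeriodic? (n / suc i) w)) * τ n (suc i) (δ₁ n)))
      ≡⟨ ∑-cong n (λ i → trans (cong (_*_ (χ (suc i ∣? n))) (sym (∑L-*ʳ (words n m) (τ n (suc i) (δ₁ n)) (λ w → χ (extPeriodic? (n / suc i) w)))))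
           (sym (∑L-*ˡ (words n m) (χ (suc i ∣? n)) _))) ⟩
    ∑ n (λ i → ∑L (words n m) (λ w → χ (suc i ∣? n) * (χ (extPeriodic? (n / suc i) w) * τ n (suc i) (δ₁ n))))
      ≡⟨ ∑L-swap (upTo n) (words n m) _ ⟩
    ∑L (words n m) (λ w → ∑ n (λ i → χ (suc i ∣? n) * (χ (extPeriodic? (n / suc i) w) * τ n (suc i) (δ₁ n))))
      ≡⟨ ∑L-cong (words n m) (λ {w} _ → contribution w (leastPeriod n (ext-periodic n w))) ⟩
    ∑L (words n m) (λ w → χ (isPrimitive? n w)) ∎
    where
    open ≡-Reasoning
    contribution : ∀ w → (∃ λ p → 1 ℕ.≤ p × Periodic p (ext n w) × (∀ q → Periodic q (ext n w) → p ∣ q)) →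
      ∑ n (λ i → χ (suc i ∣? n) * (χ (extPeriodic? (n / suc i) w) * τ n (suc i) (δ₁ n))) ≡ χ (isPrimitive? n w)
    contribution w (p@(suc _) , 1≤p , p-per , minimal) with divides g n≡gp ← minimal n (ext-periodic n w) = begin
      ∑ n (λ i → χ (suc i ∣? n) * (χ (extPeriodic? (n / suc i) w) * τ n (suc i) (δ₁ n)))
        ≡⟨ ∑-cong n (λ i → trans (sym (ℤₚ.*-assoc (χ (suc i ∣? n)) _ _))
             (cong (_* τ n (suc i) (δ₁ n)) (χ-* (suc i ∣? n) (extPeriodic? (n / suc i) w) (suc i ∣? g) (to i) (λ d → ∣-trans d g∣n) (from i)))) ⟩
      divisorSum n g (λ e → τ n e (δ₁ n)) ≡⟨ divisorSum-τ n (δ₁ n) g 1≤g g∣n ⟩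
      σ n g (δ₁ n) ≡⟨ evaluation (g ℕₚ.≟ 1) ⟩
      χ (isPrimitive? n w) ∎
      where
      g∣n : g ∣ n
      g∣n = divides p (trans n≡gp (ℕₚ.*-comm g p))
      1≤g : 1 ℕ.≤ g
      1≤g = ℕₚ.n≢0⇒n>0 (λ g≡0 → ℕ.≢-nonZero⁻¹ n (trans n≡gp (cong (ℕ._* p) g≡0)))
      to : ∀ i → suc i ∣ n → Periodic (n / suc i) (ext n w) → suc i ∣ g
      to i (divides N n≡Ne) per with divides s N≡sp ← minimal N (subst (λ q → Periodic q (ext n w)) (trans (cong (_/ suc i) n≡Ne) (m*n/n≡m N (suc i))) per) =
        divides s (ℕₚ.*-cancelʳ-≡ g (s ℕ.* suc i) p (begin
          g ℕ.* p ≡⟨ sym n≡gp ⟩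
          n ≡⟨ n≡Ne ⟩
          N ℕ.* suc i ≡⟨ cong (ℕ._* suc i) N≡sp ⟩
          s ℕ.* p ℕ.* suc i ≡⟨ rearrange s p (suc i) ⟩
          s ℕ.* suc i ℕ.* p   ∎))
        where
        rearrange : ∀ a b c → a ℕ.* b ℕ.* c ≡ a ℕ.* c ℕ.* b
        rearrange = ℕ-Solver.solve-∀
      from : ∀ i → suc i ∣ g → Periodic (n / suc i) (ext n w)
      from i (divides s g≡se) = subst (λ q → Periodic q (ext n w)) (sym n/e) (Periodic-* p-per s)
        where
        rearrange : ∀ a b c → a ℕ.* b ℕ.* c ≡ a ℕ.* c ℕ.* b
        rearrange = ℕ-Solver.solve-∀
        n/e : n / suc i ≡ s ℕ.* p
        n/e = trans (cong (_/ suc i) (trans n≡gp (trans (cong (ℕ._* p) g≡se) (rearrange s (suc i) p)))) (m*n/n≡m (s ℕ.* p) (suc i))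
      evaluation : Dec (g ≡ 1) → σ n g (δ₁ n) ≡ χ (isPrimitive? n w)
      evaluation (yes refl) = trans
        (∑-single {n} {1 % n} (m%n<n 1 n) (λ k k<n k≢ → χ-no (1 ℕ.* k % n ℕₚ.≟ 1 % n) (λ e → k≢ (trans (sym (m<n⇒m%n≡m k<n)) (trans (cong (_% n) (sym (ℕₚ.*-identityˡ k))) e)))))
        (trans (χ-yes (1 ℕ.* (1 % n) % n ℕₚ.≟ 1 % n) (trans (cong (_% n) (ℕₚ.*-identityˡ (1 % n))) (m<n⇒m%n≡m (m%n<n 1 n))))
          (sym (χ-yes (isPrimitive? n w) (λ q 1≤q q-per → subst (ℕ._≤ q) (sym (trans n≡gp (ℕₚ.*-identityˡ p))) (∣⇒≤ {{ℕ.>-nonZero 1≤q}} (minimal q q-per))))))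
      evaluation (no g≢1) = trans
        (∑-zero< n (λ k _ → χ-no (g ℕ.* k % n ℕₚ.≟ 1 % n) (λ e → g≢1 (g≡1 (subst (g ∣_) (trans e 1%n≡1) (%-presˡ-∣ (m∣m*n k) g∣n))))))
        (sym (χ-no (isPrimitive? n w) (λ prim → ℕₚ.<⇒≱ p<n (prim p 1≤p p-per))))
        where
        g≡1 : g ∣ 1 → g ≡ 1
        g≡1 d = ℕₚ.≤-antisym (∣⇒≤ d) 1≤g
        1<g : 1 ℕ.< g
        1<g = ℕₚ.≤∧≢⇒< 1≤g (g≢1 ∘ sym)
        -- A divisor g > 1 forces n > 1, so the exponent 1 does not wrap around to 0.
        1%n≡1 : 1 % n ≡ 1
        1%n≡1 = m<n⇒m%n≡m (ℕₚ.<-≤-trans 1<g (∣⇒≤ g∣n))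
        p<n : p ℕ.< n
        p<n = subst (p ℕ.<_) (sym n≡gp) (subst (ℕ._< g ℕ.* p) (ℕₚ.*-identityˡ p) (ℕₚ.*-monoˡ-< p 1<g))

  wordsBelow : ℕ → List (List ℕ)
  wordsBelow zero    = []
  wordsBelow (suc k) = words n k ++ wordsBelow k

  ∑L-wordsBelow : ∀ k (F : List ℕ → ℤ) → ∑L (wordsBelow k) F ≡ ∑ k (λ i → ∑L (words n (k ∸ suc i)) F)
  ∑L-wordsBelow zero    F = refl
  ∑L-wordsBelow (suc k) F = trans (∑L-++ (words n k) (wordsBelow k) F)
    (trans (cong (_+_ (∑L (words n k) F)) (∑L-wordsBelow k F)) (sym (∑-suc k (λ i → ∑L (words n (k ∸ i)) F))))

  wordsBelow-sound : ∀ k {w} → w ∈ wordsBelow k → length w ≡ n × sum w ℕ.< k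
  wordsBelow-sound (suc k) {w} w∈ with ∈-++⁻ (words n k) w∈
  ... | inj₁ w∈ = proj₁ (words-sound n k {w} w∈) , s≤s (ℕₚ.≤-reflexive (proj₂ (words-sound n k {w} w∈)))
  ... | inj₂ w∈ = proj₁ (wordsBelow-sound k {w} w∈) , ℕₚ.m<n⇒m<1+n (proj₂ (wordsBelow-sound k {w} w∈))

  wordsBelow-complete : ∀ k {w} → length w ≡ n → sum w ℕ.< k → w ∈ wordsBelow k
  wordsBelow-complete (suc k) {w} refl (s≤s s≤k) with ℕₚ.m≤n⇒m<n∨m≡n s≤k
  ... | inj₁ s<k  = ∈-++⁺ʳ (words n k) (wordsBelow-complete k refl s<k)
  ... | inj₂ refl = ∈-++⁺ˡ (words-complete w)

  wordsBelow-unique : ∀ k → Unique (wordsBelow k)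
  wordsBelow-unique zero    = AllPairs.[]
  wordsBelow-unique (suc k) = Unique.++⁺ (words-unique n k) (wordsBelow-unique k)
    (λ {w} (w∈ , w∈′) → ℕₚ.<-irrefl (proj₂ (words-sound n k {w} w∈)) (proj₂ (wordsBelow-sound k {w} w∈′)))

  primitiveWords : List (List ℕ)
  primitiveWords = filter (isPrimitive? n) (wordsBelow n)

  length-primitiveWords : ∀ t̃ → IsReducedT n t̃ → + length primitiveWords ≡ + n * linearCoefficientMod n t̃
  length-primitiveWords t̃ red = begin
    + length primitiveWords ≡⟨ length-filter-χ (isPrimitive? n) (wordsBelow n) ⟩
    ∑L (wordsBelow n) (χ ∘ isPrimitive? n) ≡⟨ ∑L-wordsBelow n (χ ∘ isPrimitive? n) ⟩
    ∑ n (λ i → ∑L (words n (n ∸ suc i)) (χ ∘ isPrimitive? n)) ≡⟨ ∑-cong n (λ i → sym (H-primitive (n ∸ suc i))) ⟩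
    ∑ n (λ i → + n * H (downFrom n) (n ∸ suc i) (δ₁ n)) ≡⟨ ∑L-*ˡ (upTo n) (+ n) _ ⟩
    + n * ∑ n (λ i → H (downFrom n) (n ∸ suc i) (δ₁ n)) ≡⟨ cong (_*_ (+ n)) (sym (linearCoefficient≡H n t̃ red)) ⟩
    + n * linearCoefficientMod n t̃ ∎
    where open ≡-Reasoning

-- Labellings and their codes

rsum : (ℕ → ℕ) → ℕ → ℕ → ℕ
rsum c l zero    = 0
rsum c l (suc k) = c l ℕ.+ rsum c (suc l) k

psum≡rsum : ∀ c l k → psum (λ i → c (l ℕ.+ i)) k ≡ rsum c l k
psum≡rsum c l zero    = refl
psum≡rsum c l (suc k) = cong₂ ℕ._+_ (cong c (+-identityʳ l))
  (trans (psum-cong< k (λ i _ → cong c (+-suc l i))) (psum≡rsum c (suc l) k))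

rsum-+ : ∀ c l a b → rsum c l (a ℕ.+ b) ≡ rsum c l a ℕ.+ rsum c (l ℕ.+ a) b
rsum-+ c l zero    b = cong (λ l → rsum c l b) (sym (+-identityʳ l))
rsum-+ c l (suc a) b = trans (cong (ℕ._+_ (c l)) (trans (rsum-+ c (suc l) a b) (cong (λ m → rsum c (suc l) a ℕ.+ rsum c m b) (sym (+-suc l a)))))
  (sym (+-assoc (c l) _ _))

rsum-shift : ∀ {n c} → Periodic n c → ∀ l → rsum c l n ≡ rsum c 0 n
rsum-shift         p zero    = refl
rsum-shift {n} {c} p (suc l) = trans (+-cancelˡ-≡ (c l) _ _ (begin
  c l ℕ.+ rsum c (suc l) n ≡⟨⟩
  rsum c l (1 ℕ.+ n) ≡⟨ cong (rsum c l) (+-comm 1 n) ⟩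
  rsum c l (n ℕ.+ 1) ≡⟨ rsum-+ c l n 1 ⟩
  rsum c l n ℕ.+ (c (l ℕ.+ n) ℕ.+ 0) ≡⟨ cong (ℕ._+_ (rsum c l n)) (trans (+-identityʳ _) (p l)) ⟩
  rsum c l n ℕ.+ c l ≡⟨ +-comm _ (c l) ⟩
  c l ℕ.+ rsum c l n                ∎)) (rsum-shift p l)
  where open ≡-Reasoning

argmin : ∀ (f : ℕ → ℕ) n → 1 ℕ.≤ n → ∃ λ i → i ℕ.< n × (∀ j → j ℕ.< n → f i ℕ.≤ f j) × (∀ j → j ℕ.< i → f i ℕ.< f j)
argmin f (suc zero)    _ = 0 , s≤s z≤n , (λ { zero _ → ≤-refl ; (suc j) (s≤s ()) }) , λ _ ()
argmin f (suc (suc n)) _ with argmin f (suc n) (s≤s z≤n)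
... | i , i<n , min , first with f i ≤? f (suc n)
...   | yes fi≤ = i , m<n⇒m<1+n i<n , min′ , first
  where
  min′ : ∀ j → j ℕ.< suc (suc n) → f i ℕ.≤ f j
  min′ j (s≤s j≤n) with m≤n⇒m<n∨m≡n j≤n
  ... | inj₁ j<n  = min j j<n
  ... | inj₂ refl = fi≤
...   | no fi≰ = suc n , ≤-refl , min′ , λ j j<n → <-≤-trans (≰⇒> fi≰) (min j j<n)
  where
  min′ : ∀ j → j ℕ.< suc (suc n) → f (suc n) ℕ.≤ f j
  min′ j (s≤s j≤n) with m≤n⇒m<n∨m≡n j≤n
  ... | inj₁ j<n  = ≤-trans (<⇒≤ (≰⇒> fi≰)) (min j j<n)
  ... | inj₂ refl = ≤-refl

Positive : (ℕ → ℕ) → Set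
Positive u = ∀ i → 1 ℕ.≤ u i

Solves : (ℕ → ℕ) → (ℕ → ℕ) → Set
Solves q u = ∀ i → q i ℕ.* u (1 ℕ.+ i) ≡ u i ℕ.+ u (2 ℕ.+ i)

Divisible : (ℕ → ℕ) → Set
Divisible u = ∀ i → u (1 ℕ.+ i) ∣ u i ℕ.+ u (2 ℕ.+ i)

Solves⇒Divisible : ∀ {q u} → Solves q u → Divisible u
Solves⇒Divisible {q} s i = divides (q i) (sym (s i))

-- c i is the number of peripheral arcs that leave the vertex i of the
-- punctured disc to the right: it equals ⌈u (i + 1) / u i⌉ - 1.
IsCode : (ℕ → ℕ) → (ℕ → ℕ) → Set
IsCode u c = ∀ i → c i ℕ.* u i ℕ.< u (1 ℕ.+ i) × u (1 ℕ.+ i) ℕ.≤ suc (c i) ℕ.* u i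

multiple-below-double : ∀ {d s} → d ∣ s → 1 ℕ.≤ s → s ℕ.< d ℕ.+ d → s ≡ d
multiple-below-double {d} (divides zero          refl) 1≤s s<2d = contradiction 1≤s (λ ())
multiple-below-double {d} (divides (suc zero)    refl) 1≤s s<2d = +-identityʳ d
multiple-below-double {d} (divides (suc (suc k)) refl) 1≤s s<2d =
  contradiction s<2d (≤⇒≯ (≤-trans (m≤m+n (d ℕ.+ d) (k ℕ.* d)) (≤-reflexive (+-assoc d d (k ℕ.* d)))))

Link : ℕ → ℕ → List ℕ → Set
Link x v []      = ⊤
Link x v (w ∷ V) = v ∣ x ℕ.+ w

-- The labels of the vertices that are visible from the left: they decrease
-- weakly and satisfy the divisibility condition themselves.
Chain : ℕ → List ℕ → Set
Chain v []      = ⊤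
Chain v (w ∷ V) = w ℕ.≤ v × Link v w V × Chain w V

lastOf : ℕ → List ℕ → ℕ
lastOf v []      = v
lastOf v (w ∷ V) = lastOf w V

last≤head : ∀ v V → Chain v V → lastOf v V ℕ.≤ v
last≤head v []      _               = ≤-refl
last≤head v (w ∷ V) (w≤v , _ , ch) = ≤-trans (last≤head w V ch) w≤v

-- Once the vertex x + w is cut off, its right neighbour w has x as left neighbour; this changes the
-- sum of the neighbours of w by w only.
Link-+ : ∀ x w V → Link (x ℕ.+ w) w V → Link x w V
Link-+ x w []       _ = tt
Link-+ x w (w′ ∷ V) d = ∣m+n∣m⇒∣n (subst (w ∣_) (lemma x w w′) d) ∣-refl
  where
  lemma : ∀ x w w′ → x ℕ.+ w ℕ.+ w′ ≡ w ℕ.+ (x ℕ.+ w′)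
  lemma = ℕ-Solver.solve-∀

-- What remains of a chain once the first c of its vertices have been cut off
-- by arcs from a vertex with label x.
record Remainder (x v : ℕ) (V : List ℕ) (c : ℕ) : Set where
  field
    {next}   : ℕ
    {rest}   : List ℕ
    head≡    : v ≡ c ℕ.* x ℕ.+ next
    next≤x   : next ℕ.≤ x
    link     : Link x next rest
    chain    : Chain next rest
    length≡  : length V ≡ c ℕ.+ length rest
    last≡    : lastOf v V ≡ lastOf next rest

-- A head v > x is an ear: v divides x + w with w ≤ v, and x + w < 2v forces v = x + w. Cutting it
-- off by an arc from x lowers the head by x. So c cuts bring the head down to at most x, unless the
-- chain runs out before; then even its last label exceeds x.
cut : ∀ x v V c → 1 ℕ.≤ x → Chain v V → Link x v V → c ℕ.* x ℕ.< v → v ℕ.≤ suc c ℕ.* x →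
  Remainder x v V c ⊎ (length V ℕ.< c × x ℕ.< lastOf v V)
cut x v V zero 1≤x ch lk lo hi = inj₁ (record
  { head≡ = refl ; next≤x = subst (v ℕ.≤_) (+-identityʳ x) hi ; link = lk ; chain = ch ; length≡ = refl ; last≡ = refl })
cut x v [] (suc c) 1≤x ch lk lo hi = inj₂ (s≤s z≤n , ≤-<-trans (m≤m+n x (c ℕ.* x)) lo)
cut x v (w ∷ V) (suc c) 1≤x (w≤v , lk′ , ch) lk lo hi
  with refl ← multiple-below-double lk (≤-trans 1≤x (m≤m+n x w)) (+-mono-<-≤ (≤-<-trans (m≤m+n x (c ℕ.* x)) lo) w≤v)
  with cut x w V c 1≤x ch (Link-+ x w V lk′) (+-cancelˡ-< x _ _ lo) (+-cancelˡ-≤ x _ _ hi)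
... | inj₁ r = inj₁ (record
  { head≡ = trans (cong (ℕ._+_ x) head≡) (sym (+-assoc x (c ℕ.* x) next)) ; next≤x = next≤x ; link = link ; chain = chain
  ; length≡ = cong suc length≡ ; last≡ = last≡ })
  where open Remainder r
... | inj₂ (l , x<last) = inj₂ (s≤s l , x<last)

module _ {u c : ℕ → ℕ} (pos : Positive u) (div : Divisible u) (code : IsCode u c) (i : ℕ) where

  -- For l + k = i: each of the k vertices after l, up to i, is either still visible from l or cut
  -- off by exactly one of the arcs counted by `rsum c l k`. The field `link` names the predecessor
  -- of l by an equation because l may be 0.
  record Visible (l k : ℕ) : Set where
    field
      {visible} : List ℕ
      chain     : Chain (u l) visible
      last≡     : lastOf (u l) visible ≡ u i
      link      : ∀ l′ → suc l′ ≡ l → Link (u l′) (u l) visible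
      length≡   : length visible ℕ.+ rsum c l k ≡ k

  -- The last alternative is overflow: the vertex l sends out more arcs than there are vertices left
  -- to cut, which happens only if its label is below the label at i.
  extend : ∀ {l k} → Visible (suc l) k →
    Visible l (suc k) × rsum c l (suc k) ℕ.≤ k × (∃ λ w → u (suc l) ≡ c l ℕ.* u l ℕ.+ w × u i ℕ.≤ w × w ℕ.≤ u l) ⊎ (u l ℕ.< u i × suc k ℕ.≤ rsum c l (suc k))
  extend {l} {k} vis with cut (u l) (u (suc l)) (Visible.visible vis) (c l) (pos l) (Visible.chain vis) (Visible.link vis l refl) (proj₁ (code l)) (proj₂ (code l))
  ... | inj₂ (l<c , x<last) = inj₂ (subst (u l ℕ.<_) (Visible.last≡ vis) x<last ,
    ≤-trans (≤-reflexive (cong suc (sym (Visible.length≡ vis)))) (+-monoˡ-≤ (rsum c (suc l) k) l<c))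
  ... | inj₁ r = inj₁ (record
    { visible = next ∷ rest
    ; chain = next≤x , link , chain
    ; last≡ = trans (sym last≡) (Visible.last≡ vis)
    ; link = λ { l′ refl → ∣m+n∣m⇒∣n (subst (u l ∣_) (trans (cong (ℕ._+_ (u l′)) head≡) (lemma (u l′) (c l ℕ.* u l) next)) (div l′)) (n∣m*n (c l)) }
    ; length≡ = cong suc rest+rsum
    } , subst (rsum c l (suc k) ℕ.≤_) rest+rsum (m≤n+m _ (length rest))
    , next , head≡ , subst (ℕ._≤ next) (trans (sym last≡) (Visible.last≡ vis)) (last≤head next rest chain) , next≤x)
    where
    open Remainder r
    open ≡-Reasoning
    lemma : ∀ a b c → a ℕ.+ (b ℕ.+ c) ≡ b ℕ.+ (a ℕ.+ c)
    lemma = ℕ-Solver.solve-∀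
    rest+rsum : length rest ℕ.+ rsum c l (suc k) ≡ k
    rest+rsum = begin
      length rest ℕ.+ (c l ℕ.+ rsum c (suc l) k) ≡⟨ lemma (length rest) (c l) _ ⟩
      c l ℕ.+ (length rest ℕ.+ rsum c (suc l) k) ≡⟨ sym (+-assoc (c l) (length rest) _) ⟩
      c l ℕ.+ length rest ℕ.+ rsum c (suc l) k ≡⟨ cong (ℕ._+ rsum c (suc l) k) (sym length≡) ⟩
      length (Visible.visible vis) ℕ.+ rsum c (suc l) k ≡⟨ Visible.length≡ vis ⟩
      k ∎

  Dominates : ℕ → Set
  Dominates l = ∀ j → l ℕ.≤ j → j ℕ.< i → u i ℕ.≤ u j

  visibleFrom : ∀ k l → l ℕ.+ k ≡ i → Dominates l → Visible l k
  -- Overflow would give l a smaller label than i, which domination forbids.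
  leftmost : ∀ k l → l ℕ.+ suc k ≡ i → Dominates l →
    Visible l (suc k) × rsum c l (suc k) ℕ.≤ k × (∃ λ w → u (suc l) ≡ c l ℕ.* u l ℕ.+ w × u i ℕ.≤ w × w ℕ.≤ u l)

  visibleFrom zero l l+k≡i dom = record
    { chain = tt ; last≡ = cong u (trans (sym (+-identityʳ l)) l+k≡i) ; link = λ _ _ → tt ; length≡ = refl }
  visibleFrom (suc k) l l+k≡i dom = proj₁ (leftmost k l l+k≡i dom)

  leftmost k l l+k≡i dom with extend (visibleFrom k (suc l) (trans (sym (+-suc l k)) l+k≡i) (λ j l<j → dom j (<⇒≤ l<j)))
  ... | inj₁ result      = result
  ... | inj₂ (ul<ui , _) = contradiction (dom l ≤-refl (subst (l ℕ.<_) l+k≡i (m<m+n l (s≤s z≤n)))) (<⇒≱ ul<ui)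

  -- A position that carries fewer arcs than vertices on every interval to its
  -- left carries a minimal label.
  dominates? : ∀ k l → l ℕ.+ k ≡ i → (∃ λ l′ → ∃ λ k′ → l ℕ.≤ l′ × l′ ℕ.+ suc k′ ≡ i × suc k′ ℕ.≤ rsum c l′ (suc k′)) ⊎ Dominates l
  dominates? zero l l+k≡i = inj₂ (λ j l≤j j<i → contradiction (≤-trans (≤-reflexive (trans (sym l+k≡i) (+-identityʳ l))) l≤j) (<⇒≱ j<i))
  dominates? (suc k) l l+k≡i with dominates? k (suc l) (trans (sym (+-suc l k)) l+k≡i)
  ... | inj₁ (l′ , k′ , l<l′ , rest) = inj₁ (l′ , k′ , <⇒≤ l<l′ , rest)
  ... | inj₂ dom with extend (visibleFrom k (suc l) (trans (sym (+-suc l k)) l+k≡i) dom)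
  ...   | inj₂ (_ , full) = inj₁ (l , k , ≤-refl , l+k≡i , full)
  ...   | inj₁ (_ , _ , _ , _ , ui≤w , w≤ul) = inj₂ dom′
    where
    dom′ : Dominates l
    dom′ j l≤j j<i with m≤n⇒m<n∨m≡n l≤j
    ... | inj₁ l<j  = dom j l<j j<i
    ... | inj₂ refl = ≤-trans ui≤w w≤ul

IsMinimum : (ℕ → ℕ) → ℕ → Set
IsMinimum u i = ∀ j → u i ℕ.≤ u j

module _ {n : ℕ} .{{_ : NonZero n}} where

  1≤n : 1 ℕ.≤ n
  1≤n = ℕ.>-nonZero⁻¹ n

  -- The position is i + n rather than i because intervals are followed to the left, and a full
  -- period must fit there within ℕ.
  minimum-window : ∀ {u} → Periodic n u → ∀ i → (∀ j → i ℕ.≤ j → j ℕ.< i ℕ.+ n → u (i ℕ.+ n) ℕ.≤ u j) → i ℕ.< n → IsMinimum u (i ℕ.+ n)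
  minimum-window {u} per i window i<n j = subst (u (i ℕ.+ n) ℕ.≤_) (periodic-% n per j) (reduced (j % n) (m%n<n j n))
    where
    reduced : ∀ r → r ℕ.< n → u (i ℕ.+ n) ℕ.≤ u r
    reduced r r<n with i ≤? r
    ... | yes i≤r = window r i≤r (<-≤-trans r<n (m≤n+m n i))
    ... | no  i≰r = ≤-trans (window (r ℕ.+ n) (≤-trans (<⇒≤ i<n) (m≤n+m n r)) (+-monoˡ-< n (≰⇒> i≰r))) (≤-reflexive (per r))

  minimum : ∀ {u} → Periodic n u → ∃ λ i → i ℕ.< n × IsMinimum u (i ℕ.+ n)
  minimum {u} per with i , i<n , min , _ ← argmin u n 1≤n =
    i , i<n , λ j → ≤-trans (≤-reflexive (per i)) (subst (u i ℕ.≤_)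
      (periodic-% n per j) (min (j % n) (m%n<n j n)))

  -- `leftmost` is applied to a full period that ends at a minimal label.
  code-sum<n : ∀ {u c} → Positive u → Divisible u → IsCode u c → Periodic n u → Periodic n c → rsum c 0 n ℕ.< n
  code-sum<n {u} {c} pos div code u-per c-per with i , _ , min ← minimum u-per =
    subst (ℕ._< n) (rsum-shift c-per i) (below n refl 1≤n)
    where
    below : ∀ m → m ≡ n → 1 ℕ.≤ m → rsum c i m ℕ.< m
    below (suc m) refl _ = s≤s (proj₁ (proj₂ (leftmost pos div code (i ℕ.+ suc m) m i refl (λ j _ _ → min j))))

  -- The code alone decides where the minima are. By `leftmost` for u every interval ending at the
  -- minimum has fewer arcs than vertices, and by `dominates?` for u′ this makes the position
  -- minimal there too.
  minimum-transfer : ∀ {u u′ c} → Positive u → Divisible u → IsCode u c → Positive u′ → Divisible u′ → IsCode u′ c →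
    Periodic n u′ → ∀ i → i ℕ.< n → IsMinimum u (i ℕ.+ n) → IsMinimum u′ (i ℕ.+ n)
  minimum-transfer {c = c} pos div code pos′ div′ code′ per′ i i<n min with dominates? {c = c} pos′ div′ code′ (i ℕ.+ n) n i refl
  ... | inj₂ dom = minimum-window per′ i dom i<n
  ... | inj₁ (l , k , _ , l+k≡i , full) =
    contradiction full (<⇒≱ (s≤s (proj₁ (proj₂ (leftmost {c = c} pos div code (i ℕ.+ n) k l l+k≡i (λ j _ _ → min j))))))

-- A code determines its labelling up to scale

next-unique-≤ : ∀ {N s p q} c → N ∣ s ℕ.+ p → N ∣ s ℕ.+ q → c ℕ.* N ℕ.< p → q ℕ.≤ suc c ℕ.* N → p ℕ.≤ q → p ≡ q
next-unique-≤ {N} {s} {p} {q} c N∣p N∣q p> q≤ p≤q with q ∸ p in eq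
... | zero  = ≤-antisym p≤q (m∸n≡0⇒m≤n eq)
... | suc d = contradiction (≤-trans (s≤s q≤) (≤-trans (≤-reflexive (sym (+-suc N (c ℕ.* N)))) (≤-trans (+-mono-≤ (∣⇒≤ N∣d) p>) (≤-reflexive (+-comm (suc d) p)))))
    (<-irrefl (sym (trans (cong (ℕ._+_ p) (sym eq)) (m+[n∸m]≡n p≤q))))
  where
  N∣d : N ∣ suc d
  N∣d = ∣m+n∣m⇒∣n (subst (N ∣_) (trans (cong (ℕ._+_ s) (trans (sym (m+[n∸m]≡n p≤q)) (cong (ℕ._+_ p) eq))) (sym (+-assoc s p (suc d)))) N∣q) N∣p

-- The N numbers after c N represent each residue class modulo N once. Hence two consecutive labels
-- and the code determine the label that follows.
next-unique : ∀ {N s p q} c → N ∣ s ℕ.+ p → N ∣ s ℕ.+ q → c ℕ.* N ℕ.< p → p ℕ.≤ suc c ℕ.* N → c ℕ.* N ℕ.< q → q ℕ.≤ suc c ℕ.* N → p ≡ q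
next-unique {p = p} {q} c N∣p N∣q p> p≤ q> q≤ with ≤-total p q
... | inj₁ p≤q = next-unique-≤ c N∣p N∣q p> q≤ p≤q
... | inj₂ q≤p = sym (next-unique-≤ c N∣q N∣p q> p≤ q≤p)

module _ {n : ℕ} .{{_ : NonZero n}} {q u q′ u′ c : ℕ → ℕ}
  (pos : Positive u) (sol : Solves q u) (code : IsCode u c) (per : Periodic n u)
  (pos′ : Positive u′) (sol′ : Solves q′ u′) (code′ : IsCode u′ c) (per′ : Periodic n u′) where

  private
    div : Divisible u
    div = Solves⇒Divisible {q} {u} sol
    div′ : Divisible u′
    div′ = Solves⇒Divisible {q′} {u′} sol′

  -- Seen over a full period, the remainder w after the c i cuts lies between the labels at i + n
  -- and at i, which are equal.
  successor-of-minimum : ∀ {q u} → Positive u → Solves q u → IsCode u c → Periodic n u → ∀ i → IsMinimum u i → u (suc i) ≡ suc (c i) ℕ.* u i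
  successor-of-minimum {q} {u} pos sol code per i min
    with w , u≡ , ≤w , w≤ ← proj₂ (proj₂ (leftmost {u} {c} pos (Solves⇒Divisible {q} {u} sol) code (i ℕ.+ n) (n ∸ 1) i
           (cong (ℕ._+_ i) (trans (+-comm 1 (n ∸ 1)) (m∸n+n≡m (1≤n {n})))) (λ j _ _ → ≤-trans (≤-reflexive (per i)) (min j)))) =
    trans u≡ (trans (cong (ℕ._+_ (c i ℕ.* u i)) (≤-antisym w≤ (≤-trans (≤-reflexive (sym (per i))) ≤w))) (+-comm (c i ℕ.* u i) (u i)))

  module _ (i : ℕ) (min : IsMinimum u i) (min′ : IsMinimum u′ i) where

    private
      e e′ : ℕ
      e = u i
      e′ = u′ i

      e-nonZero : NonZero e
      e-nonZero = ℕ.>-nonZero (pos i)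
      e′-nonZero : NonZero e′
      e′-nonZero = ℕ.>-nonZero (pos′ i)

    -- Each labelling is multiplied by the minimal label of the other. The two then agree at i, by
    -- `successor-of-minimum` also at i + 1, and `next-unique` continues to the right.
    proportional : ∀ k → u (k ℕ.+ i) ℕ.* e′ ≡ u′ (k ℕ.+ i) ℕ.* e × u (suc k ℕ.+ i) ℕ.* e′ ≡ u′ (suc k ℕ.+ i) ℕ.* e
    proportional zero = *-comm e e′ , (begin
      u (suc i) ℕ.* e′ ≡⟨ cong (ℕ._* e′) (successor-of-minimum {q} {u} pos sol code per i min) ⟩
      suc (c i) ℕ.* e ℕ.* e′ ≡⟨ lemma (suc (c i)) e e′ ⟩
      suc (c i) ℕ.* e′ ℕ.* e ≡⟨ cong (ℕ._* e) (sym (successor-of-minimum {q′} {u′} pos′ sol′ code′ per′ i min′)) ⟩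
      u′ (suc i) ℕ.* e          ∎)
      where
      open ≡-Reasoning
      lemma : ∀ a b c → a ℕ.* b ℕ.* c ≡ a ℕ.* c ℕ.* b
      lemma = ℕ-Solver.solve-∀
    proportional (suc k) with proportional k
    ... | here≡ , next≡ = next≡ , next-unique (c (suc k ℕ.+ i))
        (scaled u div e′ (k ℕ.+ i))
        (subst₂ (λ N s → N ∣ s ℕ.+ u′ (2 ℕ.+ k ℕ.+ i) ℕ.* e) (sym next≡) (sym here≡) (scaled u′ div′ e (k ℕ.+ i)))
        (scaled-< {u (suc k ℕ.+ i)} {u (2 ℕ.+ k ℕ.+ i)} {c (suc k ℕ.+ i)} e′ {{e′-nonZero}} (proj₁ (code (suc k ℕ.+ i)))) (scaled-≤ {u (suc k ℕ.+ i)} {u (2 ℕ.+ k ℕ.+ i)} {suc (c (suc k ℕ.+ i))} e′ (proj₂ (code (suc k ℕ.+ i))))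
        (subst (λ N → c (suc k ℕ.+ i) ℕ.* N ℕ.< u′ (2 ℕ.+ k ℕ.+ i) ℕ.* e) (sym next≡) (scaled-< {u′ (suc k ℕ.+ i)} {u′ (2 ℕ.+ k ℕ.+ i)} {c (suc k ℕ.+ i)} e {{e-nonZero}} (proj₁ (code′ (suc k ℕ.+ i)))))
        (subst (λ N → u′ (2 ℕ.+ k ℕ.+ i) ℕ.* e ℕ.≤ suc (c (suc k ℕ.+ i)) ℕ.* N) (sym next≡) (scaled-≤ {u′ (suc k ℕ.+ i)} {u′ (2 ℕ.+ k ℕ.+ i)} {suc (c (suc k ℕ.+ i))} e (proj₂ (code′ (suc k ℕ.+ i)))))
      where
      scaled : ∀ u → Divisible u → ∀ d j → u (1 ℕ.+ j) ℕ.* d ∣ u j ℕ.* d ℕ.+ u (2 ℕ.+ j) ℕ.* d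
      scaled u div d j = subst (u (1 ℕ.+ j) ℕ.* d ∣_) (*-distribʳ-+ d (u j) (u (2 ℕ.+ j))) (*-monoˡ-∣ d (div j))
      scaled-< : ∀ {a b m} d .{{_ : NonZero d}} → m ℕ.* a ℕ.< b → m ℕ.* (a ℕ.* d) ℕ.< b ℕ.* d
      scaled-< {a} {b} {m} d lt = subst (ℕ._< b ℕ.* d) (*-assoc m a d) (*-monoˡ-< d lt)
      scaled-≤ : ∀ {a b m} d → b ℕ.≤ m ℕ.* a → b ℕ.* d ℕ.≤ m ℕ.* (a ℕ.* d)
      scaled-≤ {a} {b} {m} d le = subst (b ℕ.* d ℕ.≤_) (*-assoc m a d) (*-monoˡ-≤ d le)

    quiddity-from : ∀ k → q (k ℕ.+ i) ≡ q′ (k ℕ.+ i)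
    quiddity-from k = *-cancelʳ-≡ (q (k ℕ.+ i)) (q′ (k ℕ.+ i)) (u (suc k ℕ.+ i) ℕ.* e′) {{m*n≢0 (u (suc k ℕ.+ i)) e′ {{ℕ.>-nonZero (pos (suc k ℕ.+ i))}} {{e′-nonZero}}}} (begin
      q (k ℕ.+ i) ℕ.* (u (suc k ℕ.+ i) ℕ.* e′) ≡⟨ scale q u sol e′ ⟩
      u (k ℕ.+ i) ℕ.* e′ ℕ.+ u (2 ℕ.+ k ℕ.+ i) ℕ.* e′ ≡⟨ cong₂ ℕ._+_ (proj₁ (proportional k)) (proj₂ (proportional (suc k))) ⟩
      u′ (k ℕ.+ i) ℕ.* e ℕ.+ u′ (2 ℕ.+ k ℕ.+ i) ℕ.* e ≡⟨ sym (scale q′ u′ sol′ e) ⟩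
      q′ (k ℕ.+ i) ℕ.* (u′ (suc k ℕ.+ i) ℕ.* e) ≡⟨ cong (q′ (k ℕ.+ i) ℕ.*_) (sym (proj₂ (proportional k))) ⟩
      q′ (k ℕ.+ i) ℕ.* (u (suc k ℕ.+ i) ℕ.* e′)         ∎)
      where
      open ≡-Reasoning
      scale : ∀ q u → Solves q u → ∀ d → q (k ℕ.+ i) ℕ.* (u (suc k ℕ.+ i) ℕ.* d) ≡ u (k ℕ.+ i) ℕ.* d ℕ.+ u (2 ℕ.+ k ℕ.+ i) ℕ.* d
      scale q u sol d = trans (sym (*-assoc (q (k ℕ.+ i)) _ d)) (trans (cong (ℕ._* d) (sol (k ℕ.+ i))) (*-distribʳ-+ d (u (k ℕ.+ i)) _))

  code-determines-quiddity : Periodic n q → Periodic n q′ → ∀ j → q j ≡ q′ j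
  code-determines-quiddity q-per q′-per j with i , i<n , min ← minimum {n} per = begin
    q j ≡⟨ sym (Periodic-* q-per (i ℕ.+ n) j) ⟩
    q (j ℕ.+ (i ℕ.+ n) ℕ.* n) ≡⟨ cong q index ⟩
    q (j ℕ.+ (i ℕ.+ n) ℕ.* (n ∸ 1) ℕ.+ (i ℕ.+ n)) ≡⟨ quiddity-from (i ℕ.+ n) min (minimum-transfer {c = c} pos div code pos′ div′ code′ per′ i i<n min) (j ℕ.+ (i ℕ.+ n) ℕ.* (n ∸ 1)) ⟩
    q′ (j ℕ.+ (i ℕ.+ n) ℕ.* (n ∸ 1) ℕ.+ (i ℕ.+ n)) ≡⟨ cong q′ (sym index) ⟩
    q′ (j ℕ.+ (i ℕ.+ n) ℕ.* n) ≡⟨ Periodic-* q′-per (i ℕ.+ n) j ⟩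
    q′ j ∎
    where
    open ≡-Reasoning
    -- `quiddity-from` reaches only positions from i + n onwards, so j is first moved by i + n
    -- periods.
    index : j ℕ.+ (i ℕ.+ n) ℕ.* n ≡ j ℕ.+ (i ℕ.+ n) ℕ.* (n ∸ 1) ℕ.+ (i ℕ.+ n)
    index = trans (cong (ℕ._+_ j) (trans (cong ((i ℕ.+ n) ℕ.*_) (sym (m∸n+n≡m (1≤n {n})))) (trans (*-distribˡ-+ (i ℕ.+ n) (n ∸ 1) 1) (cong (ℕ._+_ ((i ℕ.+ n) ℕ.* (n ∸ 1))) (*-identityʳ (i ℕ.+ n))))))
      (sym (+-assoc j _ (i ℕ.+ n)))

-- A quiddity determines its code

wronskian : ∀ q u u′ {w} → Solves q u → Solves q u′ → u 0 ℕ.* u′ 1 ≡ u 1 ℕ.* u′ 0 ℕ.+ w → ∀ j → u j ℕ.* u′ (suc j) ≡ u (suc j) ℕ.* u′ j ℕ.+ w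
wronskian q u u′ sol sol′ e zero = e
wronskian q u u′ {w} sol sol′ e (suc j) = +-cancelʳ-≡ (u (suc j) ℕ.* u′ j) _ _ (begin
  u (1 ℕ.+ j) ℕ.* u′ (2 ℕ.+ j) ℕ.+ u (1 ℕ.+ j) ℕ.* u′ j ≡⟨ lemma₁ (u (1 ℕ.+ j)) (u′ (2 ℕ.+ j)) (u′ j) ⟩
  u (1 ℕ.+ j) ℕ.* (u′ j ℕ.+ u′ (2 ℕ.+ j)) ≡⟨ cong (u (1 ℕ.+ j) ℕ.*_) (sym (sol′ j)) ⟩
  u (1 ℕ.+ j) ℕ.* (q j ℕ.* u′ (1 ℕ.+ j)) ≡⟨ lemma₂ (u (1 ℕ.+ j)) (q j) (u′ (1 ℕ.+ j)) ⟩
  q j ℕ.* u (1 ℕ.+ j) ℕ.* u′ (1 ℕ.+ j) ≡⟨ cong (ℕ._* u′ (1 ℕ.+ j)) (sol j) ⟩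
  (u j ℕ.+ u (2 ℕ.+ j)) ℕ.* u′ (1 ℕ.+ j) ≡⟨ lemma₃ (u j) (u (2 ℕ.+ j)) (u′ (1 ℕ.+ j)) ⟩
  u (2 ℕ.+ j) ℕ.* u′ (1 ℕ.+ j) ℕ.+ u j ℕ.* u′ (1 ℕ.+ j) ≡⟨ cong (ℕ._+_ (u (2 ℕ.+ j) ℕ.* u′ (1 ℕ.+ j))) (wronskian q u u′ sol sol′ e j) ⟩
  u (2 ℕ.+ j) ℕ.* u′ (1 ℕ.+ j) ℕ.+ (u (1 ℕ.+ j) ℕ.* u′ j ℕ.+ w) ≡⟨ lemma₄ (u (2 ℕ.+ j) ℕ.* u′ (1 ℕ.+ j)) (u (1 ℕ.+ j) ℕ.* u′ j) w ⟩
  u (2 ℕ.+ j) ℕ.* u′ (1 ℕ.+ j) ℕ.+ w ℕ.+ u (1 ℕ.+ j) ℕ.* u′ j               ∎)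
  where
  open ≡-Reasoning
  lemma₁ : ∀ a b c → a ℕ.* b ℕ.+ a ℕ.* c ≡ a ℕ.* (c ℕ.+ b)
  lemma₁ = ℕ-Solver.solve-∀
  lemma₂ : ∀ a b c → a ℕ.* (b ℕ.* c) ≡ b ℕ.* a ℕ.* c
  lemma₂ = ℕ-Solver.solve-∀
  lemma₃ : ∀ a b c → (a ℕ.+ b) ℕ.* c ≡ b ℕ.* c ℕ.+ a ℕ.* c
  lemma₃ = ℕ-Solver.solve-∀
  lemma₄ : ∀ a b c → a ℕ.+ (b ℕ.+ c) ≡ a ℕ.+ c ℕ.+ b
  lemma₄ = ℕ-Solver.solve-∀

-- A positive Wronskian makes the ratio u′ / u strictly increasing.
no-positive-wronskian : ∀ {n} .{{_ : NonZero n}} q u u′ → Positive u → Solves q u → Periodic n u → Solves q u′ → Periodic n u′ →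
  ¬ (u 1 ℕ.* u′ 0 ℕ.< u 0 ℕ.* u′ 1)
no-positive-wronskian {suc n} q u u′ pos sol per sol′ per′ lt =
  <-irrefl (sym (trans (cong (u 0 ℕ.*_) (per′ 0)) (trans (*-comm (u 0) (u′ 0)) (trans (*-comm (u′ 0) (u 0)) (cong (ℕ._* u′ 0) (sym (per 0))))))) (increasing n)
  where
  w : ℕ
  w = u 0 ℕ.* u′ 1 ∸ u 1 ℕ.* u′ 0
  local : ∀ j → u (suc j) ℕ.* u′ j ℕ.< u j ℕ.* u′ (suc j)
  local j = subst (u (suc j) ℕ.* u′ j ℕ.<_) (sym (wronskian q u u′ {w} sol sol′ (sym (m+[n∸m]≡n (<⇒≤ lt))) j)) (m<m+n _ (m<n⇒0<n∸m lt))
  increasing : ∀ k → u (suc k) ℕ.* u′ 0 ℕ.< u 0 ℕ.* u′ (suc k)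
  increasing zero    = lt
  increasing (suc k) = *-cancelˡ-< (u (suc k)) _ _ (begin-strict
    u (suc k) ℕ.* (u (2 ℕ.+ k) ℕ.* u′ 0) ≡⟨ lemma (u (suc k)) (u (2 ℕ.+ k)) (u′ 0) ⟩
    u (2 ℕ.+ k) ℕ.* (u (suc k) ℕ.* u′ 0) ≤⟨ *-monoʳ-≤ (u (2 ℕ.+ k)) (<⇒≤ (increasing k)) ⟩
    u (2 ℕ.+ k) ℕ.* (u 0 ℕ.* u′ (suc k)) ≡⟨ lemma (u (2 ℕ.+ k)) (u 0) (u′ (suc k)) ⟩
    u 0 ℕ.* (u (2 ℕ.+ k) ℕ.* u′ (suc k)) <⟨ *-monoʳ-< (u 0) {{ℕ.>-nonZero (pos 0)}} (local (suc k)) ⟩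
    u 0 ℕ.* (u (suc k) ℕ.* u′ (2 ℕ.+ k)) ≡⟨ lemma (u 0) (u (suc k)) (u′ (2 ℕ.+ k)) ⟩
    u (suc k) ℕ.* (u 0 ℕ.* u′ (2 ℕ.+ k))     ∎)
    where
    open ≤-Reasoning
    lemma : ∀ a b c → a ℕ.* (b ℕ.* c) ≡ b ℕ.* (a ℕ.* c)
    lemma = ℕ-Solver.solve-∀

-- Neither sign of the Wronskian is compatible with periodicity, so it vanishes and the two
-- solutions are proportional.
cross-ratio : ∀ {n} .{{_ : NonZero n}} q u u′ → Positive u → Solves q u → Periodic n u → Positive u′ → Solves q u′ → Periodic n u′ →
  ∀ j → u j ℕ.* u′ (suc j) ≡ u (suc j) ℕ.* u′ j
cross-ratio q u u′ pos sol per pos′ sol′ per′ j with <-cmp (u 1 ℕ.* u′ 0) (u 0 ℕ.* u′ 1)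
... | tri< lt _ _ = contradiction lt (no-positive-wronskian q u u′ pos sol per sol′ per′)
... | tri≈ _ eq _ = trans (wronskian q u u′ {0} sol sol′ (trans (sym eq) (sym (+-identityʳ _))) j) (+-identityʳ _)
... | tri> _ _ gt = contradiction (subst₂ ℕ._<_ (*-comm (u 0) (u′ 1)) (*-comm (u 1) (u′ 0)) gt) (no-positive-wronskian q u′ u pos′ sol′ per′ sol per)

quotient-unique-≤ : ∀ {a b c c′} → c ℕ.* a ℕ.< b → b ℕ.≤ suc c′ ℕ.* a → c ℕ.≤ c′
quotient-unique-≤ {a} {b} {c} {c′} lt le = ≤-pred (*-cancelʳ-< a c (suc c′) (<-≤-trans lt le))

quotient-unique : ∀ {a b c c′} → c ℕ.* a ℕ.< b → b ℕ.≤ suc c ℕ.* a → c′ ℕ.* a ℕ.< b → b ℕ.≤ suc c′ ℕ.* a → c ≡ c′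
quotient-unique lt le lt′ le′ = ≤-antisym (quotient-unique-≤ lt le′) (quotient-unique-≤ lt′ le)

quiddity-determines-code : ∀ {n} .{{_ : NonZero n}} {q u u′ c c′} → Positive u → Solves q u → Periodic n u → IsCode u c →
  Positive u′ → Solves q u′ → Periodic n u′ → IsCode u′ c′ → ∀ j → c j ≡ c′ j
quiddity-determines-code {q = q} {u} {u′} {c} {c′} pos sol per code pos′ sol′ per′ code′ j =
  quotient-unique lt le (proj₁ (code′ j)) (proj₂ (code′ j))
  where
  open ≤-Reasoning
  lemma : ∀ c a b → a ℕ.* (c ℕ.* b) ≡ c ℕ.* a ℕ.* b
  lemma = ℕ-Solver.solve-∀
  cross : u j ℕ.* u′ (suc j) ≡ u (suc j) ℕ.* u′ j
  cross = cross-ratio q u u′ pos sol per pos′ sol′ per′ j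
  lt : c j ℕ.* u′ j ℕ.< u′ (suc j)
  lt = *-cancelˡ-< (u j) _ _ (begin-strict
    u j ℕ.* (c j ℕ.* u′ j) ≡⟨ lemma (c j) (u j) (u′ j) ⟩
    c j ℕ.* u j ℕ.* u′ j <⟨ *-monoˡ-< (u′ j) {{ℕ.>-nonZero (pos′ j)}} (proj₁ (code j)) ⟩
    u (suc j) ℕ.* u′ j ≡⟨ sym cross ⟩
    u j ℕ.* u′ (suc j)        ∎)
  le : u′ (suc j) ℕ.≤ suc (c j) ℕ.* u′ j
  le = *-cancelˡ-≤ (u j) {{ℕ.>-nonZero (pos j)}} (begin
    u j ℕ.* u′ (suc j) ≡⟨ cross ⟩
    u (suc j) ℕ.* u′ j ≤⟨ *-monoˡ-≤ (u′ j) (proj₂ (code j)) ⟩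
    suc (c j) ℕ.* u j ℕ.* u′ j ≡⟨ sym (lemma (suc (c j)) (u j) (u′ j)) ⟩
    u j ℕ.* (suc (c j) ℕ.* u′ j) ∎)

-- ⌈b / a⌉ - 1 for positive a and b.
arcs : ℕ → ℕ → ℕ
arcs zero      b = 0
arcs a@(suc _) b = (b ∸ 1) / a

arcs-bounds : ∀ {a b} → 1 ℕ.≤ a → 1 ℕ.≤ b → arcs a b ℕ.* a ℕ.< b × b ℕ.≤ suc (arcs a b) ℕ.* a
arcs-bounds {a@(suc _)} {suc b} _ _ = s≤s (≤-trans (m≤n+m _ (b % a)) (≤-reflexive (sym b≡))) , (begin
    suc b ≡⟨ cong suc b≡ ⟩
    suc (b % a) ℕ.+ b / a ℕ.* a ≤⟨ +-monoˡ-≤ (b / a ℕ.* a) (m%n<n b a) ⟩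
    suc (b / a) ℕ.* a          ∎)
  where
  open ≤-Reasoning
  b≡ : b ≡ b % a ℕ.+ b / a ℕ.* a
  b≡ = m≡m%n+[m/n]*n b a

codeOf : (ℕ → ℕ) → ℕ → ℕ
codeOf u i = arcs (u i) (u (suc i))

codeOf-isCode : ∀ {u} → Positive u → IsCode u (codeOf u)
codeOf-isCode pos i = arcs-bounds (pos i) (pos (suc i))

codeOf-periodic : ∀ {n u} → Periodic n u → Periodic n (codeOf u)
codeOf-periodic per i = cong₂ arcs (per i) (per (suc i))

-- A labelling with a prescribed code

-- Stacks of labels, on top of infinitely many labels 1.
head₁ : List ℕ → ℕ
head₁ []      = 1
head₁ (v ∷ s) = v

Decreasing : List ℕ → Set
Decreasing []      = ⊤
Decreasing (v ∷ s) = head₁ s ℕ.≤ v × Decreasing s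

Linked : ℕ → List ℕ → Set
Linked x []      = ⊤
Linked x (v ∷ s) = v ∣ x ℕ.+ head₁ s × Linked v s

-- Undoes the cutting of k arcs that leave a vertex with label x.
grow : ℕ → ℕ → List ℕ → List ℕ
grow x zero    s = s
grow x (suc k) s = (x ℕ.+ head₁ (grow x k s)) ∷ grow x k s

head-grow : ∀ x k s → head₁ (grow x k s) ≡ k ℕ.* x ℕ.+ head₁ s
head-grow x zero    s = refl
head-grow x (suc k) s = trans (cong (ℕ._+_ x) (head-grow x k s)) (sym (+-assoc x (k ℕ.* x) _))

length-grow : ∀ x k s → length (grow x k s) ≡ k ℕ.+ length s
length-grow x zero    s = refl
length-grow x (suc k) s = cong suc (length-grow x k s)

Decreasing-grow : ∀ x k s → Decreasing s → Decreasing (grow x k s)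
Decreasing-grow x zero    s d = d
Decreasing-grow x (suc k) s d = m≤n+m _ x , Decreasing-grow x k s d

Linked-raise : ∀ x s → Linked x s → Linked (x ℕ.+ head₁ s) s
Linked-raise x []      _       = tt
Linked-raise x (w ∷ s) (d , l) = subst (w ∣_) (lemma x w (head₁ s)) (∣m∣n⇒∣m+n ∣-refl d) , l
  where
  lemma : ∀ x w h → w ℕ.+ (x ℕ.+ h) ≡ x ℕ.+ w ℕ.+ h
  lemma = ℕ-Solver.solve-∀

Linked-grow : ∀ x k s → Linked x s → Linked x (grow x k s)
Linked-grow x zero    s l = l
Linked-grow x (suc k) s l = ∣-refl , Linked-raise x (grow x k s) (Linked-grow x k s l)

1≤head : ∀ s → Decreasing s → 1 ℕ.≤ head₁ s
1≤head []      _       = ≤-refl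
1≤head (v ∷ s) (h , d) = ≤-trans (1≤head s d) h

head-drop≤head : ∀ s → Decreasing s → head₁ (drop 1 s) ℕ.≤ head₁ s
head-drop≤head []      _       = ≤-refl
head-drop≤head (v ∷ s) (h , _) = h

Decreasing-drop : ∀ s → Decreasing s → Decreasing (drop 1 s)
Decreasing-drop []      _       = tt
Decreasing-drop (v ∷ s) (_ , d) = d

Linked-drop : ∀ x s → Linked x s → Linked (head₁ s) (drop 1 s)
Linked-drop x []      _       = tt
Linked-drop x (v ∷ s) (_ , l) = l

head∣ : ∀ x s → Linked x s → head₁ s ∣ x ℕ.+ head₁ (drop 1 s)
head∣ x []      _       = 1∣ _
head∣ x (v ∷ s) (d , _) = d

length-drop₁ : ∀ (s : List ℕ) → length (drop 1 s) ≡ length s ∸ 1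
length-drop₁ []      = refl
length-drop₁ (v ∷ s) = refl

record Labelling (n : ℕ) (c : ℕ → ℕ) : Set where
  field
    label     : ℕ → ℕ
    positive  : Positive label
    divisible : Divisible label
    isCode    : IsCode label c
    periodic  : Periodic n label

module _ (c : ℕ → ℕ) where

  -- The cutting of chains run backwards. The top is the label at i, and below it lies what i sees
  -- after its cuts; pushing c i labels undoes those cuts and yields the label at i + 1. The floor
  -- of labels 1 stands for the minima.
  state : ℕ → List ℕ
  state zero    = []
  state (suc i) = grow (head₁ (state i)) (c i) (drop 1 (state i))

  state-invariant : ∀ i → Decreasing (state i) × Linked (head₁ (state i)) (drop 1 (state i))
  state-invariant zero    = tt , tt
  state-invariant (suc i) with d , l ← state-invariant i =
    Decreasing-grow (head₁ (state i)) (c i) _ (Decreasing-drop (state i) d) ,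
    Linked-drop _ (state (suc i)) (Linked-grow (head₁ (state i)) (c i) _ l)

  -- The height obeys h ↦ c i + max(h - 1, 0). Traced back to the last empty stack, at l, it is the
  -- number of arcs minus the number of vertices since then, plus 1 because the pop from the empty
  -- stack removes nothing.
  state-height : ∀ i → length (state i) ≡ 0 ⊎ (∃ λ l → ∃ λ k → l ℕ.+ suc k ≡ i × length (state i) ℕ.+ suc k ≡ suc (rsum c l (suc k)))
  state-height zero    = inj₁ refl
  state-height (suc i) = raise (length (state i)) refl (state-height i)
    where
    open ≡-Reasoning
    height : length (state (suc i)) ≡ c i ℕ.+ (length (state i) ∸ 1)
    height = trans (length-grow (head₁ (state i)) (c i) _) (cong (ℕ._+_ (c i)) (length-drop₁ (state i)))
    raise : ∀ h → length (state i) ≡ h → length (state i) ≡ 0 ⊎ (∃ λ l → ∃ λ k → l ℕ.+ suc k ≡ i × length (state i) ℕ.+ suc k ≡ suc (rsum c l (suc k))) →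
      length (state (suc i)) ≡ 0 ⊎ (∃ λ l → ∃ λ k → l ℕ.+ suc k ≡ suc i × length (state (suc i)) ℕ.+ suc k ≡ suc (rsum c l (suc k)))
    raise zero    h≡ _ = inj₂ (i , 0 , +-comm i 1 , trans (cong (ℕ._+ 1) (trans height (cong (λ h → c i ℕ.+ (h ∸ 1)) h≡))) (+-comm (c i ℕ.+ 0) 1))
    raise (suc h) h≡ (inj₁ e) = contradiction (trans (sym h≡) e) (λ ())
    raise (suc h) h≡ (inj₂ (l , k , refl , e)) = inj₂ (l , suc k , +-suc l (suc k) , (begin
      length (state (suc i)) ℕ.+ suc (suc k) ≡⟨ cong (ℕ._+ suc (suc k)) (trans height (cong (λ h → c i ℕ.+ (h ∸ 1)) h≡)) ⟩
      c i ℕ.+ h ℕ.+ suc (suc k) ≡⟨ lemma (c i) h k ⟩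
      suc h ℕ.+ suc k ℕ.+ c i ≡⟨ cong (ℕ._+ c i) (trans (cong (ℕ._+ suc k) (sym h≡)) e) ⟩
      suc (rsum c l (suc k) ℕ.+ c i) ≡⟨ cong (λ z → suc (rsum c l (suc k) ℕ.+ z)) (sym (+-identityʳ (c i))) ⟩
      suc (rsum c l (suc k) ℕ.+ rsum c (l ℕ.+ suc k) 1) ≡⟨ cong suc (sym (rsum-+ c l (suc k) 1)) ⟩
      suc (rsum c l (suc k ℕ.+ 1)) ≡⟨ cong (λ m → suc (rsum c l m)) (+-comm (suc k) 1) ⟩
      suc (rsum c l (suc (suc k)))              ∎))
      where
      lemma : ∀ a h k → a ℕ.+ h ℕ.+ suc (suc k) ≡ suc h ℕ.+ suc k ℕ.+ a
      lemma = ℕ-Solver.solve-∀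

  state-empty : ∀ n → (∀ l k → l ℕ.+ suc k ≡ n → rsum c l (suc k) ℕ.< suc k) → state n ≡ []
  state-empty n short with state n | state-height n
  ... | []    | _ = refl
  ... | v ∷ s | inj₂ (l , k , l+k≡n , e) =
    contradiction (short l k l+k≡n) (≤⇒≯ (≤-trans (m≤n+m (suc k) (length s)) (≤-reflexive (suc-injective e))))

  state-periodic : ∀ {n} → Periodic n c → state n ≡ [] → Periodic n state
  state-periodic per empty zero    = empty
  state-periodic per empty (suc i) rewrite state-periodic per empty i | per i = refl

  label-state : ∀ i → head₁ (state (suc i)) ≡ c i ℕ.* head₁ (state i) ℕ.+ head₁ (drop 1 (state i))
  label-state i = head-grow (head₁ (state i)) (c i) (drop 1 (state i))

  -- Short intervals before n leave nothing on the stack at n, so the process returns to its initial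
  -- state after one period.
  stack-labelling : ∀ {n} → Periodic n c → (∀ l k → l ℕ.+ suc k ≡ n → rsum c l (suc k) ℕ.< suc k) → Labelling n c
  stack-labelling {n} per short = record
    { label     = u
    ; positive  = λ i → 1≤head (state i) (proj₁ (state-invariant i))
    ; divisible = λ i → subst (u (1 ℕ.+ i) ∣_) (trans (lemma (c (suc i) ℕ.* u (suc i)) (u i) _) (cong (ℕ._+_ (u i)) (sym (label-state (suc i)))))
        (∣m∣n⇒∣m+n (n∣m*n (c (suc i))) (head∣ (u i) (state (suc i)) (Linked-grow (u i) (c i) _ (proj₂ (state-invariant i)))))
    ; isCode    = λ i →
        subst (c i ℕ.* u i ℕ.<_) (sym (label-state i)) (m<m+n (c i ℕ.* u i) (1≤head _ (Decreasing-drop (state i) (proj₁ (state-invariant i))))) ,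
        subst (ℕ._≤ suc (c i) ℕ.* u i) (sym (label-state i)) (≤-trans (+-monoʳ-≤ (c i ℕ.* u i) (head-drop≤head (state i) (proj₁ (state-invariant i)))) (≤-reflexive (+-comm (c i ℕ.* u i) (u i))))
    ; periodic  = λ i → cong head₁ (state-periodic per (state-empty n short) i)
    }
    where
    u : ℕ → ℕ
    u i = head₁ (state i)
    lemma : ∀ a b h → a ℕ.+ (b ℕ.+ h) ≡ b ℕ.+ (a ℕ.+ h)
    lemma = ℕ-Solver.solve-∀

Labelling-shift : ∀ {n c c′} s → Periodic n c → (∀ i → c (i ℕ.+ s) ≡ c′ i) → Labelling n c → Labelling n c′
Labelling-shift {n} {c} {c′} s per e L = record
  { label     = λ i → label (i ℕ.+ s)
  ; positive  = λ i → positive (i ℕ.+ s)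
  ; divisible = λ i → divisible (i ℕ.+ s)
  ; isCode    = λ i → subst (λ a → a ℕ.* label (i ℕ.+ s) ℕ.< label (suc i ℕ.+ s) × label (suc i ℕ.+ s) ℕ.≤ suc a ℕ.* label (i ℕ.+ s)) (e i) (isCode (i ℕ.+ s))
  ; periodic  = shift-periodic s periodic
  }
  where
  open Labelling L

rsum-shiftˡ : ∀ c s l k → rsum (λ i → c (i ℕ.+ s)) l k ≡ rsum c (l ℕ.+ s) k
rsum-shiftˡ c s l zero    = refl
rsum-shiftˡ c s l (suc k) = cong (ℕ._+_ (c (l ℕ.+ s))) (rsum-shiftˡ c s (suc l) k)

rsum-shift-n : ∀ {n c} → Periodic n c → ∀ l k → rsum c (l ℕ.+ n) k ≡ rsum c l k
rsum-shift-n per l zero    = refl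
rsum-shift-n per l (suc k) = cong₂ ℕ._+_ (per l) (rsum-shift-n per (suc l) k)

-- The starting point i₀ of the cycle lemma: every interval that ends at i₀
-- carries fewer arcs than vertices.
cycle-lemma : ∀ {n} .{{_ : NonZero n}} {c} → Periodic n c → rsum c 0 n ℕ.< n →
  ∃ λ i₀ → i₀ ℕ.< n × (∀ l k → l ℕ.+ suc k ≡ n → rsum (λ i → c (i ℕ.+ i₀)) l (suc k) ℕ.< suc k)
-- Adding n - k instead of subtracting k minimises R k - k within ℕ. The first minimum is taken,
-- which makes the inequality strict for earlier positions.
cycle-lemma {n} {c} per T<n with argmin (λ k → R k ℕ.+ (n ∸ k)) n (ℕ.>-nonZero⁻¹ n)
  where
  R : ℕ → ℕ
  R = rsum c 0
... | i₀ , i₀<n , min , first = i₀ , i₀<n , short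
  where
  R : ℕ → ℕ
  R = rsum c 0
  exchange : ∀ i j → i ℕ.≤ n → j ℕ.≤ n → R i ℕ.+ (n ∸ i) ℕ.+ (i ℕ.+ j) ≡ R i ℕ.+ j ℕ.+ n
  exchange i j i≤n j≤n = trans (lemma (R i) (n ∸ i) i j) (cong (ℕ._+_ (R i ℕ.+ j)) (m∸n+n≡m i≤n))
    where
    lemma : ∀ r d i j → r ℕ.+ d ℕ.+ (i ℕ.+ j) ≡ r ℕ.+ j ℕ.+ (d ℕ.+ i)
    lemma = ℕ-Solver.solve-∀
  weak : ∀ j → j ℕ.< n → R i₀ ℕ.+ j ℕ.≤ R j ℕ.+ i₀
  weak j j<n = +-cancelʳ-≤ n _ _ (subst₂ ℕ._≤_ (exchange i₀ j (<⇒≤ i₀<n) (<⇒≤ j<n))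
    (trans (cong (ℕ._+_ (R j ℕ.+ (n ∸ j))) (+-comm i₀ j)) (exchange j i₀ (<⇒≤ j<n) (<⇒≤ i₀<n))) (+-monoˡ-≤ (i₀ ℕ.+ j) (min j j<n)))
  strong : ∀ j → j ℕ.< i₀ → R i₀ ℕ.+ j ℕ.< R j ℕ.+ i₀
  strong j j<i₀ = +-cancelʳ-< n _ _ (subst₂ ℕ._<_ (exchange i₀ j (<⇒≤ i₀<n) j≤n)
    (trans (cong (ℕ._+_ (R j ℕ.+ (n ∸ j))) (+-comm i₀ j)) (exchange j i₀ j≤n (<⇒≤ i₀<n))) (+-monoˡ-< (i₀ ℕ.+ j) (first j j<i₀)))
    where
    j≤n : j ℕ.≤ n
    j≤n = <⇒≤ (<-trans j<i₀ i₀<n)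
  R-shift : ∀ j → R (n ℕ.+ j) ≡ R n ℕ.+ R j
  R-shift j = trans (rsum-+ c 0 n j) (cong (ℕ._+_ (R n)) (rsum-shift-n per 0 j))
  record-at-i₀ : ∀ j → j ℕ.< n ℕ.+ i₀ → R (n ℕ.+ i₀) ℕ.+ j ℕ.< R j ℕ.+ (n ℕ.+ i₀)
  record-at-i₀ j j<n+i₀ with j <? n
  ... | yes j<n = begin-strict
    R (n ℕ.+ i₀) ℕ.+ j ≡⟨ trans (cong (ℕ._+ j) (R-shift i₀)) (+-assoc (R n) (R i₀) j) ⟩
    R n ℕ.+ (R i₀ ℕ.+ j) <⟨ +-mono-<-≤ T<n (weak j j<n) ⟩
    n ℕ.+ (R j ℕ.+ i₀) ≡⟨ lemma n (R j) i₀ ⟩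
    R j ℕ.+ (n ℕ.+ i₀) ∎
    where
    open ≤-Reasoning
    lemma : ∀ a b c → a ℕ.+ (b ℕ.+ c) ≡ b ℕ.+ (a ℕ.+ c)
    lemma = ℕ-Solver.solve-∀
  ... | no j≮n = begin-strict
    R (n ℕ.+ i₀) ℕ.+ j ≡⟨ cong₂ ℕ._+_ (R-shift i₀) (sym j≡) ⟩
    R n ℕ.+ R i₀ ℕ.+ (n ℕ.+ j′) ≡⟨ lemma (R n) (R i₀) n j′ ⟩
    R n ℕ.+ n ℕ.+ (R i₀ ℕ.+ j′) <⟨ +-monoʳ-< (R n ℕ.+ n) (strong j′ (+-cancelˡ-< n _ _ (subst (ℕ._< n ℕ.+ i₀) (sym j≡) j<n+i₀))) ⟩
    R n ℕ.+ n ℕ.+ (R j′ ℕ.+ i₀) ≡⟨ lemma (R n) n (R j′) i₀ ⟩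
    R n ℕ.+ R j′ ℕ.+ (n ℕ.+ i₀) ≡⟨ cong (ℕ._+ (n ℕ.+ i₀)) (trans (sym (R-shift j′)) (cong R j≡)) ⟩
    R j ℕ.+ (n ℕ.+ i₀) ∎
    where
    open ≤-Reasoning
    j′ : ℕ
    j′ = j ∸ n
    j≡ : n ℕ.+ j′ ≡ j
    j≡ = m+[n∸m]≡n (≮⇒≥ j≮n)
    lemma : ∀ a b c d → a ℕ.+ b ℕ.+ (c ℕ.+ d) ≡ a ℕ.+ c ℕ.+ (b ℕ.+ d)
    lemma = ℕ-Solver.solve-∀
  short : ∀ l k → l ℕ.+ suc k ≡ n → rsum (λ i → c (i ℕ.+ i₀)) l (suc k) ℕ.< suc k
  short l k l+k≡n = subst (ℕ._< suc k) (sym (rsum-shiftˡ c i₀ l (suc k))) (+-cancelˡ-< (R (l ℕ.+ i₀) ℕ.+ (l ℕ.+ i₀)) _ _ (begin-strict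
    R (l ℕ.+ i₀) ℕ.+ (l ℕ.+ i₀) ℕ.+ rsum c (l ℕ.+ i₀) (suc k) ≡⟨ lemma (R (l ℕ.+ i₀)) (l ℕ.+ i₀) _ ⟩
    R (l ℕ.+ i₀) ℕ.+ rsum c (l ℕ.+ i₀) (suc k) ℕ.+ (l ℕ.+ i₀) ≡⟨ cong (ℕ._+ (l ℕ.+ i₀)) (sym (rsum-+ c 0 (l ℕ.+ i₀) (suc k))) ⟩
    R (l ℕ.+ i₀ ℕ.+ suc k) ℕ.+ (l ℕ.+ i₀) ≡⟨ cong (λ m → R m ℕ.+ (l ℕ.+ i₀)) end ⟩
    R (n ℕ.+ i₀) ℕ.+ (l ℕ.+ i₀) <⟨ record-at-i₀ (l ℕ.+ i₀) (+-monoˡ-< i₀ (subst (l ℕ.<_) l+k≡n (m<m+n l (s≤s z≤n)))) ⟩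
    R (l ℕ.+ i₀) ℕ.+ (n ℕ.+ i₀) ≡⟨ cong (ℕ._+_ (R (l ℕ.+ i₀))) (sym end) ⟩
    R (l ℕ.+ i₀) ℕ.+ (l ℕ.+ i₀ ℕ.+ suc k) ≡⟨ sym (+-assoc (R (l ℕ.+ i₀)) (l ℕ.+ i₀) (suc k)) ⟩
    R (l ℕ.+ i₀) ℕ.+ (l ℕ.+ i₀) ℕ.+ suc k                      ∎))
    where
    open ≤-Reasoning
    lemma : ∀ a b c → a ℕ.+ b ℕ.+ c ≡ a ℕ.+ c ℕ.+ b
    lemma = ℕ-Solver.solve-∀
    end : l ℕ.+ i₀ ℕ.+ suc k ≡ n ℕ.+ i₀
    end = trans (lemma l i₀ (suc k)) (cong (ℕ._+ i₀) l+k≡n)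

-- The stack may start empty only at the position found by `cycle-lemma`; the labelling is built
-- from there and then rotated back.
labelling : ∀ {n} .{{_ : NonZero n}} {c} → Periodic n c → rsum c 0 n ℕ.< n → Labelling n c
labelling {n} {c} per T<n with i₀ , i₀<n , short ← cycle-lemma per T<n =
  Labelling-shift (n ∸ i₀) per₀ (λ i → trans (cong c (trans (+-assoc i (n ∸ i₀) i₀) (cong (ℕ._+_ i) (m∸n+n≡m (<⇒≤ i₀<n))))) (per i))
    (stack-labelling (λ i → c (i ℕ.+ i₀)) per₀ short)
  where
  per₀ : Periodic n (λ i → c (i ℕ.+ i₀))
  per₀ = shift-periodic i₀ per

ratio : ℕ → ℕ → ℕ
ratio zero      b = 0
ratio a@(suc _) b = b / a

ratio-* : ∀ {a b} → 1 ℕ.≤ a → a ∣ b → ratio a b ℕ.* a ≡ b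
ratio-* {suc a} _ d = m/n*n≡m d

quiddityOf : (ℕ → ℕ) → ℕ → ℕ
quiddityOf u i = ratio (u (1 ℕ.+ i)) (u i ℕ.+ u (2 ℕ.+ i))

quiddityOf-solves : ∀ {u} → Positive u → Divisible u → Solves (quiddityOf u) u
quiddityOf-solves pos div i = ratio-* (pos (1 ℕ.+ i)) (div i)

quiddityOf-periodic : ∀ {n u} → Periodic n u → Periodic n (quiddityOf u)
quiddityOf-periodic per i = cong₂ ratio (per (1 ℕ.+ i)) (cong₂ ℕ._+_ (per i) (per (2 ℕ.+ i)))

-- The quiddity of a frieze with growth coefficient 2

-- E m k stands for the frieze entry F(m, m + k).
record Array (E : ℕ → ℕ → ℤ) : Set where
  field
    diag      : ∀ m → E m 0 ≡ 0ℤ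
    superdiag : ∀ m → E m 1 ≡ 1ℤ
    unimodular : ∀ m k → E m (1 ℕ.+ k) * E (1 ℕ.+ m) (1 ℕ.+ k) - E (1 ℕ.+ m) k * E m (2 ℕ.+ k) ≡ 1ℤ
    positive  : ∀ m k → 0ℤ ℤ.< E m (1 ℕ.+ k)

module _ {E : ℕ → ℕ → ℤ} (A : Array E) where
  open Array A

  private
    q : ℕ → ℤ
    q m = E m 2

  -- The difference of two adjacent diamonds shows that (F(m, j + 1) + F(m, j - 1)) / F(m, j) agrees
  -- in the rows m and m + 1. In the row j - 1 this ratio is the quiddity entry.
  recurrence : ∀ k m → E m (2 ℕ.+ k) + E m k ≡ q (m ℕ.+ k) * E m (1 ℕ.+ k)
  recurrence zero m rewrite diag m | superdiag m | ℕₚ.+-identityʳ m = trans (ℤₚ.+-identityʳ (q m)) (sym (ℤₚ.*-identityʳ (q m)))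
  recurrence (suc k) m = ℤₚ.*-cancelˡ-≡ d _ _ {{ℤ.≢-nonZero (ℤₚ.<⇒≢ (positive (1 ℕ.+ m) k) ∘ sym)}} (begin
    d * (z + x) ≡⟨ lemma₁ d x y z (E (1 ℕ.+ m) k) e ⟩
    y * (e + E (1 ℕ.+ m) k) + ((x * d - E (1 ℕ.+ m) k * y) - (y * e - d * z))
      ≡⟨ cong₂ (λ a b → y * (e + E (1 ℕ.+ m) k) + (a - b)) (unimodular m k) (unimodular m (1 ℕ.+ k)) ⟩
    y * (e + E (1 ℕ.+ m) k) + 0ℤ ≡⟨ ℤₚ.+-identityʳ _ ⟩
    y * (e + E (1 ℕ.+ m) k) ≡⟨ cong (_*_ y) (recurrence k (1 ℕ.+ m)) ⟩
    y * (q (1 ℕ.+ m ℕ.+ k) * d) ≡⟨ cong (λ a → y * (q a * d)) (sym (ℕₚ.+-suc m k)) ⟩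
    y * (q (m ℕ.+ suc k) * d) ≡⟨ lemma₂ y (q (m ℕ.+ suc k)) d ⟩
    d * (q (m ℕ.+ suc k) * y)                            ∎)
    where
    open ≡-Reasoning
    x y z d e : ℤ
    x = E m (1 ℕ.+ k)
    y = E m (2 ℕ.+ k)
    z = E m (3 ℕ.+ k)
    d = E (1 ℕ.+ m) (1 ℕ.+ k)
    e = E (1 ℕ.+ m) (2 ℕ.+ k)
    lemma₁ : ∀ d x y z f e → d * (z + x) ≡ y * (e + f) + ((x * d - f * y) - (y * e - d * z))
    lemma₁ = ℤ-Solver.solve-∀
    lemma₂ : ∀ y q d → y * (q * d) ≡ d * (q * y)
    lemma₂ = ℤ-Solver.solve-∀

array-determined : ∀ {E E′} → Array E → Array E′ → ∀ s → (∀ m → E′ m 2 ≡ E (m ℕ.+ s) 2) → ∀ k m → E′ m k ≡ E (m ℕ.+ s) k × E′ m (suc k) ≡ E (m ℕ.+ s) (suc k)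
array-determined A A′ s e zero m = trans (Array.diag A′ m) (sym (Array.diag A (m ℕ.+ s))) , trans (Array.superdiag A′ m) (sym (Array.superdiag A (m ℕ.+ s)))
array-determined {E} {E′} A A′ s e (suc k) m with array-determined A A′ s e k m
... | e₀ , e₁ = e₁ , (begin
  E′ m (2 ℕ.+ k) ≡⟨ solve (recurrence A′ k m) ⟩
  E′ (m ℕ.+ k) 2 * E′ m (1 ℕ.+ k) - E′ m k ≡⟨ cong₂ _-_ (cong₂ _*_ (trans (e (m ℕ.+ k)) (cong (λ a → E a 2) (lemma m k s))) e₁) e₀ ⟩
  E (m ℕ.+ s ℕ.+ k) 2 * E (m ℕ.+ s) (1 ℕ.+ k) - E (m ℕ.+ s) k ≡⟨ sym (solve (recurrence A k (m ℕ.+ s))) ⟩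
  E (m ℕ.+ s) (2 ℕ.+ k)                                ∎)
  where
  open ≡-Reasoning
  lemma : ∀ m k s → m ℕ.+ k ℕ.+ s ≡ m ℕ.+ s ℕ.+ k
  lemma = ℕ-Solver.solve-∀
  cancel : ∀ a b → a ≡ a + b - b
  cancel = ℤ-Solver.solve-∀
  solve : ∀ {a b c} → a + b ≡ c → a ≡ c - b
  solve {a} {b} refl = cancel a b

record Solved (n : ℕ) : Set where
  field
    q u      : ℕ → ℕ
    q-per    : Periodic n q
    u-pos    : Positive u
    u-solves : Solves q u
    u-per    : Periodic n u
  c : ℕ → ℕ
  c = codeOf u
  c-per : Periodic n c
  c-per = codeOf-periodic u-per

shiftSolved : ∀ {n} → ℕ → Solved n → Solved n
shiftSolved {n} s R = record
  { q = λ i → q (i ℕ.+ s) ; u = λ i → u (i ℕ.+ s)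
  ; q-per = shift-periodic s q-per
  ; u-pos = λ i → u-pos (i ℕ.+ s) ; u-solves = λ i → u-solves (i ℕ.+ s)
  ; u-per = shift-periodic s u-per }
  where open Solved R

module _ {n : ℕ} .{{_ : NonZero n}} (R R′ : Solved n) where
  open Solved

  same-quiddity⇒same-code : (∀ m → q R m ≡ q R′ m) → ∀ m → c R m ≡ c R′ m
  same-quiddity⇒same-code e = quiddity-determines-code {n} {q R} {u R} {u R′} (u-pos R) (u-solves R) (u-per R) (codeOf-isCode (u-pos R))
    (u-pos R′) (λ i → trans (cong (ℕ._* u R′ (suc i)) (e i)) (u-solves R′ i)) (u-per R′) (codeOf-isCode (u-pos R′))

  same-code⇒same-quiddity : (∀ m → c R m ≡ c R′ m) → ∀ m → q R m ≡ q R′ m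
  same-code⇒same-quiddity e = code-determines-quiddity {n} {q R} {u R} {q R′} {u R′} {c R} (u-pos R) (u-solves R) (codeOf-isCode (u-pos R)) (u-per R)
    (u-pos R′) (u-solves R′) (λ i → subst (λ a → a ℕ.* u R′ i ℕ.< u R′ (suc i) × u R′ (suc i) ℕ.≤ suc a ℕ.* u R′ i) (sym (e i)) (codeOf-isCode (u-pos R′) i)) (u-per R′)
    (q-per R) (q-per R′)

module _ {E : ℕ → ℕ → ℤ} (A : Array E) {n-1 : ℕ} (per : ∀ k → Periodic (suc n-1) (λ m → E m k))
  (growth₂ : ∀ m → E m (2 ℕ.+ n-1) - E (1 ℕ.+ m) n-1 ≡ + 2) where
  open Array A
  open ≡-Reasoning

  private
    n : ℕ
    n = suc n-1
    q : ℕ → ℤ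
    q m = E m 2
    f v D : ℕ → ℤ
    f = E 0
    v j = f (j ℕ.+ n) - f j
    D j = v (j ℕ.+ n) - v j

  -- Translation by n, written in the basis of solutions given by the rows 0 and 1. Both sides
  -- satisfy the same recurrence in j, so two initial values suffice.
  monodromy : ∀ j → f (1 ℕ.+ j ℕ.+ n) ≡ f (1 ℕ.+ n) * f (1 ℕ.+ j) - f n * E 1 j
    × f (2 ℕ.+ j ℕ.+ n) ≡ f (1 ℕ.+ n) * f (2 ℕ.+ j) - f n * E 1 (1 ℕ.+ j)
  monodromy zero = base₀ , base₁
    where
    lemma₀ : ∀ x y → x ≡ x * 1ℤ - y * 0ℤ
    lemma₀ = ℤ-Solver.solve-∀
    base₀ : f (1 ℕ.+ n) ≡ f (1 ℕ.+ n) * f 1 - f n * E 1 0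
    base₀ rewrite superdiag 0 | diag 1 = lemma₀ (f (1 ℕ.+ n)) (f n)
    lemma₁ : ∀ x y → x ≡ x + y - y * 1ℤ
    lemma₁ = ℤ-Solver.solve-∀
    base₁ : f (2 ℕ.+ n) ≡ f (1 ℕ.+ n) * f 2 - f n * E 1 1
    base₁ rewrite superdiag 1 = trans (lemma₁ (f (2 ℕ.+ n)) (f n)) (cong (_- f n * 1ℤ)
      (trans (recurrence A n 0) (trans (cong (_* f (1 ℕ.+ n)) (per 2 0)) (ℤₚ.*-comm (q 0) _))))
  monodromy (suc j) with monodromy j
  ... | e₀ , e₁ = e₁ , (begin
    f (3 ℕ.+ j ℕ.+ n) ≡⟨ cancel (f (3 ℕ.+ j ℕ.+ n)) (f (1 ℕ.+ j ℕ.+ n)) ⟩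
    f (3 ℕ.+ j ℕ.+ n) + f (1 ℕ.+ j ℕ.+ n) - f (1 ℕ.+ j ℕ.+ n)
      ≡⟨ cong (_- f (1 ℕ.+ j ℕ.+ n)) (trans (recurrence A (1 ℕ.+ j ℕ.+ n) 0) (cong (_* f (2 ℕ.+ j ℕ.+ n)) (per 2 (1 ℕ.+ j)))) ⟩
    q (1 ℕ.+ j) * f (2 ℕ.+ j ℕ.+ n) - f (1 ℕ.+ j ℕ.+ n) ≡⟨ cong₂ (λ a b → q (1 ℕ.+ j) * a - b) e₁ e₀ ⟩
    q (1 ℕ.+ j) * (f (1 ℕ.+ n) * f (2 ℕ.+ j) - f n * E 1 (1 ℕ.+ j)) - (f (1 ℕ.+ n) * f (1 ℕ.+ j) - f n * E 1 j)
      ≡⟨ lemma (q (1 ℕ.+ j)) (f (1 ℕ.+ n)) (f (2 ℕ.+ j)) (f n) (E 1 (1 ℕ.+ j)) (f (1 ℕ.+ j)) (E 1 j) ⟩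
    f (1 ℕ.+ n) * (q (1 ℕ.+ j) * f (2 ℕ.+ j) - f (1 ℕ.+ j)) - f n * (q (1 ℕ.+ j) * E 1 (1 ℕ.+ j) - E 1 j)
      ≡⟨ cong₂ (λ a b → f (1 ℕ.+ n) * (a - f (1 ℕ.+ j)) - f n * (b - E 1 j)) (sym (recurrence A (1 ℕ.+ j) 0)) (sym (recurrence A j 1)) ⟩
    f (1 ℕ.+ n) * (f (3 ℕ.+ j) + f (1 ℕ.+ j) - f (1 ℕ.+ j)) - f n * (E 1 (2 ℕ.+ j) + E 1 j - E 1 j)
      ≡⟨ cong₂ (λ a b → f (1 ℕ.+ n) * a - f n * b) (sym (cancel (f (3 ℕ.+ j)) (f (1 ℕ.+ j)))) (sym (cancel (E 1 (2 ℕ.+ j)) (E 1 j))) ⟩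
    f (1 ℕ.+ n) * f (3 ℕ.+ j) - f n * E 1 (2 ℕ.+ j) ∎)
    where
    cancel : ∀ a b → a ≡ a + b - b
    cancel = ℤ-Solver.solve-∀
    lemma : ∀ q a b c d e f → q * (a * b - c * d) - (a * e - c * f) ≡ a * (q * b - e) - c * (q * d - f)
    lemma = ℤ-Solver.solve-∀

  v-recurrence : ∀ j → v (2 ℕ.+ j) + v j ≡ q j * v (1 ℕ.+ j)
  v-recurrence j = begin
    v (2 ℕ.+ j) + v j
      ≡⟨ lemma₁ (f (2 ℕ.+ j ℕ.+ n)) (f (2 ℕ.+ j)) (f (j ℕ.+ n)) (f j) ⟩
    f (2 ℕ.+ j ℕ.+ n) + f (j ℕ.+ n) - (f (2 ℕ.+ j) + f j)
      ≡⟨ cong₂ _-_ (trans (recurrence A (j ℕ.+ n) 0) (cong (_* f (1 ℕ.+ j ℕ.+ n)) (per 2 j))) (recurrence A j 0) ⟩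
    q j * f (1 ℕ.+ j ℕ.+ n) - q j * f (1 ℕ.+ j)
      ≡⟨ lemma₂ (q j) (f (1 ℕ.+ j ℕ.+ n)) (f (1 ℕ.+ j)) ⟩
    q j * v (1 ℕ.+ j) ∎
    where
    lemma₁ : ∀ a b c d → a - b + (c - d) ≡ a + c - (b + d)
    lemma₁ = ℤ-Solver.solve-∀
    lemma₂ : ∀ q a b → q * a - q * b ≡ q * (a - b)
    lemma₂ = ℤ-Solver.solve-∀

  -- The monodromy has determinant 1 and trace 2, so it is unipotent.
  D-zero : ∀ j → D j ≡ 0ℤ × D (1 ℕ.+ j) ≡ 0ℤ
  D-zero zero = base₀ , base₁
    where
    lemma₀ : ∀ a b g → a * b - b * g - b - (b - 0ℤ) ≡ b * (a - g - + 2)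
    lemma₀ = ℤ-Solver.solve-∀
    base₀ : D 0 ≡ 0ℤ
    base₀ = begin
      f (n ℕ.+ n) - f n - (f n - f 0) ≡⟨ cong₂ (λ a b → a - f n - (f n - b)) (proj₁ (monodromy n-1)) (diag 0) ⟩
      f (1 ℕ.+ n) * f n - f n * E 1 n-1 - f n - (f n - 0ℤ) ≡⟨ lemma₀ (f (1 ℕ.+ n)) (f n) (E 1 n-1) ⟩
      f n * (f (1 ℕ.+ n) - E 1 n-1 - + 2) ≡⟨ cong (λ a → f n * (a - + 2)) (growth₂ 0) ⟩
      f n * 0ℤ ≡⟨ ℤₚ.*-zeroʳ (f n) ⟩
      0ℤ ∎
    lemma₁ : ∀ a b g h → a * a - b * h - a - (a - 1ℤ) ≡ a * (a - g - + 2) + (1ℤ - (b * h - g * a))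
    lemma₁ = ℤ-Solver.solve-∀
    base₁ : D 1 ≡ 0ℤ
    base₁ = begin
      f (1 ℕ.+ n ℕ.+ n) - f (1 ℕ.+ n) - (f (1 ℕ.+ n) - f 1)
        ≡⟨ cong₂ (λ a b → a - f (1 ℕ.+ n) - (f (1 ℕ.+ n) - b)) (proj₁ (monodromy n)) (superdiag 0) ⟩
      f (1 ℕ.+ n) * f (1 ℕ.+ n) - f n * E 1 n - f (1 ℕ.+ n) - (f (1 ℕ.+ n) - 1ℤ)
        ≡⟨ lemma₁ (f (1 ℕ.+ n)) (f n) (E 1 n-1) (E 1 n) ⟩
      f (1 ℕ.+ n) * (f (1 ℕ.+ n) - E 1 n-1 - + 2) + (1ℤ - (f n * E 1 n - E 1 n-1 * f (1 ℕ.+ n)))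
        ≡⟨ cong₂ (λ a b → f (1 ℕ.+ n) * (a - + 2) + (1ℤ - b)) (growth₂ 0) (unimodular 0 n-1) ⟩
      f (1 ℕ.+ n) * 0ℤ + 0ℤ ≡⟨ trans (ℤₚ.+-identityʳ _) (ℤₚ.*-zeroʳ (f (1 ℕ.+ n))) ⟩
      0ℤ ∎
  D-zero (suc j) with D-zero j
  ... | e₀ , e₁ = e₁ , (begin
    D (2 ℕ.+ j) ≡⟨ lemma₁ (v (2 ℕ.+ j ℕ.+ n)) (v (2 ℕ.+ j)) (v (j ℕ.+ n)) (v j) ⟩
    (v (2 ℕ.+ j ℕ.+ n) + v (j ℕ.+ n)) - (v (2 ℕ.+ j) + v j) - D j
      ≡⟨ cong₂ (λ a b → a - b - D j) (trans (v-recurrence (j ℕ.+ n)) (cong (_* v (1 ℕ.+ j ℕ.+ n)) (per 2 j))) (v-recurrence j) ⟩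
    q j * v (1 ℕ.+ j ℕ.+ n) - q j * v (1 ℕ.+ j) - D j ≡⟨ lemma₂ (q j) (v (1 ℕ.+ j ℕ.+ n)) (v (1 ℕ.+ j)) (D j) ⟩
    q j * D (1 ℕ.+ j) - D j ≡⟨ cong₂ (λ a b → q j * a - b) e₁ e₀ ⟩
    q j * 0ℤ - 0ℤ ≡⟨ trans (ℤₚ.+-identityʳ _) (ℤₚ.*-zeroʳ (q j)) ⟩
    0ℤ                                           ∎)
    where
    lemma₁ : ∀ a b c d → a - b ≡ (a + c) - (b + d) - (c - d)
    lemma₁ = ℤ-Solver.solve-∀
    lemma₂ : ∀ q a b d → q * a - q * b - d ≡ q * (a - b) - d
    lemma₂ = ℤ-Solver.solve-∀

  v-periodic : Periodic n v
  v-periodic j = ℤₚ.i-j≡0⇒i≡j _ _ (proj₁ (D-zero j))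

  f-arithmetic : ∀ j k → f (j ℕ.+ k ℕ.* n) ≡ f j + + k * v j
  f-arithmetic j zero    = trans (cong f (ℕₚ.+-identityʳ j)) (sym (trans (cong (_+_ (f j)) (ℤₚ.*-zeroˡ (v j))) (ℤₚ.+-identityʳ (f j))))
  f-arithmetic j (suc k) = begin
    f (j ℕ.+ suc k ℕ.* n) ≡⟨ cong f (index j n (k ℕ.* n)) ⟩
    f (j ℕ.+ k ℕ.* n ℕ.+ n) ≡⟨ cancel (f (j ℕ.+ k ℕ.* n ℕ.+ n)) (f (j ℕ.+ k ℕ.* n)) ⟩
    v (j ℕ.+ k ℕ.* n) + f (j ℕ.+ k ℕ.* n) ≡⟨ cong₂ _+_ (Periodic-* v-periodic k j) (f-arithmetic j k) ⟩
    v j + (f j + + k * v j) ≡⟨ lemma (v j) (f j) (+ k) ⟩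
    f j + (1ℤ + + k) * v j ∎
    where
    index : ∀ j n a → j ℕ.+ (n ℕ.+ a) ≡ j ℕ.+ a ℕ.+ n
    index = ℕ-Solver.solve-∀
    cancel : ∀ a b → a ≡ a - b + b
    cancel = ℤ-Solver.solve-∀
    lemma : ∀ v f k → v + (f + k * v) ≡ f + (1ℤ + k) * v
    lemma = ℤ-Solver.solve-∀

  f-nonNegative : ∀ j → 0ℤ ℤ.≤ f j
  f-nonNegative zero    = ℤₚ.≤-reflexive (sym (diag 0))
  f-nonNegative (suc j) = ℤₚ.<⇒≤ (positive 0 j)

  -- By `f-arithmetic` a negative increment would push f below 0 after f j + 1 periods.
  v-nonNegative : ∀ j → 0ℤ ℤ.≤ v j
  v-nonNegative j with v j in v≡
  ... | + a      = ℤ.+≤+ z≤n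
  ... | -[1+ a ] = contradiction (ℤₚ.≤-trans (f-nonNegative (j ℕ.+ k ℕ.* n)) (ℤₚ.≤-reflexive negative)) (λ ())
    where
    k : ℕ
    k = suc ∣ f j ∣
    lemma : ∀ x a → x + (1ℤ + x) * - (1ℤ + a) ≡ - (1ℤ + (a + x * a))
    lemma = ℤ-Solver.solve-∀
    negative : f (j ℕ.+ k ℕ.* n) ≡ -[1+ a ℕ.+ ∣ f j ∣ ℕ.* a ]
    negative = begin
      f (j ℕ.+ k ℕ.* n) ≡⟨ f-arithmetic j k ⟩
      f j + + k * v j ≡⟨ cong₂ (λ x y → x + + k * y) (sym (ℤₚ.0≤i⇒+∣i∣≡i (f-nonNegative j))) v≡ ⟩
      + ∣ f j ∣ + + k * -[1+ a ] ≡⟨ lemma (+ ∣ f j ∣) (+ a) ⟩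
      - (1ℤ + (+ a + + ∣ f j ∣ * + a)) ≡⟨ cong (λ y → - (1ℤ + (+ a + y))) (sym (ℤₚ.pos-* ∣ f j ∣ a)) ⟩
      -[1+ a ℕ.+ ∣ f j ∣ ℕ.* a ] ∎

  -- The start is v 0 = F(0, n). A zero at j + 1 would force v j + v (j + 2) = 0 although v j is
  -- positive and v (j + 2) nonnegative.
  v-positive : ∀ j → 0ℤ ℤ.< v j
  v-positive zero    = subst (0ℤ ℤ.<_) (sym (trans (cong (λ x → f n - x) (diag 0)) (ℤₚ.+-identityʳ (f n)))) (positive 0 n-1)
  v-positive (suc j) = ℤₚ.≤∧≢⇒< (v-nonNegative (suc j)) (λ 0≡v → ℤₚ.<⇒≱ (v-positive j) (begin-≤ 0≡v))
    where
    begin-≤ : 0ℤ ≡ v (suc j) → v j ℤ.≤ 0ℤ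
    begin-≤ 0≡v = subst (v j ℤ.≤_) (trans (v-recurrence j) (trans (cong (_*_ (q j)) (sym 0≡v)) (ℤₚ.*-zeroʳ (q j))))
      (ℤₚ.≤-trans (ℤₚ.≤-reflexive (sym (ℤₚ.+-identityˡ (v j)))) (ℤₚ.+-monoˡ-≤ (v j) (v-nonNegative (2 ℕ.+ j))))

  solved : Solved n
  solved = record
    { q = λ m → ∣ E m 2 ∣ ; u = λ j → ∣ v j ∣
    ; q-per = λ m → cong ∣_∣ (per 2 m)
    ; u-pos = λ j → ℤₚ.drop‿+<+ (subst (0ℤ ℤ.<_) (sym (+∣v∣ j)) (v-positive j))
    ; u-solves = λ j → ℤₚ.+-injective (begin
        + (∣ E j 2 ∣ ℕ.* ∣ v (1 ℕ.+ j) ∣) ≡⟨ ℤₚ.pos-* ∣ E j 2 ∣ ∣ v (1 ℕ.+ j) ∣ ⟩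
        + ∣ E j 2 ∣ * + ∣ v (1 ℕ.+ j) ∣ ≡⟨ cong₂ _*_ (ℤₚ.0≤i⇒+∣i∣≡i (ℤₚ.<⇒≤ (positive j 1))) (+∣v∣ (1 ℕ.+ j)) ⟩
        q j * v (1 ℕ.+ j) ≡⟨ sym (v-recurrence j) ⟩
        v (2 ℕ.+ j) + v j ≡⟨ ℤₚ.+-comm (v (2 ℕ.+ j)) (v j) ⟩
        v j + v (2 ℕ.+ j) ≡⟨ cong₂ _+_ (sym (+∣v∣ j)) (sym (+∣v∣ (2 ℕ.+ j))) ⟩
        + (∣ v j ∣ ℕ.+ ∣ v (2 ℕ.+ j) ∣)        ∎)
    ; u-per = λ j → cong ∣_∣ (v-periodic j) }
    where
    +∣v∣ : ∀ j → + ∣ v j ∣ ≡ v j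
    +∣v∣ j = ℤₚ.0≤i⇒+∣i∣≡i (v-nonNegative j)

-- The frieze of a quiddity

periodic-ℤ : ∀ {n} {f : ℕ → B} → Periodic n f → ∀ {a b} z → + a ≡ + b + z * + n → f a ≡ f b
periodic-ℤ {n = n} {f} per {a} {b} (+ k) e = trans (cong f (ℤₚ.+-injective (trans e (cong (_+_ (+ b)) (sym (ℤₚ.pos-* k n)))))) (Periodic-* per k b)
periodic-ℤ {n = n} {f} per {a} {b} -[1+ k ] e = sym (trans (cong f (ℤₚ.+-injective (begin
    + b ≡⟨ lemma (+ b) (+ suc k) (+ n) ⟩
    + b + -[1+ k ] * + n + + suc k * + n ≡⟨ cong₂ _+_ (sym e) (sym (ℤₚ.pos-* (suc k) n)) ⟩
    + a + + (suc k ℕ.* n)                                   ∎))) (Periodic-* per (suc k) a))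
  where
  open ≡-Reasoning
  lemma : ∀ b k n → b ≡ b + - k * n + k * n
  lemma = ℤ-Solver.solve-∀

periodic-%ℕ : ∀ {n} .{{_ : NonZero n}} {f : ℕ → B} → Periodic n f → ∀ i k → f ((i + + k) %ℕ n) ≡ f (i %ℕ n ℕ.+ k)
periodic-%ℕ {n = n} per i k = sym (periodic-ℤ per ((i + + k) /ℕ n - i /ℕ n) (begin
    + (i %ℕ n) + + k
      ≡⟨ lemma₁ (+ (i %ℕ n)) (+ k) (i /ℕ n) (+ n) ⟩
    (+ (i %ℕ n) + i /ℕ n * + n) + + k - i /ℕ n * + n
      ≡⟨ cong (λ a → a + + k - i /ℕ n * + n) (sym (a≡a%ℕn+[a/ℕn]*n i n)) ⟩
    i + + k - i /ℕ n * + n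
      ≡⟨ cong (_- i /ℕ n * + n) (a≡a%ℕn+[a/ℕn]*n (i + + k) n) ⟩
    + ((i + + k) %ℕ n) + (i + + k) /ℕ n * + n - i /ℕ n * + n
      ≡⟨ lemma₂ (+ ((i + + k) %ℕ n)) ((i + + k) /ℕ n) (i /ℕ n) (+ n) ⟩
    + ((i + + k) %ℕ n) + ((i + + k) /ℕ n - i /ℕ n) * + n ∎))
  where
  open ≡-Reasoning
  lemma₁ : ∀ r k z n → r + k ≡ (r + z * n) + k - z * n
  lemma₁ = ℤ-Solver.solve-∀
  lemma₂ : ∀ r y z n → r + y * n - z * n ≡ r + (y - z) * n
  lemma₂ = ℤ-Solver.solve-∀

distance : ∀ {i j} → i ℤ.≤ j → ∃ λ k → j ≡ i + + k
distance {i} {j} i≤j = ∣ j - i ∣ , trans (lemma i j) (cong (_+_ i) (sym (ℤₚ.0≤i⇒+∣i∣≡i (ℤₚ.i≤j⇒0≤j-i i≤j))))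
  where
  lemma : ∀ i j → j ≡ i + (j - i)
  lemma = ℤ-Solver.solve-∀

-- The continuants of q: each row solves the recurrence with initial values 0 and 1.
quiddityArray : (ℕ → ℕ) → ℕ → ℕ → ℤ
quiddityArray q m zero          = 0ℤ
quiddityArray q m (suc zero)    = 1ℤ
quiddityArray q m (suc (suc k)) = + q (m ℕ.+ k) * quiddityArray q m (suc k) - quiddityArray q m k

module _ {n : ℕ} (R : Solved n) where
  open Solved R
  open ≡-Reasoning

  private
    E : ℕ → ℕ → ℤ
    E = quiddityArray q
    U : ℕ → ℤ
    U m = + u m
    U-solves : ∀ m → + q m * U (1 ℕ.+ m) ≡ U m + U (2 ℕ.+ m)
    U-solves m = trans (sym (ℤₚ.pos-* (q m) (u (1 ℕ.+ m)))) (cong +_ (u-solves m))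

  E-periodic : ∀ k → Periodic n (λ m → E m k)
  E-periodic zero          m = refl
  E-periodic (suc zero)    m = refl
  E-periodic (suc (suc k)) m = cong₂ _-_ (cong₂ _*_ (cong +_ (trans (cong q (lemma m n k)) (q-per (m ℕ.+ k)))) (E-periodic (suc k) m)) (E-periodic k m)
    where
    lemma : ∀ m n k → m ℕ.+ n ℕ.+ k ≡ m ℕ.+ k ℕ.+ n
    lemma = ℕ-Solver.solve-∀

  -- The Wronskian of row m and u is constant and equals u m at the start. Written without
  -- subtraction, it gives the positivity of the entries by induction.
  E-horizontal : ∀ m k → E m (1 ℕ.+ k) * U (m ℕ.+ k) ≡ E m k * U (1 ℕ.+ m ℕ.+ k) + U m
  E-horizontal m zero    = trans (cong (λ i → 1ℤ * U i) (ℕₚ.+-identityʳ m)) (lemma (U m) (U (1 ℕ.+ m ℕ.+ 0)))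
    where
    lemma : ∀ x y → 1ℤ * x ≡ 0ℤ * y + x
    lemma = ℤ-Solver.solve-∀
  E-horizontal m (suc k) = begin
    (+ q (m ℕ.+ k) * b - a) * U (m ℕ.+ suc k) ≡⟨ cong (λ i → (+ q (m ℕ.+ k) * b - a) * U i) (ℕₚ.+-suc m k) ⟩
    (+ q (m ℕ.+ k) * b - a) * y ≡⟨ lemma₁ (+ q (m ℕ.+ k)) b a y ⟩
    b * (+ q (m ℕ.+ k) * y) - a * y ≡⟨ cong (λ w → b * w - a * y) (U-solves (m ℕ.+ k)) ⟩
    b * (x + z) - a * y ≡⟨ lemma₂ b x z (a * y) ⟩
    b * x - a * y + b * z ≡⟨ cong (λ w → w - a * y + b * z) (E-horizontal m k) ⟩
    a * y + U m - a * y + b * z ≡⟨ lemma₃ (a * y) (U m) (b * z) ⟩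
    b * z + U m ≡⟨ cong (λ i → b * U i + U m) (cong suc (sym (ℕₚ.+-suc m k))) ⟩
    b * U (1 ℕ.+ m ℕ.+ suc k) + U m ∎
    where
    a b x y z : ℤ
    a = E m k
    b = E m (1 ℕ.+ k)
    x = U (m ℕ.+ k)
    y = U (1 ℕ.+ m ℕ.+ k)
    z = U (2 ℕ.+ m ℕ.+ k)
    lemma₁ : ∀ q b a y → (q * b - a) * y ≡ b * (q * y) - a * y
    lemma₁ = ℤ-Solver.solve-∀
    lemma₂ : ∀ b x z w → b * (x + z) - w ≡ b * x - w + b * z
    lemma₂ = ℤ-Solver.solve-∀
    lemma₃ : ∀ w v z → w + v - w + z ≡ z + v
    lemma₃ = ℤ-Solver.solve-∀

  -- Row m, row m + 1 and u solve the same recurrence along the columns, so a linear relation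
  -- between them follows from two initial values; hence the pair of consecutive cases.
  E-vertical : ∀ m k → E m (1 ℕ.+ k) * U (1 ℕ.+ m) ≡ E (1 ℕ.+ m) k * U m + U (1 ℕ.+ m ℕ.+ k)
    × E m (2 ℕ.+ k) * U (1 ℕ.+ m) ≡ E (1 ℕ.+ m) (1 ℕ.+ k) * U m + U (2 ℕ.+ m ℕ.+ k)
  E-vertical m zero rewrite ℕₚ.+-identityʳ m = lemma₀ (U (1 ℕ.+ m)) (U m) ,
    trans (lemma₁ (+ q m) (U (1 ℕ.+ m))) (trans (U-solves m) (cong (_+ U (2 ℕ.+ m)) (sym (ℤₚ.*-identityˡ (U m)))))
    where
    lemma₀ : ∀ x y → 1ℤ * x ≡ 0ℤ * y + x
    lemma₀ = ℤ-Solver.solve-∀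
    lemma₁ : ∀ q x → (q * 1ℤ - 0ℤ) * x ≡ q * x
    lemma₁ = ℤ-Solver.solve-∀
  E-vertical m (suc k) with E-vertical m k
  ... | e₀ , e₁ = trans e₁ (cong (λ i → E (1 ℕ.+ m) (1 ℕ.+ k) * U m + U i) (cong suc (sym (ℕₚ.+-suc m k)))) , (begin
    (+ q (m ℕ.+ suc k) * b - a) * U (1 ℕ.+ m) ≡⟨ cong (λ i → (+ q i * b - a) * U (1 ℕ.+ m)) (ℕₚ.+-suc m k) ⟩
    (Q * b - a) * U (1 ℕ.+ m) ≡⟨ lemma₁ Q b a (U (1 ℕ.+ m)) ⟩
    Q * (b * U (1 ℕ.+ m)) - a * U (1 ℕ.+ m) ≡⟨ cong₂ (λ x y → Q * x - y) e₁ e₀ ⟩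
    Q * (d * U m + U (2 ℕ.+ m ℕ.+ k)) - (c₀ * U m + U (1 ℕ.+ m ℕ.+ k))
      ≡⟨ lemma₂ Q d (U m) (U (2 ℕ.+ m ℕ.+ k)) c₀ (U (1 ℕ.+ m ℕ.+ k)) ⟩
    (Q * d - c₀) * U m + (Q * U (2 ℕ.+ m ℕ.+ k) - U (1 ℕ.+ m ℕ.+ k))
      ≡⟨ cong (λ w → (Q * d - c₀) * U m + (w - U (1 ℕ.+ m ℕ.+ k))) (U-solves (1 ℕ.+ m ℕ.+ k)) ⟩
    (Q * d - c₀) * U m + (U (1 ℕ.+ m ℕ.+ k) + U (3 ℕ.+ m ℕ.+ k) - U (1 ℕ.+ m ℕ.+ k))
      ≡⟨ cong (_+_ ((Q * d - c₀) * U m)) (lemma₃ (U (1 ℕ.+ m ℕ.+ k)) (U (3 ℕ.+ m ℕ.+ k))) ⟩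
    (Q * d - c₀) * U m + U (3 ℕ.+ m ℕ.+ k)
      ≡⟨ cong (λ i → (Q * d - c₀) * U m + U (2 ℕ.+ i)) (sym (ℕₚ.+-suc m k)) ⟩
    (Q * d - c₀) * U m + U (2 ℕ.+ m ℕ.+ suc k)     ∎)
    where
    a b c₀ d Q : ℤ
    a = E m (1 ℕ.+ k)
    b = E m (2 ℕ.+ k)
    c₀ = E (1 ℕ.+ m) k
    d = E (1 ℕ.+ m) (1 ℕ.+ k)
    Q = + q (1 ℕ.+ m ℕ.+ k)
    lemma₁ : ∀ q b a y → (q * b - a) * y ≡ q * (b * y) - a * y
    lemma₁ = ℤ-Solver.solve-∀
    lemma₂ : ∀ q d x y c z → q * (d * x + y) - (c * x + z) ≡ (q * d - c) * x + (q * y - z)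
    lemma₂ = ℤ-Solver.solve-∀
    lemma₃ : ∀ y z → y + z - y ≡ z
    lemma₃ = ℤ-Solver.solve-∀

  E-unimodular : ∀ m k → E m (1 ℕ.+ k) * E (1 ℕ.+ m) (1 ℕ.+ k) - E (1 ℕ.+ m) k * E m (2 ℕ.+ k) ≡ 1ℤ
  E-unimodular m zero    = refl
  E-unimodular m (suc k) rewrite ℕₚ.+-suc m k = trans (lemma (+ q (suc (m ℕ.+ k))) (E m (1 ℕ.+ k)) (E m (2 ℕ.+ k)) (E (1 ℕ.+ m) k) (E (1 ℕ.+ m) (1 ℕ.+ k))) (E-unimodular m k)
    where
    lemma : ∀ q a b c d → b * (q * d - c) - d * (q * b - a) ≡ a * d - c * b
    lemma = ℤ-Solver.solve-∀

  E-positive : ∀ m k → 0ℤ ℤ.< E m (1 ℕ.+ k)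
  E-positive m k = ℤₚ.*-cancelʳ-<-nonNeg {0ℤ} {E m (1 ℕ.+ k)} (U (m ℕ.+ k)) (subst₂ ℤ._<_ (sym (ℤₚ.*-zeroˡ (U (m ℕ.+ k)))) (sym (E-horizontal m k))
    (ℤₚ.≤-<-trans (nonNegative k) (ℤₚ.≤-<-trans (ℤₚ.≤-reflexive (sym (ℤₚ.+-identityʳ _))) (ℤₚ.+-monoʳ-< (E m k * U (1 ℕ.+ m ℕ.+ k)) (ℤ.+<+ (u-pos m))))))
    where
    nonNegative : ∀ k → 0ℤ ℤ.≤ E m k * U (1 ℕ.+ m ℕ.+ k)
    nonNegative zero    = ℤₚ.≤-refl
    nonNegative (suc k) = subst (ℤ._≤ E m (suc k) * U (1 ℕ.+ m ℕ.+ suc k)) (ℤₚ.*-zeroˡ (U (1 ℕ.+ m ℕ.+ suc k))) (ℤₚ.*-monoʳ-≤-nonNeg (U (1 ℕ.+ m ℕ.+ suc k)) (ℤₚ.<⇒≤ (E-positive m k)))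

  E-array : Array E
  E-array = record { diag = λ _ → refl ; superdiag = λ _ → refl ; unimodular = E-unimodular ; positive = E-positive }

  -- After multiplication by u m, the horizontal and vertical relations express both entries through
  -- E m n. By periodicity of u these parts cancel, and u m is left twice.
  E-growth : ∀ n-1 → n ≡ suc n-1 → ∀ m → E m (2 ℕ.+ n-1) - E (1 ℕ.+ m) n-1 ≡ + 2
  E-growth n-1 refl m = ℤₚ.*-cancelʳ-≡ _ _ (U m) {{ℤ.≢-nonZero (λ U≡0 → ℕₚ.<⇒≢ (u-pos m) (sym (ℤₚ.+-injective U≡0)))}} (begin
    (E m (2 ℕ.+ n-1) - E (1 ℕ.+ m) n-1) * U m ≡⟨ lemma₁ (E m (2 ℕ.+ n-1)) (E (1 ℕ.+ m) n-1) (U m) ⟩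
    E m (2 ℕ.+ n-1) * U m - E (1 ℕ.+ m) n-1 * U m ≡⟨ cong₂ _-_ (trans (cong (λ w → E m (2 ℕ.+ n-1) * w) (sym (U-per m))) (E-horizontal m (suc n-1)))
                                                                     (isolate (proj₁ (E-vertical m n-1))) ⟩
    E m (1 ℕ.+ n-1) * U (1 ℕ.+ m ℕ.+ suc n-1) + U m - (E m (1 ℕ.+ n-1) * U (1 ℕ.+ m) - U (1 ℕ.+ m ℕ.+ n-1))
      ≡⟨ cong₂ (λ x y → E m (1 ℕ.+ n-1) * x + U m - (E m (1 ℕ.+ n-1) * U (1 ℕ.+ m) - y))
           (U-per (1 ℕ.+ m)) (trans (cong U (sym (ℕₚ.+-suc m n-1))) (U-per m)) ⟩
    E m (1 ℕ.+ n-1) * U (1 ℕ.+ m) + U m - (E m (1 ℕ.+ n-1) * U (1 ℕ.+ m) - U m)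
      ≡⟨ lemma₂ (E m (1 ℕ.+ n-1) * U (1 ℕ.+ m)) (U m) ⟩
    + 2 * U m                                              ∎)
    where
    U-per : ∀ i → U (i ℕ.+ suc n-1) ≡ U i
    U-per i = cong +_ (u-per i)
    lemma₁ : ∀ a b x → (a - b) * x ≡ a * x - b * x
    lemma₁ = ℤ-Solver.solve-∀
    lemma₂ : ∀ a x → a + x - (a - x) ≡ + 2 * x
    lemma₂ = ℤ-Solver.solve-∀
    cancel : ∀ b y → b ≡ b + y - y
    cancel = ℤ-Solver.solve-∀
    isolate : ∀ {a b y} → a ≡ b + y → b ≡ a - y
    isolate {_} {b} {y} refl = cancel b y

module _ {n : ℕ} .{{_ : NonZero n}} {E : ℕ → ℕ → ℤ} (A : Array E) (per : ∀ k → Periodic n (λ m → E m k)) where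
  open Array A

  private
    e : ℤ → ℤ → ℤ
    e i j = E (i %ℕ n) ∣ j - i ∣
    at : ∀ i j k → j - i ≡ + k → e i j ≡ E (i %ℕ n) k
    at i j k d = cong (λ z → E (i %ℕ n) ∣ z ∣) d
    at-suc : ∀ i j k → j - (i + 1ℤ) ≡ + k → e (i + 1ℤ) j ≡ E (suc (i %ℕ n)) k
    at-suc i j k d = trans (at (i + 1ℤ) j k d) (trans (periodic-%ℕ (per k) i 1) (cong (λ m → E m k) (ℕₚ.+-comm (i %ℕ n) 1)))
    lemma₀ : ∀ i k → i + k - i ≡ k
    lemma₀ = ℤ-Solver.solve-∀
    lemma₁ : ∀ i k → i + 1ℤ + k - i ≡ 1ℤ + k
    lemma₁ = ℤ-Solver.solve-∀
    lemma₂ : ∀ i k → i + 1ℤ + k + 1ℤ - (i + 1ℤ) ≡ 1ℤ + k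
    lemma₂ = ℤ-Solver.solve-∀
    lemma₃ : ∀ i k → i + 1ℤ + k + 1ℤ - i ≡ + 2 + k
    lemma₃ = ℤ-Solver.solve-∀
    lemma₄ : ∀ i j k → j + k - (i + k) ≡ j - i
    lemma₄ = ℤ-Solver.solve-∀

  -- Rows at negative positions are supplied by periodicity; for i ≤ j the absolute value is the
  -- distance j - i.
  arrayFrieze : InfiniteFrieze
  arrayFrieze = record
    { entry = e
    ; entry-diagonal = λ i → trans (at i i 0 (ℤₚ.+-inverseʳ i)) (diag (i %ℕ n))
    ; entry-superdiagonal = λ i → trans (at i (i + 1ℤ) 1 (lemma₀ i 1ℤ)) (superdiag (i %ℕ n))
    ; diamond = λ i j i+1≤j → diamond′ i j (distance i+1≤j)
    }
    where
    diamond′ : ∀ i j → (∃ λ k → j ≡ i + 1ℤ + + k) → e i j * e (i + 1ℤ) (j + 1ℤ) - e (i + 1ℤ) j * e i (j + 1ℤ) ≡ 1ℤ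
    diamond′ i j (k , refl) = trans
      (cong₂ _-_ (cong₂ _*_ (at i j (1 ℕ.+ k) (lemma₁ i (+ k))) (at-suc i (j + 1ℤ) (1 ℕ.+ k) (lemma₂ i (+ k))))
                   (cong₂ _*_ (at-suc i j k (lemma₀ (i + 1ℤ) (+ k))) (at i (j + 1ℤ) (2 ℕ.+ k) (lemma₃ i (+ k)))))
      (unimodular (i %ℕ n) k)

  arrayFrieze-positive : PositiveIntegral arrayFrieze
  arrayFrieze-positive i j i<j with distance (ℤₚ.<⇒≤ i<j)
  ... | zero  , j≡ = contradiction (trans j≡ (ℤₚ.+-identityʳ i)) (ℤₚ.<⇒≢ i<j ∘ sym)
  ... | suc k , refl = subst (0ℤ ℤ.<_) (sym (at i j (suc k) (lemma₀ i (+ suc k)))) (positive (i %ℕ n) k)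

  arrayFrieze-entry : ∀ m k → e (+ m) (+ (m ℕ.+ k)) ≡ E m k
  arrayFrieze-entry m k = trans (at (+ m) (+ (m ℕ.+ k)) k (lemma₀ (+ m) (+ k))) (sym (periodic-ℤ (per k) ((+ m) /ℕ n) (a≡a%ℕn+[a/ℕn]*n (+ m) n)))

  arrayFrieze-periodic : ∀ p → 1 ℕ.≤ p → (∀ k → Periodic p (λ m → E m k)) → IsPeriod arrayFrieze p
  arrayFrieze-periodic p 1≤p p-per = 1≤p , λ i j _ → trans (cong (λ z → E ((i + + p) %ℕ n) ∣ z ∣) (lemma₄ i j (+ p)))
    (trans (periodic-%ℕ (per ∣ j - i ∣) i p) (p-per ∣ j - i ∣ (i %ℕ n)))

  arrayFrieze-growth : ∀ n-1 → n ≡ suc n-1 → (∀ m → E m (2 ℕ.+ n-1) - E (1 ℕ.+ m) n-1 ≡ + 2) →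
    ∀ i → e i (i + + n + 1ℤ) - e (i + 1ℤ) (i + + n) ≡ + 2
  arrayFrieze-growth n-1 refl g i = trans (cong₂ _-_ (at i (i + + n + 1ℤ) (2 ℕ.+ n-1) (lemma₅ i (+ n-1))) (at-suc i (i + + n) n-1 (lemma₆ i (+ n-1)))) (g (i %ℕ n))
    where
    lemma₅ : ∀ i k → i + (1ℤ + k) + 1ℤ - i ≡ + 2 + k
    lemma₅ = ℤ-Solver.solve-∀
    lemma₆ : ∀ i k → i + (1ℤ + k) - (i + 1ℤ) ≡ k
    lemma₆ = ℤ-Solver.solve-∀

-- Passing from a frieze to its array

friezeArray : InfiniteFrieze → ℕ → ℕ → ℤ
friezeArray F m k = entry F (+ m) (+ (m ℕ.+ k))

module _ (F : InfiniteFrieze) where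

  private
    at : ∀ {a b c d} → a ≡ c → b ≡ d → entry F (+ a) (+ b) ≡ entry F (+ c) (+ d)
    at refl refl = refl

  friezeArray-array : PositiveIntegral F → Array (friezeArray F)
  friezeArray-array pos = record
    { diag = λ m → trans (at refl (ℕₚ.+-identityʳ m)) (entry-diagonal F (+ m))
    ; superdiag = λ m → entry-superdiagonal F (+ m)
    ; unimodular = λ m k → trans
        (cong₂ _-_ (cong (_*_ (friezeArray F m (1 ℕ.+ k))) (at (ℕₚ.+-comm 1 m) (index₁ m k))) (cong₂ _*_ (at (ℕₚ.+-comm 1 m) (sym (ℕₚ.+-suc m k))) (at {m} refl (index₂ m k))))
        (diamond F (+ m) (+ (m ℕ.+ suc k)) (ℤ.+≤+ (ℕₚ.+-monoʳ-≤ m (s≤s z≤n))))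
    ; positive = λ m k → pos (+ m) (+ (m ℕ.+ suc k)) (ℤ.+<+ (ℕₚ.m<m+n m (s≤s z≤n)))
    }
    where
    index₁ : ∀ m k → 1 ℕ.+ m ℕ.+ (1 ℕ.+ k) ≡ m ℕ.+ suc k ℕ.+ 1
    index₁ = ℕ-Solver.solve-∀
    index₂ : ∀ m k → m ℕ.+ (2 ℕ.+ k) ≡ m ℕ.+ suc k ℕ.+ 1
    index₂ = ℕ-Solver.solve-∀

  friezeArray-periodic : ∀ {p} → IsPeriod F p → ∀ k → Periodic p (λ m → friezeArray F m k)
  friezeArray-periodic {p} (_ , per) k m = trans (at refl (index m p k)) (per (+ m) (+ (m ℕ.+ k)) (ℤ.+≤+ (ℕₚ.m≤m+n m k)))
    where
    index : ∀ m p k → m ℕ.+ p ℕ.+ k ≡ m ℕ.+ k ℕ.+ p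
    index = ℕ-Solver.solve-∀

  friezeArray-growth : ∀ n-1 → (∀ i → entry F i (i + + suc n-1 + 1ℤ) - entry F (i + 1ℤ) (i + + suc n-1) ≡ + 2) →
    ∀ m → friezeArray F m (2 ℕ.+ n-1) - friezeArray F (1 ℕ.+ m) n-1 ≡ + 2
  friezeArray-growth n-1 g m = trans (cong₂ _-_ (at refl (index m n-1)) (at (ℕₚ.+-comm 1 m) (sym (ℕₚ.+-suc m n-1)))) (g (+ m))
    where
    index : ∀ m k → m ℕ.+ (2 ℕ.+ k) ≡ m ℕ.+ suc k ℕ.+ 1
    index = ℕ-Solver.solve-∀

  translate : ∀ {n} → IsPeriod F n → ∀ t {i j} → i ℤ.≤ j → entry F (i + + (t ℕ.* n)) (j + + (t ℕ.* n)) ≡ entry F i j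
  translate per zero {i} {j} i≤j = cong₂ (entry F) (ℤₚ.+-identityʳ i) (ℤₚ.+-identityʳ j)
  translate {n} per (suc t) {i} {j} i≤j = trans
    (cong₂ (entry F) (lemma i (+ n) (+ (t ℕ.* n))) (lemma j (+ n) (+ (t ℕ.* n))))
    (trans (proj₂ per (i + + (t ℕ.* n)) (j + + (t ℕ.* n)) (ℤₚ.+-monoˡ-≤ (+ (t ℕ.* n)) i≤j)) (translate per t i≤j))
    where
    lemma : ∀ i n a → i + (n + a) ≡ i + a + n
    lemma = ℤ-Solver.solve-∀

  translate-ℤ : ∀ {n} → IsPeriod F n → ∀ z {i j} → i ℤ.≤ j → entry F (i + z * + n) (j + z * + n) ≡ entry F i j
  translate-ℤ {n} per (+ t) {i} {j} i≤j rewrite sym (ℤₚ.pos-* t n) = translate per t i≤j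
  translate-ℤ {n} per -[1+ t ] {i} {j} i≤j = trans
    (sym (translate per (suc t) (ℤₚ.+-monoˡ-≤ (-[1+ t ] * + n) i≤j)))
    (cong₂ (entry F) (back i) (back j))
    where
    lemma : ∀ i k n → i + - k * n + k * n ≡ i
    lemma = ℤ-Solver.solve-∀
    back : ∀ i → i + -[1+ t ] * + n + + (suc t ℕ.* n) ≡ i
    back i = trans (cong (_+_ (i + -[1+ t ] * + n)) (ℤₚ.pos-* (suc t) n)) (lemma i (+ suc t) (+ n))

nonNegative-translate : ∀ n .{{_ : NonZero n}} i → ∃ λ m → i + + (∣ i ∣ ℕ.* n) ≡ + m
nonNegative-translate n (+ a)      = a ℕ.+ a ℕ.* n , refl
nonNegative-translate (suc n) -[1+ a ] = suc a ℕ.* n , trans (cong (_+_ -[1+ a ]) (trans (cong +_ (ℕₚ.*-suc (suc a) n)) (ℤₚ.pos-+ (suc a) (suc a ℕ.* n)))) (lemma (+ suc a) (+ (suc a ℕ.* n)))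
  where
  lemma : ∀ a b → - a + (a + b) ≡ b
  lemma = ℤ-Solver.solve-∀

module _ {n : ℕ} .{{_ : NonZero n}} (F G : InfiniteFrieze) where

  -- Arrays have only nonnegative rows; a translation by ∣ i ∣ periods moves the row i there, and
  -- periodicity of both friezes permits it.
  shift-from-quiddity : PositiveIntegral F → PositiveIntegral G → IsPeriod F n → IsPeriod G n → ∀ s →
    (∀ m → friezeArray G m 2 ≡ friezeArray F (m ℕ.+ s) 2) →
    ∀ i j → i ℤ.≤ j → entry G i j ≡ entry F (i + + s) (j + + s)
  shift-from-quiddity F-pos G-pos F-per G-per s e i j i≤j with distance i≤j | nonNegative-translate n i
  ... | k , refl | m , i+tn≡m = begin
    entry G i (i + + k) ≡⟨ sym (translate G G-per ∣ i ∣ i≤j) ⟩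
    entry G (i + T) (i + + k + T) ≡⟨ cong₂ (entry G) i+tn≡m (trans (lemma i (+ k) T) (cong (_+ + k) i+tn≡m)) ⟩
    friezeArray G m k ≡⟨ proj₁ (array-determined (friezeArray-array F F-pos) (friezeArray-array G G-pos) s e k m) ⟩
    friezeArray F (m ℕ.+ s) k ≡⟨ cong₂ (entry F) (trans (cong (_+ + s) (sym i+tn≡m)) (lemma i T (+ s)))
                                                                   (trans (cong (λ z → z + + s + + k) (sym i+tn≡m)) (lemma′ i T (+ s) (+ k))) ⟩
    entry F (i + + s + T) (i + + k + + s + T) ≡⟨ translate F F-per ∣ i ∣ (ℤₚ.+-monoˡ-≤ (+ s) i≤j) ⟩
    entry F (i + + s) (i + + k + + s) ∎
    where
    open ≡-Reasoning
    T : ℤ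
    T = + (∣ i ∣ ℕ.* n)
    lemma : ∀ a b c → a + b + c ≡ a + c + b
    lemma = ℤ-Solver.solve-∀
    lemma′ : ∀ a b c d → a + b + c + d ≡ a + d + c + b
    lemma′ = ℤ-Solver.solve-∀

  quiddity-from-shift : IsPeriod F n → ∀ z → (∀ i j → i ℤ.≤ j → entry G i j ≡ entry F (i + z) (j + z)) →
    ∀ m k → friezeArray G m k ≡ friezeArray F (m ℕ.+ z %ℕ n) k
  quiddity-from-shift F-per z e m k = begin
    entry G (+ m) (+ (m ℕ.+ k)) ≡⟨ e (+ m) (+ (m ℕ.+ k)) m≤m+k ⟩
    entry F (+ m + z) (+ (m ℕ.+ k) + z) ≡⟨ cong₂ (entry F) (reduce (+ m)) (reduce (+ (m ℕ.+ k))) ⟩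
    entry F (+ m + + r + z /ℕ n * + n) (+ (m ℕ.+ k) + + r + z /ℕ n * + n)
      ≡⟨ translate-ℤ F F-per (z /ℕ n) (ℤₚ.+-monoˡ-≤ (+ r) m≤m+k) ⟩
    entry F (+ (m ℕ.+ r)) (+ (m ℕ.+ k ℕ.+ r)) ≡⟨ cong (λ a → entry F (+ (m ℕ.+ r)) (+ a)) (index m k r) ⟩
    entry F (+ (m ℕ.+ r)) (+ (m ℕ.+ r ℕ.+ k)) ∎
    where
    open ≡-Reasoning
    r : ℕ
    r = z %ℕ n
    m≤m+k : + m ℤ.≤ + (m ℕ.+ k)
    m≤m+k = ℤ.+≤+ (ℕₚ.m≤m+n m k)
    reduce : ∀ x → x + z ≡ x + + r + z /ℕ n * + n
    reduce x = trans (cong (_+_ x) (a≡a%ℕn+[a/ℕn]*n z n)) (sym (ℤₚ.+-assoc x (+ r) _))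
    index : ∀ m k r → m ℕ.+ k ℕ.+ r ≡ m ℕ.+ r ℕ.+ k
    index = ℕ-Solver.solve-∀

-- Enumeration

module _ {A : Set} {P : A → A → Set} (P-sym : ∀ {x y} → P x y → P y x) where

  AllPairs-lookup : ∀ {xs} → AllPairs P xs → ∀ i j → i ≢ j → P (lookup xs i) (lookup xs j)
  AllPairs-lookup (px AllPairs.∷ ps) Fin.zero    Fin.zero    i≢j = contradiction refl i≢j
  AllPairs-lookup (px AllPairs.∷ ps) Fin.zero    (Fin.suc j) i≢j = All.lookup px (∈-lookup j)
  AllPairs-lookup (px AllPairs.∷ ps) (Fin.suc i) Fin.zero    i≢j = P-sym (All.lookup px (∈-lookup i))
  AllPairs-lookup (px AllPairs.∷ ps) (Fin.suc i) (Fin.suc j) i≢j = AllPairs-lookup ps i j (i≢j ∘ cong Fin.suc)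

∑L-filter : ∀ {A : Set} {P : A → Set} (P? : ∀ x → Dec (P x)) xs (f : A → ℤ) → (∀ {x} → ¬ P x → f x ≡ 0ℤ) → ∑L (filter P? xs) f ≡ ∑L xs f
∑L-filter P? []       f e = refl
∑L-filter P? (x ∷ xs) f e with P? x
... | yes _ = cong (_+_ (f x)) (∑L-filter P? xs f e)
... | no ¬p = trans (∑L-filter P? xs f e) (trans (sym (ℤₚ.+-identityˡ _)) (cong (_+ ∑L xs f) (sym (e ¬p))))

module _ {A : Set} {R : A → A → Set} (R? : ∀ x y → Dec (R x y))
  (R-refl : ∀ {x} → R x x) (R-sym : ∀ {x y} → R x y → R y x) (R-trans : ∀ {x y z} → R x y → R y z → R x z) where

  representatives-distinct : ∀ xs → AllPairs (λ x y → ¬ R x y) (deduplicate R? xs)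
  representatives-distinct []       = AllPairs.[]
  representatives-distinct (x ∷ xs) = All.all-filter _ (deduplicate R? xs) AllPairs.∷ AllPairs.filter⁺ _ (representatives-distinct xs)

  representative : ∀ xs {y} → y ∈ xs → ∃ λ r → r ∈ deduplicate R? xs × R r y
  representative (x ∷ xs) (here refl) = x , here refl , R-refl
  representative (x ∷ xs) {y} (there y∈) with r , r∈ , Rry ← representative xs y∈ with R? x r
  ... | yes Rxr = x , here refl , R-trans Rxr Rry
  ... | no ¬Rxr = r , there (∈-filter⁺ _ r∈ ¬Rxr) , Rry

  -- If x is related to y, the filter has removed every other representative of y; if not, it
  -- removes none of them.
  representative-unique : ∀ xs {y} → y ∈ xs → ∑L (deduplicate R? xs) (λ r → χ (R? r y)) ≡ 1ℤ
  representative-unique (x ∷ xs) {y} y∈ with R? x y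
  ... | yes Rxy = trans (cong (_+_ 1ℤ) (trans
      (∑L-cong (filter (¬? ∘ R? x) (deduplicate R? xs)) (λ {r} r∈ → χ-no (R? r y) (λ Rry → proj₂ (∈-filter⁻ (¬? ∘ R? x) {xs = deduplicate R? xs} r∈) (R-trans Rxy (R-sym Rry)))))
      (∑L-zero (filter (¬? ∘ R? x) (deduplicate R? xs))))) refl
  ... | no ¬Rxy = trans (ℤₚ.+-identityˡ _) (trans
      (∑L-filter (¬? ∘ R? x) (deduplicate R? xs) (λ r → χ (R? r y)) (λ {r} ¬¬Rxr → χ-no (R? r y) (λ Rry → ¬¬Rxr (λ Rxr → ¬Rxy (R-trans Rxr Rry)))))
      (representative-unique xs (tail y∈)))
    where
    tail : y ∈ x ∷ xs → y ∈ xs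
    tail (here refl) = contradiction R-refl ¬Rxy
    tail (there y∈) = y∈

  -- Double counting of the pairs of a representative and a member of its class.
  length-classes : ∀ n xs → (∀ {x} → x ∈ xs → length (filter (R? x) xs) ≡ n) → + length xs ≡ + length (deduplicate R? xs) * + n
  length-classes n xs class = begin
    + length xs ≡⟨ sym (trans (∑L-const xs 1ℤ) (ℤₚ.*-identityʳ _)) ⟩
    ∑L xs (λ _ → 1ℤ) ≡⟨ ∑L-cong xs (λ y∈ → sym (representative-unique xs y∈)) ⟩
    ∑L xs (λ y → ∑L reps (λ r → χ (R? r y))) ≡⟨ ∑L-swap xs reps (λ y r → χ (R? r y)) ⟩
    ∑L reps (λ r → ∑L xs (λ y → χ (R? r y))) ≡⟨ ∑L-cong reps (λ {r} r∈ → trans (sym (length-filter-χ (R? r) xs)) (cong +_ (class (∈-deduplicate⁻ R? xs r∈)))) ⟩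
    ∑L reps (λ _ → + n) ≡⟨ ∑L-const reps (+ n) ⟩
    + length reps * + n ∎
    where
    open ≡-Reasoning
    reps : List A
    reps = deduplicate R? xs

enumeration : (S : Setoid 0ℓ 0ℓ) → ∀ {m} (fs : Fin m → Setoid.Carrier S) →
  (∀ i j → Setoid._≈_ S (fs i) (fs j) → i ≡ j) → (∀ x → ∃ λ i → Setoid._≈_ S (fs i) x) → Inverse S (≡.setoid (Fin m))
enumeration S fs injective surjective = record
  { to        = λ x → proj₁ (surjective x)
  ; from      = fs
  ; to-cong   = λ {x} {y} x≈y → injective _ _ (≈.trans (proj₂ (surjective x)) (≈.trans x≈y (≈.sym (proj₂ (surjective y)))))
  ; from-cong = λ { refl → ≈.refl }
  ; inverse   = (λ {i} {x} x≈fi → injective _ _ (≈.trans (proj₂ (surjective x)) x≈fi)) ,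
                (λ { {x} refl → proj₂ (surjective x) })
  }
  where module ≈ = Setoid S

-- Friezes and primitive words

module _ (n-1 : ℕ) where

  private
    n : ℕ
    n = suc n-1

  -- The period hidden in `growth` is itself minimal, hence equal to n.
  growth-period : (F : CountedFrieze n) → ∀ i → entry (frieze F) i (i + + n + 1ℤ) - entry (frieze F) (i + 1ℤ) (i + + n) ≡ + 2
  growth-period F with p , (p-per , p-min) , g ← growth F
    with refl ← ℕₚ.≤-antisym (p-min n (proj₁ (minimalPeriod F))) (proj₂ (minimalPeriod F) p p-per) = g

  solvedOf : CountedFrieze n → Solved n
  solvedOf F = solved (friezeArray-array (frieze F) (positiveIntegral F))
    (friezeArray-periodic (frieze F) (proj₁ (minimalPeriod F))) (friezeArray-growth (frieze F) n-1 (growth-period F))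

  codeOfFrieze : CountedFrieze n → ℕ → ℕ
  codeOfFrieze F = Solved.c (solvedOf F)

  +quiddity : ∀ F m → + Solved.q (solvedOf F) m ≡ friezeArray (frieze F) m 2
  +quiddity F m = ℤₚ.0≤i⇒+∣i∣≡i (ℤₚ.<⇒≤ (Array.positive (friezeArray-array (frieze F) (positiveIntegral F)) m 1))

  code-shift⇒frieze-shift : ∀ F G s → (∀ m → codeOfFrieze G m ≡ codeOfFrieze F (m ℕ.+ s)) →
    ∀ i j → i ℤ.≤ j → entry (frieze G) i j ≡ entry (frieze F) (i + + s) (j + + s)
  code-shift⇒frieze-shift F G s e = shift-from-quiddity (frieze F) (frieze G) (positiveIntegral F) (positiveIntegral G)
    (proj₁ (minimalPeriod F)) (proj₁ (minimalPeriod G)) s (λ m → trans (sym (+quiddity G m))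
      (trans (cong +_ (same-code⇒same-quiddity (solvedOf G) (shiftSolved s (solvedOf F)) e m)) (+quiddity F (m ℕ.+ s))))

  frieze-shift⇒code-shift : ∀ F G z → (∀ i j → i ℤ.≤ j → entry (frieze G) i j ≡ entry (frieze F) (i + z) (j + z)) →
    ∀ m → codeOfFrieze G m ≡ codeOfFrieze F (m ℕ.+ z %ℕ n)
  frieze-shift⇒code-shift F G z e = same-quiddity⇒same-code (solvedOf G) (shiftSolved (z %ℕ n) (solvedOf F))
    (λ m → cong ∣_∣ (quiddity-from-shift (frieze F) (frieze G) (proj₁ (minimalPeriod F)) z e m 2))

  code⇒≈ : ∀ F G → (∀ m → codeOfFrieze F m ≡ codeOfFrieze G m) → frieze F ≈ frieze G
  code⇒≈ F G e i j i≤j = trans (code-shift⇒frieze-shift G F 0 (λ m → trans (e m) (cong (codeOfFrieze G) (sym (ℕₚ.+-identityʳ m)))) i j i≤j)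
    (cong₂ (entry (frieze G)) (ℤₚ.+-identityʳ i) (ℤₚ.+-identityʳ j))

  ≈⇒code : ∀ F G → frieze F ≈ frieze G → ∀ m → codeOfFrieze F m ≡ codeOfFrieze G m
  ≈⇒code F G e = same-quiddity⇒same-code (solvedOf F) (solvedOf G) (λ m → cong ∣_∣ (e (+ m) (+ (m ℕ.+ 2)) (ℤ.+≤+ (ℕₚ.m≤m+n m 2))))

  codeWord : CountedFrieze n → List ℕ
  codeWord F = applyUpTo (codeOfFrieze F) n

  ext-codeWord : ∀ F i → ext n (codeWord F) i ≡ codeOfFrieze F i
  ext-codeWord F = ext-applyUpTo n (Solved.c-per (solvedOf F))

  codeWord-primitive : ∀ F → codeWord F ∈ primitiveWords n
  codeWord-primitive F = ∈-filter⁺ (isPrimitive? n) (wordsBelow-complete n n (length-applyUpTo c n) sum<n) prim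
    where
    open Solved (solvedOf F)
    sum<n : sum (codeWord F) ℕ.< n
    sum<n = subst (ℕ._< n) (sym (psum≡rsum c 0 n)) (code-sum<n u-pos (Solves⇒Divisible {q} {u} u-solves) (codeOf-isCode u-pos) u-per c-per)
    prim : IsPrimitive n (ext n (codeWord F))
    -- A period p of the code makes the frieze equal to its own shift by p.
    prim p 1≤p per = proj₂ (minimalPeriod F) p (1≤p , λ i j i≤j → sym (code-shift⇒frieze-shift F F p
      (λ m → trans (sym (ext-codeWord F m)) (trans (sym (per m)) (ext-codeWord F (m ℕ.+ p)))) i j i≤j))

  module _ (w : List ℕ) (w∈ : w ∈ primitiveWords n) where

    private
      w-sound : length w ≡ n × sum w ℕ.< n
      w-sound = wordsBelow-sound n n {w} (proj₁ (∈-filter⁻ (isPrimitive? n) {xs = wordsBelow n n} w∈))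
      L : Labelling n (ext n w)
      L = labelling (ext-periodic n w) (subst (ℕ._< n) (trans (cong sum (sym (applyUpTo-ext n {w} (proj₁ w-sound)))) (psum≡rsum (ext n w) 0 n)) (proj₂ w-sound))
      open Labelling L
      R : Solved n
      R = record { q = quiddityOf label ; u = label ; q-per = quiddityOf-periodic periodic ; u-pos = positive
                 ; u-solves = quiddityOf-solves positive divisible ; u-per = periodic }
      c≡ext : ∀ i → Solved.c R i ≡ ext n w i
      c≡ext i = quotient-unique (proj₁ (codeOf-isCode positive i)) (proj₂ (codeOf-isCode positive i)) (proj₁ (isCode i)) (proj₂ (isCode i))
      D : InfiniteFrieze
      D = arrayFrieze (E-array R) (E-periodic R)
      D-quiddity : ∀ m → friezeArray D m 2 ≡ + Solved.q R m
      D-quiddity m = trans (arrayFrieze-entry (E-array R) (E-periodic R) m 2) (trans (lemma (+ Solved.q R (m ℕ.+ 0))) (cong (λ i → + Solved.q R i) (ℕₚ.+-identityʳ m)))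
        where
        lemma : ∀ x → x * 1ℤ - 0ℤ ≡ x
        lemma = ℤ-Solver.solve-∀
      D-minimal : IsMinimalPeriod D n
      -- A period of the frieze is one of its quiddity, hence one of the code, and the code is the
      -- primitive word.
      D-minimal = arrayFrieze-periodic (E-array R) (E-periodic R) n (s≤s z≤n) (E-periodic R) , λ p p-per →
        proj₂ (∈-filter⁻ (isPrimitive? n) {xs = wordsBelow n n} w∈) p (proj₁ p-per) (λ i → trans (sym (c≡ext (i ℕ.+ p)))
          (trans (same-quiddity⇒same-code (shiftSolved p R) R (λ m → ℤₚ.+-injective
            (trans (sym (D-quiddity (m ℕ.+ p))) (trans (friezeArray-periodic D p-per 2 m) (D-quiddity m)))) i) (c≡ext i)))

    decode : CountedFrieze n
    decode = record
      { frieze           = D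
      ; positiveIntegral = arrayFrieze-positive (E-array R) (E-periodic R)
      ; minimalPeriod    = D-minimal
      ; growth           = n , D-minimal , arrayFrieze-growth (E-array R) (E-periodic R) n-1 refl (E-growth R n-1 refl)
      }

    code-decode : ∀ i → codeOfFrieze decode i ≡ ext n w i
    code-decode i = trans (same-quiddity⇒same-code (solvedOf decode) R (λ m → cong ∣_∣ (D-quiddity m)) i) (c≡ext i)

  record Rotated (w v : List ℕ) : Set where
    constructor rotatedBy
    field
      offset : ℕ
      rotated : ∀ i → ext n v i ≡ ext n w (i ℕ.+ offset)

  Rotated? : ∀ w v → Dec (Rotated w v)
  -- The list v is arbitrary, so `rotate n 0 v` first normalises it to length n.
  Rotated? w v with ℕₚ.anyUpTo? (λ s → ≡-dec ℕₚ._≟_ (rotate n 0 v) (rotate n s w)) n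
  ... | yes (s , _ , e) = yes (rotatedBy s λ i → begin
    ext n v i ≡⟨ cong (ext n v) (sym (ℕₚ.+-identityʳ i)) ⟩
    ext n v (i ℕ.+ 0) ≡⟨ sym (ext-rotate n 0 v i) ⟩
    ext n (rotate n 0 v) i ≡⟨ cong (λ x → ext n x i) e ⟩
    ext n (rotate n s w) i ≡⟨ ext-rotate n s w i ⟩
    ext n w (i ℕ.+ s)          ∎)
    where open ≡-Reasoning
  ... | no none = no (λ (rotatedBy s e) → none (s % n , m%n<n s n , applyUpTo-cong< n (λ i _ → trans (cong (ext n v) (ℕₚ.+-identityʳ i)) (trans (e i) (sym (shift-% n (ext-periodic n w) s i))))))

  Rotated-refl : ∀ {w} → Rotated w w
  Rotated-refl {w} = rotatedBy 0 (λ i → cong (ext n w) (sym (ℕₚ.+-identityʳ i)))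

  Rotated-sym : ∀ {w v} → Rotated w v → Rotated v w
  -- Modulo n, the offset -s is s (n - 1).
  Rotated-sym {w} {v} (rotatedBy s e) = rotatedBy (s ℕ.* n-1) (λ i → sym (trans (e (i ℕ.+ s ℕ.* n-1)) (trans (cong (ext n w) (lemma i s n-1)) (Periodic-* (ext-periodic n w) s i))))
    where
    lemma : ∀ i s k → i ℕ.+ s ℕ.* k ℕ.+ s ≡ i ℕ.+ s ℕ.* suc k
    lemma = ℕ-Solver.solve-∀

  Rotated-trans : ∀ {w v x} → Rotated w v → Rotated v x → Rotated w x
  Rotated-trans {w} (rotatedBy s e) (rotatedBy s′ e′) = rotatedBy (s′ ℕ.+ s) (λ i → trans (e′ i) (trans (e (i ℕ.+ s′)) (cong (ext n w) (ℕₚ.+-assoc i s′ s))))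

  primitive-sound : ∀ {w} → w ∈ primitiveWords n → (length w ≡ n × sum w ℕ.< n) × IsPrimitive n (ext n w)
  primitive-sound {w} w∈ with w∈′ , prim ← ∈-filter⁻ (isPrimitive? n) {xs = wordsBelow n n} w∈ = wordsBelow-sound n n {w} w∈′ , prim

  rotate-primitive : ∀ s {w} → w ∈ primitiveWords n → rotate n s w ∈ primitiveWords n
  rotate-primitive s {w} w∈ with (len , sum<n) , prim ← primitive-sound {w} w∈ =
    ∈-filter⁺ (isPrimitive? n) (wordsBelow-complete n n (length-rotate n s w) (subst (ℕ._< n) (sym sum-rotate) sum<n)) (λ p 1≤p per → prim p 1≤p (unrotate p per))
    where
    open ≡-Reasoning
    sum-rotate : sum (rotate n s w) ≡ sum w
    sum-rotate = begin
      psum (λ i → ext n w (i ℕ.+ s)) n ≡⟨ psum-cong< n (λ i _ → cong (ext n w) (ℕₚ.+-comm i s)) ⟩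
      psum (λ i → ext n w (s ℕ.+ i)) n ≡⟨ psum≡rsum (ext n w) s n ⟩
      rsum (ext n w) s n ≡⟨ rsum-shift (ext-periodic n w) s ⟩
      rsum (ext n w) 0 n ≡⟨ sym (psum≡rsum (ext n w) 0 n) ⟩
      psum (ext n w) n ≡⟨ cong sum (applyUpTo-ext n {w} (proj₁ (proj₁ (primitive-sound {w} w∈)))) ⟩
      sum w ∎
    unrotate : ∀ p → Periodic p (ext n (rotate n s w)) → Periodic p (ext n w)
    unrotate p per i with rotatedBy s′ e ← Rotated-sym {w} {rotate n s w} (rotatedBy s (ext-rotate n s w)) =
      trans (e (i ℕ.+ p)) (trans (cong (ext n (rotate n s w)) (lemma i p s′)) (trans (per (i ℕ.+ s′)) (sym (e i))))
      where
      lemma : ∀ i p s → i ℕ.+ p ℕ.+ s ≡ i ℕ.+ s ℕ.+ p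
      lemma = ℕ-Solver.solve-∀

  -- Equal rotations by i and j would make j - i a positive period below n. The offset i (n - 1)
  -- undoes the rotation by i within ℕ.
  rotations-distinct : ∀ {w} → w ∈ primitiveWords n → ∀ {i j} → i ℕ.< j → j ℕ.< n → rotate n i w ≢ rotate n j w
  rotations-distinct {w} w∈ {i} {j} i<j j<n e = ℕₚ.<⇒≱ (ℕₚ.≤-<-trans (ℕₚ.m∸n≤m j i) j<n)
    (proj₂ (primitive-sound {w} w∈) (j ∸ i) (ℕₚ.m<n⇒0<n∸m i<j) (λ m → begin
      ext n w (m ℕ.+ (j ∸ i)) ≡⟨ sym (Periodic-* (ext-periodic n w) i (m ℕ.+ (j ∸ i))) ⟩
      ext n w (m ℕ.+ (j ∸ i) ℕ.+ i ℕ.* n) ≡⟨ cong (ext n w) (trans (lemma₁ m (j ∸ i) i n-1) (cong (ℕ._+_ (m ℕ.+ i ℕ.* n-1)) (ℕₚ.m∸n+n≡m (ℕₚ.<⇒≤ i<j)))) ⟩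
      ext n w (m ℕ.+ i ℕ.* n-1 ℕ.+ j) ≡⟨ sym (ext-rotate n j w (m ℕ.+ i ℕ.* n-1)) ⟩
      ext n (rotate n j w) (m ℕ.+ i ℕ.* n-1) ≡⟨ cong (λ v → ext n v (m ℕ.+ i ℕ.* n-1)) (sym e) ⟩
      ext n (rotate n i w) (m ℕ.+ i ℕ.* n-1) ≡⟨ ext-rotate n i w (m ℕ.+ i ℕ.* n-1) ⟩
      ext n w (m ℕ.+ i ℕ.* n-1 ℕ.+ i) ≡⟨ cong (ext n w) (lemma₂ m i n-1) ⟩
      ext n w (m ℕ.+ i ℕ.* n) ≡⟨ Periodic-* (ext-periodic n w) i m ⟩
      ext n w m                                      ∎))
    where
    open ≡-Reasoning
    lemma₁ : ∀ m d i k → m ℕ.+ d ℕ.+ i ℕ.* suc k ≡ m ℕ.+ i ℕ.* k ℕ.+ (d ℕ.+ i)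
    lemma₁ = ℕ-Solver.solve-∀
    lemma₂ : ∀ m i k → m ℕ.+ i ℕ.* k ℕ.+ i ≡ m ℕ.+ i ℕ.* suc k
    lemma₂ = ℕ-Solver.solve-∀

  same-ext : ∀ {w v} → length w ≡ n → length v ≡ n → (∀ i → ext n w i ≡ ext n v i) → w ≡ v
  same-ext {w} {v} lw lv e = trans (sym (applyUpTo-ext n {w} lw)) (trans (applyUpTo-cong< n (λ i _ → e i)) (applyUpTo-ext n {v} lv))

  primitiveWords-unique : Unique (primitiveWords n)
  primitiveWords-unique = Unique.filter⁺ (isPrimitive? n) (wordsBelow-unique n n)

  length-rotation-class : ∀ {w} → w ∈ primitiveWords n → length (filter (Rotated? w) (primitiveWords n)) ≡ n
  length-rotation-class {w} w∈ = trans
    (length-unique (Unique.filter⁺ (Rotated? w) primitiveWords-unique) (Unique.applyUpTo⁺₁ rotation n (rotations-distinct w∈)) to from)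
    (length-applyUpTo rotation n)
    where
    rotation : ℕ → List ℕ
    rotation s = rotate n s w
    to : ∀ {v} → v ∈ filter (Rotated? w) (primitiveWords n) → v ∈ applyUpTo rotation n
    to {v} v∈ with v∈′ , rotatedBy s e ← ∈-filter⁻ (Rotated? w) {xs = primitiveWords n} v∈ =
      subst (_∈ applyUpTo rotation n) (same-ext {rotation (s % n)} {v} (length-rotate n (s % n) w) (proj₁ (proj₁ (primitive-sound {v} v∈′))) (λ i → begin
        ext n (rotation (s % n)) i ≡⟨ ext-rotate n (s % n) w i ⟩
        ext n w (i ℕ.+ s % n) ≡⟨ shift-% n (ext-periodic n w) s i ⟩
        ext n w (i ℕ.+ s) ≡⟨ sym (e i) ⟩
        ext n v i                                  ∎)) (∈-applyUpTo⁺ rotation (m%n<n s n))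
      where open ≡-Reasoning
    from : ∀ {v} → v ∈ applyUpTo rotation n → v ∈ filter (Rotated? w) (primitiveWords n)
    from {v} v∈ with s , _ , refl ← ∈-applyUpTo⁻ rotation v∈ =
      ∈-filter⁺ (Rotated? w) (rotate-primitive s {w} w∈) (rotatedBy s (ext-rotate n s w))

  representatives : List (List ℕ)
  representatives = deduplicate Rotated? (primitiveWords n)

  length-representatives : + length (primitiveWords n) ≡ + length representatives * + n
  length-representatives = length-classes Rotated? Rotated-refl Rotated-sym Rotated-trans n (primitiveWords n) length-rotation-class

  friezes-enumerated : Inverse (Friezes n) (≡.setoid (Fin (length (primitiveWords n))))
  friezes-enumerated = enumeration (Friezes n) fs injective surjective
    where
    fs : Fin (length (primitiveWords n)) → CountedFrieze n
    fs i = decode (lookup (primitiveWords n) i) (∈-lookup i)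
    injective : ∀ i j → frieze (fs i) ≈ frieze (fs j) → i ≡ j
    injective i j e = decidable-stable (i Finₚ.≟ j) (λ i≢j → AllPairs-lookup {P = _≢_} (_∘ sym) primitiveWords-unique i j i≢j
      (same-ext {lookup (primitiveWords n) i} {lookup (primitiveWords n) j}
        (proj₁ (proj₁ (primitive-sound {lookup (primitiveWords n) i} (∈-lookup i)))) (proj₁ (proj₁ (primitive-sound {lookup (primitiveWords n) j} (∈-lookup j))))
        (λ m → trans (sym (code-decode (lookup (primitiveWords n) i) (∈-lookup i) m)) (trans (≈⇒code (fs i) (fs j) e m) (code-decode (lookup (primitiveWords n) j) (∈-lookup j) m)))))
    surjective : ∀ F → ∃ λ i → frieze (fs i) ≈ frieze F
    surjective F = i , code⇒≈ (fs i) F (λ m → trans (code-decode (lookup (primitiveWords n) i) (∈-lookup i) m) (trans (cong (λ w → ext n w m) (sym (lookup-index (codeWord-primitive F)))) (ext-codeWord F m)))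
      where
      i : Fin (length (primitiveWords n))
      i = Any.index (codeWord-primitive F)

  friezes-up-to-shift-enumerated : Inverse (FriezesUpToShift n) (≡.setoid (Fin (length representatives)))
  friezes-up-to-shift-enumerated = enumeration (FriezesUpToShift n) fs injective surjective
    where
    r∈ : ∀ i → lookup representatives i ∈ primitiveWords n
    r∈ i = ∈-deduplicate⁻ Rotated? (primitiveWords n) (∈-lookup i)
    fs : Fin (length representatives) → CountedFrieze n
    fs i = decode (lookup representatives i) (r∈ i)
    injective : ∀ i j → frieze (fs i) ≈-upToShift frieze (fs j) → i ≡ j
    injective i j (z , e) = decidable-stable (i Finₚ.≟ j) (λ i≢j →
      AllPairs-lookup {P = λ w v → ¬ Rotated w v} (λ ¬r r → ¬r (Rotated-sym r))
        (representatives-distinct Rotated? Rotated-refl Rotated-sym Rotated-trans (primitiveWords n)) i j i≢j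
        (rotatedBy (z %ℕ n) (λ m → trans (sym (code-decode (lookup representatives j) (r∈ j) m))
          (trans (frieze-shift⇒code-shift (fs i) (fs j) z e m) (code-decode (lookup representatives i) (r∈ i) (m ℕ.+ z %ℕ n))))))
    representedBy : ∀ F → (∃ λ r → r ∈ representatives × Rotated r (codeWord F)) → ∃ λ i → frieze (fs i) ≈-upToShift frieze F
    representedBy F (r , r∈′ , rotatedBy s e) = i , + s , code-shift⇒frieze-shift (fs i) F s (λ m → begin
        codeOfFrieze F m ≡⟨ sym (ext-codeWord F m) ⟩
        ext n (codeWord F) m ≡⟨ e m ⟩
        ext n r (m ℕ.+ s) ≡⟨ cong (λ w → ext n w (m ℕ.+ s)) (lookup-index r∈′) ⟩
        ext n (lookup representatives i) (m ℕ.+ s) ≡⟨ sym (code-decode (lookup representatives i) (r∈ i) (m ℕ.+ s)) ⟩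
        codeOfFrieze (fs i) (m ℕ.+ s)                ∎)
      where
      open ≡-Reasoning
      i : Fin (length representatives)
      i = Any.index r∈′
    surjective : ∀ F → ∃ λ i → frieze (fs i) ≈-upToShift frieze F
    surjective F = representedBy F (representative Rotated? Rotated-refl Rotated-sym Rotated-trans (primitiveWords n) (codeWord-primitive F))

theorem4p21 : ∀ (n : ℕ) .{{_ : NonZero n}} (t̃ : Poly) → IsReducedT n t̃ →
    NumberOfElements (FriezesUpToShift n) (linearCoefficientMod n t̃)
    × NumberOfElements (Friezes n) (+ n * (linearCoefficientMod n t̃))
theorem4p21 n@(suc n-1) t̃ red =
  (length (representatives n-1) , representatives≡ , friezes-up-to-shift-enumerated n-1) ,
  (length (primitiveWords n) , length-primitiveWords n t̃ red , friezes-enumerated n-1)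
  where
  representatives≡ : + length (representatives n-1) ≡ linearCoefficientMod n t̃
  -- Every rotation class has n words, so the factor n cancels from the count of all primitive
  -- words.
  representatives≡ = ℤₚ.*-cancelˡ-≡ (+ n) _ _ (trans (ℤₚ.*-comm (+ n) _) (trans (sym (length-representatives n-1)) (length-primitiveWords n t̃ red)))
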